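{- For every integer $n\ge 1$, the Ehrhart polynomial $H_{3,n}$ has all its complex roots on the line $R=\{z\in\mathbb{C}:\operatorname{Re}(z)=-\tfrac12\}$ and is $R$-interlaced by $H_{2,n}$.
   Context: For a finite simple undirected graph $G=(V,E)$, let $\mathbb{Z}^{|V|}$ be the lattice with basis $(e_v)_{v\in V}$. The symmetric edge polytope $P_G\subset\mathbb{R}^{|V|}$ is the convex hull of all vectors $e_{v_1}-e_{v_2}$ with $\{v_1,v_2\}\in E$ (both orders). The Ehrhart polynomial $H_G$ is the polynomial with $H_G(s)=|sP_G\cap\mathbb{Z}^{|V|}|$ for all integers $s\ge 0$. For the complete bipartite graph $K_{a,b}$ with parts of sizes $a$ and $b$, write $H_{a,b}=H_{K_{a,b}}$. Interlacing: let $L=\alpha+\mathbb{R}\beta$ be a line in $\mathbb{C}$ ($\alpha,\beta\in\mathbb{C}$, $\beta\ne0$), and let $f,g\in\mathbb{C}[x]$ with $m=\deg f=\deg g+1$ have all their zeros on $L$. Let $\alpha+t_1\beta,\dots,\alpha+t_m\beta$ and $\alpha+s_1\beta,\dots,\alpha+s_{m-1}\beta$ ($t_i,s_j\in\mathbb{R}$) be the zeros of $f$ and $g$, listed with multiplicity. Then $f$ is $L$-interlaced by $g$ (equivalently, $g$ $L$-interlaces $f$) if, after relabeling, $t_1\le s_1\le t_2\le\cdots\le t_{m-1}\le s_{m-1}\le t_m$. -}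

module Defs where

open import Data.Bool.Base using (if_then_else_)
open import Data.Empty using (⊥)
open import Data.Fin.Base using (Fin; inject₁; splitAt)
open import Data.Fin.Properties using () renaming (_≟_ to _≟ᶠ_)
open import Data.Integer.Base using (ℤ; +_)
open import Data.List.Base using (List; []; _∷_; length)
import Data.List.Base as List
open import Data.List.Membership.Propositional using (_∈_)
open import Data.List.Relation.Unary.Unique.Propositional using (Unique)
open import Data.Nat.Base as ℕ using (ℕ; zero; suc)
import Data.Nat.Properties as ℕ
open import Data.Product.Base using (∃-syntax; Σ-syntax; _×_; _,_)
open import Data.Rational.Base as ℚ using (ℚ; 0ℚ; 1ℚ; ½)
import Data.Rational.Properties as ℚ
open import Data.Rational.Solver using (module +-*-Solver)
open import Data.Sum.Base using (_⊎_; inj₁; inj₂)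
open import Data.Unit.Base using (⊤; tt)
open import Data.Vec.Base using (Vec; lookup)
open import Data.Vec.Functional using (Vector; foldr)
open import Function.Base using (_∘_)
open import Function.Bundles using (_⇔_)
open import Level using (0ℓ)
open import Relation.Binary.Core using (Rel)
open import Relation.Binary.Definitions using (Symmetric; Irreflexive)
open import Relation.Binary.PropositionalEquality
  using (_≡_; refl; sym; trans; cong; subst)
open import Relation.Nullary.Decidable.Core using (does)
open import Relation.Unary using (Pred)

-- Real numbers: Cauchy sequences of rationals, compared by ≈ʳ.  All
-- arithmetic is termwise on the underlying sequences.

Cauchy : (ℕ → ℚ) → Set
Cauchy x = ∀ ε → 0ℚ ℚ.< ε → ∃[ N ] ∀ m n → N ℕ.≤ m → N ℕ.≤ n →
           ℚ.∣ x m ℚ.- x n ∣ ℚ.< ε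

record ℝ : Set where
  constructor mkℝ
  field
    seq    : ℕ → ℚ
    cauchy : Cauchy seq

open ℝ public

Eventually : (ℕ → Set) → Set
Eventually P = ∃[ N ] ∀ n → N ℕ.≤ n → P n

infix 4 _≈ʳ_ _≤ʳ_ _<ʳ_

_≈ʳ_ : Rel ℝ 0ℓ
x ≈ʳ y = ∀ ε → 0ℚ ℚ.< ε → Eventually λ n → ℚ.∣ seq x n ℚ.- seq y n ∣ ℚ.< ε

_≤ʳ_ : Rel ℝ 0ℓ
x ≤ʳ y = ∀ ε → 0ℚ ℚ.< ε → Eventually λ n → seq x n ℚ.< seq y n ℚ.+ ε

_<ʳ_ : Rel ℝ 0ℓ
x <ʳ y = ∃[ ε ] 0ℚ ℚ.< ε × Eventually λ n → seq x n ℚ.+ ε ℚ.< seq y n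

private
  ½-pos : ∀ {ε} → 0ℚ ℚ.< ε → 0ℚ ℚ.< ½ ℚ.* ε
  ½-pos {ε} ε>0 = ℚ.*-monoʳ-<-pos ½ ε>0

  ½+½ : ∀ ε → ½ ℚ.* ε ℚ.+ ½ ℚ.* ε ≡ ε
  ½+½ ε = trans (sym (ℚ.*-distribʳ-+ ε ½ ½)) (ℚ.*-identityˡ ε)

  split : ∀ {a} b c {ε} → a ≡ b ℚ.+ c →
          ℚ.∣ b ∣ ℚ.< ½ ℚ.* ε → ℚ.∣ c ∣ ℚ.< ½ ℚ.* ε → ℚ.∣ a ∣ ℚ.< ε
  split b c {ε} refl p q =
    ℚ.≤-<-trans (ℚ.∣p+q∣≤∣p∣+∣q∣ b c)
      (subst (ℚ.∣ b ∣ ℚ.+ ℚ.∣ c ∣ ℚ.<_) (½+½ ε) (ℚ.+-mono-< p q))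

  -- Without abstract, checking later definitions unfolds these proofs.
  abstract
    const-cauchy : ∀ q → Cauchy (λ _ → q)
    const-cauchy q ε ε>0 = 0 , λ _ _ _ _ →
      subst (λ r → ℚ.∣ r ∣ ℚ.< ε) (sym (ℚ.+-inverseʳ q)) ε>0

    neg-cauchy : ∀ x → Cauchy x → Cauchy (λ n → ℚ.- x n)
    neg-cauchy x cx ε ε>0 = let N , h = cx ε ε>0 in N , λ m n N≤m N≤n →
      subst (λ r → r ℚ.< ε)
        (trans (sym (ℚ.∣-p∣≡∣p∣ (x m ℚ.- x n))) (cong ℚ.∣_∣ (lemma (x m) (x n))))
        (h m n N≤m N≤n)
      where
      open +-*-Solver
      lemma : ∀ a b → ℚ.- (a ℚ.- b) ≡ (ℚ.- a) ℚ.- (ℚ.- b)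
      lemma = solve 2 (λ a b → :- (a :- b) := (:- a) :- (:- b)) refl

    +-cauchy : ∀ x y → Cauchy x → Cauchy y → Cauchy (λ n → x n ℚ.+ y n)
    +-cauchy x y cx cy ε ε>0 =
      let M , hx = cx (½ ℚ.* ε) (½-pos ε>0)
          N , hy = cy (½ ℚ.* ε) (½-pos ε>0)
      in M ℕ.⊔ N , λ m n p q →
        split (x m ℚ.- x n) (y m ℚ.- y n) (lemma (x m) (y m) (x n) (y n))
          (hx m n (ℕ.m⊔n≤o⇒m≤o M N p) (ℕ.m⊔n≤o⇒m≤o M N q))
          (hy m n (ℕ.m⊔n≤o⇒n≤o M N p) (ℕ.m⊔n≤o⇒n≤o M N q))
      where
      open +-*-Solver
      lemma : ∀ a b c d → (a ℚ.+ b) ℚ.- (c ℚ.+ d) ≡ (a ℚ.- c) ℚ.+ (b ℚ.- d)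
      lemma = solve 4 (λ a b c d → (a :+ b) :- (c :+ d) := (a :- c) :+ (b :- d)) refl

    bounded : ∀ {x} → Cauchy x →
              ∃[ B ] 0ℚ ℚ.< B × Eventually λ n → ℚ.∣ x n ∣ ℚ.≤ B
    bounded {x} cx =
      let N , h = cx 1ℚ (ℚ.positive⁻¹ 1ℚ)
      in 1ℚ ℚ.+ ℚ.∣ x N ∣
       , ℚ.+-mono-<-≤ (ℚ.positive⁻¹ 1ℚ) (ℚ.0≤∣p∣ (x N))
       , N , λ n N≤n →
           ℚ.≤-trans
             (subst (λ r → ℚ.∣ r ∣ ℚ.≤ ℚ.∣ x n ℚ.- x N ∣ ℚ.+ ℚ.∣ x N ∣)
               (lemma (x n) (x N))
               (ℚ.∣p+q∣≤∣p∣+∣q∣ (x n ℚ.- x N) (x N)))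
             (ℚ.+-monoˡ-≤ ℚ.∣ x N ∣ (ℚ.<⇒≤ (h n N N≤n ℕ.≤-refl)))
      where
      open +-*-Solver
      lemma : ∀ a b → (a ℚ.- b) ℚ.+ b ≡ a
      lemma = solve 2 (λ a b → (a :- b) :+ b := a) refl

    quotient : ∀ {B ε} → 0ℚ ℚ.< B → 0ℚ ℚ.< ε → ∃[ δ ] 0ℚ ℚ.< δ × B ℚ.* δ ≡ ε
    quotient {B} {ε} B>0 ε>0 = 1/B ℚ.* ε
      , subst (ℚ._< 1/B ℚ.* ε) (ℚ.*-zeroʳ 1/B) (ℚ.*-monoʳ-<-pos 1/B ε>0)
      , trans (sym (ℚ.*-assoc B 1/B ε))
          (trans (cong (ℚ._* ε) (ℚ.*-inverseʳ B)) (ℚ.*-identityˡ ε))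
      where
      instance
        B-pos : ℚ.Positive B
        B-pos = ℚ.positive B>0
        B-nonZero : ℚ.NonZero B
        B-nonZero = ℚ.pos⇒nonZero B
      1/B : ℚ
      1/B = ℚ.1/ B
      instance
        1/B-pos : ℚ.Positive 1/B
        1/B-pos = ℚ.1/pos⇒pos B

    ∣*∣-bound : ∀ {a b B δ η} → 0ℚ ℚ.< B → ℚ.∣ a ∣ ℚ.≤ B → ℚ.∣ b ∣ ℚ.< δ →
                B ℚ.* δ ≡ η → ℚ.∣ a ℚ.* b ∣ ℚ.< η
    ∣*∣-bound {a} {b} {B} B>0 a≤B b<δ refl =
      subst (ℚ._< _) (sym (ℚ.∣p*q∣≡∣p∣*∣q∣ a b))
        (ℚ.≤-<-trans
          (ℚ.*-monoʳ-≤-nonNeg ℚ.∣ b ∣ {{ℚ.nonNegative (ℚ.0≤∣p∣ b)}} a≤B)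
          (ℚ.*-monoʳ-<-pos B {{ℚ.positive B>0}} b<δ))

    *-cauchy : ∀ x y → Cauchy x → Cauchy y → Cauchy (λ n → x n ℚ.* y n)
    *-cauchy x y cx cy ε ε>0 =
      let A , A>0 , K , bx    = bounded cx
          B , B>0 , L , by    = bounded cy
          δ , δ>0 , Aδ≡ε/2    = quotient A>0 (½-pos ε>0)
          δ′ , δ′>0 , Bδ′≡ε/2 = quotient B>0 (½-pos ε>0)
          M , hx              = cx δ′ δ′>0
          N , hy              = cy δ δ>0
          KL = K ℕ.⊔ L
          MN = M ℕ.⊔ N
      in KL ℕ.⊔ MN , λ m n p q →
        split (x m ℚ.* (y m ℚ.- y n)) (y n ℚ.* (x m ℚ.- x n))
          (lemma (x m) (y m) (x n) (y n))
          (∣*∣-bound {x m} A>0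
            (bx m (ℕ.m⊔n≤o⇒m≤o K L (ℕ.m⊔n≤o⇒m≤o KL MN p)))
            (hy m n (ℕ.m⊔n≤o⇒n≤o M N (ℕ.m⊔n≤o⇒n≤o KL MN p))
                    (ℕ.m⊔n≤o⇒n≤o M N (ℕ.m⊔n≤o⇒n≤o KL MN q)))
            Aδ≡ε/2)
          (∣*∣-bound {y n} B>0
            (by n (ℕ.m⊔n≤o⇒n≤o K L (ℕ.m⊔n≤o⇒m≤o KL MN q)))
            (hx m n (ℕ.m⊔n≤o⇒m≤o M N (ℕ.m⊔n≤o⇒n≤o KL MN p))
                    (ℕ.m⊔n≤o⇒m≤o M N (ℕ.m⊔n≤o⇒n≤o KL MN q)))
            Bδ′≡ε/2)
      where
      open +-*-Solver
      lemma : ∀ a b c d → a ℚ.* b ℚ.- c ℚ.* d ≡ a ℚ.* (b ℚ.- d) ℚ.+ d ℚ.* (a ℚ.- c)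
      lemma = solve 4 (λ a b c d → a :* b :- c :* d := a :* (b :- d) :+ d :* (a :- c)) refl

infix  8 -ʳ_
infixl 7 _*ʳ_
infixl 6 _+ʳ_ _-ʳ_

fromℚ : ℚ → ℝ
fromℚ q = mkℝ (λ _ → q) (const-cauchy q)

fromℤ : ℤ → ℝ
fromℤ i = fromℚ (i ℚ./ 1)

0ʳ 1ʳ : ℝ
0ʳ = fromℚ 0ℚ
1ʳ = fromℚ 1ℚ

_+ʳ_ _*ʳ_ : ℝ → ℝ → ℝ
x +ʳ y = mkℝ (λ n → seq x n ℚ.+ seq y n)
  (+-cauchy (seq x) (seq y) (cauchy x) (cauchy y))
x *ʳ y = mkℝ (λ n → seq x n ℚ.* seq y n)
  (*-cauchy (seq x) (seq y) (cauchy x) (cauchy y))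

-ʳ_ : ℝ → ℝ
-ʳ x = mkℝ (λ n → ℚ.- seq x n) (neg-cauchy (seq x) (cauchy x))

_-ʳ_ : ℝ → ℝ → ℝ
x -ʳ y = x +ʳ (-ʳ y)

∑ : ∀ {k} → Vector ℝ k → ℝ
∑ = foldr _+ʳ_ 0ʳ

record ℂ : Set where
  constructor _+i_
  field
    re im : ℝ

open ℂ public

infix  4 _≈ᶜ_
infix  8 -ᶜ_
infixl 7 _*ᶜ_
infixl 6 _+ᶜ_

_≈ᶜ_ : Rel ℂ 0ℓ
z ≈ᶜ w = re z ≈ʳ re w × im z ≈ʳ im w

fromℝ : ℝ → ℂ
fromℝ x = x +i 0ʳ

fromℕ : ℕ → ℂ
fromℕ k = fromℝ (fromℤ (+ k))

0ᶜ 1ᶜ : ℂ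
0ᶜ = fromℝ 0ʳ
1ᶜ = fromℝ 1ʳ

_+ᶜ_ _*ᶜ_ : ℂ → ℂ → ℂ
z +ᶜ w = (re z +ʳ re w) +i (im z +ʳ im w)
z *ᶜ w = (re z *ʳ re w -ʳ im z *ʳ im w) +i (re z *ʳ im w +ʳ im z *ʳ re w)

-ᶜ_ : ℂ → ℂ
-ᶜ z = (-ʳ re z) +i (-ʳ im z)

-- Being nonzero, in the positive sense ∣z∣² > 0.
_≉0 : Pred ℂ 0ℓ
z ≉0 = 0ʳ <ʳ re z *ʳ re z +ʳ im z *ʳ im z

-- Complex polynomials, as lists of coefficients with the constant term
-- first.  Trailing zeros are allowed, so ≈ₚ compares all coefficients.

ℂ[x] : Set
ℂ[x] = List ℂ

coeff : ℂ[x] → ℕ → ℂ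
coeff []      _       = 0ᶜ
coeff (a ∷ p) zero    = a
coeff (a ∷ p) (suc k) = coeff p k

infix 4 _≈ₚ_

_≈ₚ_ : Rel ℂ[x] 0ℓ
p ≈ₚ q = ∀ k → coeff p k ≈ᶜ coeff q k

eval : ℂ[x] → ℂ → ℂ
eval p z = List.foldr (λ a r → a +ᶜ z *ᶜ r) 0ᶜ p

_+ₚ_ : ℂ[x] → ℂ[x] → ℂ[x]
[]      +ₚ q       = q
(a ∷ p) +ₚ []      = a ∷ p
(a ∷ p) +ₚ (b ∷ q) = (a +ᶜ b) ∷ (p +ₚ q)

scale : ℂ → ℂ[x] → ℂ[x]
scale c = List.map (c *ᶜ_)

[x-_]*_ : ℂ → ℂ[x] → ℂ[x]
[x- ρ ]* p = (0ᶜ ∷ p) +ₚ scale (-ᶜ ρ) p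

∏[x-_] : ∀ {k} → Vector ℂ k → ℂ[x]
∏[x- ρ ] = foldr [x-_]*_ (1ᶜ ∷ []) ρ

-- ρ lists the zeros of f with multiplicity: f = c (x - ρ₁) ⋯ (x - ρₖ) with
-- c ≠ 0.  In particular, deg f = k.
ZerosOf_Are_ : ∀ {k} → ℂ[x] → Vector ℂ k → Set
ZerosOf f Are ρ = ∃[ c ] c ≉0 × f ≈ₚ scale c ∏[x- ρ ]

AllZerosOn : Pred ℂ 0ℓ → ℂ[x] → Set
AllZerosOn L f = ∀ z → eval f z ≈ᶜ 0ᶜ → L z

pointOn : ℂ → ℂ → ℝ → ℂ
pointOn α β t = α +ᶜ fromℝ t *ᶜ β

-- f is L-interlaced by g.  The number of zeros of g is d, so that
-- deg f = suc d = deg g + 1.  The order condition reads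
-- t₁ ≤ s₁ ≤ t₂ ≤ ⋯ ≤ s_d ≤ t_{d+1}.
record _IsInterlaced[_]By_ (f : ℂ[x]) (L : Pred ℂ 0ℓ) (g : ℂ[x]) : Set where
  field
    α β     : ℂ
    β≉0     : β ≉0
    line    : ∀ z → L z ⇔ (∃[ t ] z ≈ᶜ pointOn α β t)
    d       : ℕ
    t       : Vector ℝ (suc d)
    s       : Vector ℝ d
    zeros-f : ZerosOf f Are (pointOn α β ∘ t)
    zeros-g : ZerosOf g Are (pointOn α β ∘ s)
    t≤s     : ∀ i → t (inject₁ i) ≤ʳ s i
    s≤t     : ∀ i → s i ≤ʳ t (Fin.suc i)

R : Pred ℂ 0ℓ
R z = re z ≈ʳ fromℚ (ℚ.- ½)

record SimpleGraph : Set₁ where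
  field
    order  : ℕ
    Adj    : Rel (Fin order) 0ℓ
    symm   : Symmetric Adj
    irrefl : Irreflexive _≡_ Adj

-- The parts of K a b are the first a and the last b elements of Fin (a + b).
K : ℕ → ℕ → SimpleGraph
K a b = record
  { order  = a ℕ.+ b
  ; Adj    = λ v w → Opposite (splitAt a v) (splitAt a w)
  ; symm   = λ {v} {w} → opp-sym (splitAt a v) (splitAt a w)
  ; irrefl = λ { {v} refl → opp-irrefl (splitAt a v) }
  }
  where
  Opposite : Rel (Fin a ⊎ Fin b) 0ℓ
  Opposite (inj₁ _) (inj₁ _) = ⊥
  Opposite (inj₁ _) (inj₂ _) = ⊤
  Opposite (inj₂ _) (inj₁ _) = ⊤
  Opposite (inj₂ _) (inj₂ _) = ⊥

  opp-sym : ∀ p q → Opposite p q → Opposite q p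
  opp-sym (inj₁ _) (inj₂ _) _ = tt
  opp-sym (inj₂ _) (inj₁ _) _ = tt

  opp-irrefl : ∀ p → Opposite p p → ⊥
  opp-irrefl (inj₁ _) ()
  opp-irrefl (inj₂ _) ()

infix 4 _≈ᵛ_

_≈ᵛ_ : ∀ {N} → Rel (Vector ℝ N) 0ℓ
x ≈ᵛ y = ∀ v → x v ≈ʳ y v

ConvexHull : ∀ {N} → Pred (Vector ℝ N) 0ℓ → Pred (Vector ℝ N) 0ℓ
ConvexHull {N} S x =
  Σ[ k ∈ ℕ ] Σ[ c ∈ Vector ℝ k ] Σ[ p ∈ Vector (Vector ℝ N) k ]
    (∀ i → S (p i)) ×
    (∀ i → 0ʳ ≤ʳ c i) ×
    ∑ c ≈ʳ 1ʳ ×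
    x ≈ᵛ λ v → ∑ λ i → c i *ʳ p i v

Dilate : ∀ {N} → ℕ → Pred (Vector ℝ N) 0ℓ → Pred (Vector ℝ N) 0ℓ
Dilate s P x = ∃[ y ] P y × x ≈ᵛ λ v → fromℤ (+ s) *ʳ y v

LatticePoint : ∀ {N} → Pred (Vector ℝ N) 0ℓ → Pred (Vec ℤ N) 0ℓ
LatticePoint P u = P (fromℤ ∘ lookup u)

basis : ∀ {N} → Fin N → Vector ℝ N
basis v w = if does (v ≟ᶠ w) then 1ʳ else 0ʳ

module _ (G : SimpleGraph) where
  open SimpleGraph G

  EdgeVector : Pred (Vector ℝ order) 0ℓ
  EdgeVector x = ∃[ v ] ∃[ w ] Adj v w × x ≈ᵛ λ u → basis v u -ʳ basis w u

  SymmetricEdgePolytope : Pred (Vector ℝ order) 0ℓ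
  SymmetricEdgePolytope = ConvexHull EdgeVector

HasCardinality : {A : Set} → Pred A 0ℓ → ℕ → Set
HasCardinality {A} P k =
  Σ[ xs ∈ List A ] Unique xs × (∀ x → P x ⇔ x ∈ xs) × length xs ≡ k

-- This determines H up to ≈ₚ.
IsEhrhartPolynomial : SimpleGraph → ℂ[x] → Set
IsEhrhartPolynomial G H = ∀ s → ∃[ k ]
  HasCardinality (LatticePoint (Dilate s (SymmetricEdgePolytope G))) k ×
  eval H (fromℕ s) ≈ᶜ fromℕ k

{-# OPTIONS --safe #-}
-- A lattice point of s P(K_{a,n}) is a pair (x, y) in ℤᵃ × ℤⁿ of total sum 0 with ∥x∥₁ ≤ s and ∥y∥₁ ≤ s:
-- one inclusion tests linear functionals bounded by 1 on the edge vectors, the other splits off edges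
-- greedily.  Summing the number of possible x over the y in the ball of radius s expresses H₂ₙ and H₃ₙ
-- through the numbers D n s of lattice points of cross-polytopes, which satisfy a three-term recurrence.
-- In the variable y = i (2 s + 1), that is s = -1/2 - i y / 2, this is a recurrence of orthogonal
-- polynomials, and H₂ₙ and H₃ₙ continue it: each member of the chain q 0, …, q n, F (for H₂ₙ), G (for H₃ₙ)
-- has the form -(ℓ f + P g), where f and g are its two predecessors and P > 0.  At the zeros of f its sign
-- is therefore opposite to that of g, and the intermediate value theorem yields interlacing real zeros.
-- Constructively, bisection over ℚ gives the zeros, strict interlacing keeps them apart, and polynomials
-- are factored over zeros that are apart.

module Submission where

open import Defs
open import Data.Nat using (ℕ; _≤_)
open import Data.Product using (_×_)
open import Algebra.Bundles using (CommutativeRing)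
import Algebra.Properties.Ring as RingProperties
open import Data.Empty using (⊥; ⊥-elim)
open import Data.Integer.Base as ℤ using (ℤ; +_; -[1+_])
import Data.Integer.Properties as ℤ
import Data.Integer.Solver as ℤ-Solver
open import Data.Nat.Base as ℕ using (zero; suc)
import Data.Nat.Properties as ℕ
import Data.Nat.Solver as ℕ-Solver
open import Data.Product.Base using (∃-syntax; Σ-syntax; _,_; proj₁; proj₂)
open import Data.Rational.Base as ℚ using (ℚ; 0ℚ; 1ℚ; ½)
import Data.Rational.Properties as ℚ
import Data.Rational.Solver as ℚ-Solver
open import Data.Sum.Base using (_⊎_; inj₁; inj₂)
open import Function.Base using (_∘_; _$_; id)
open import Level using (0ℓ)
open import Relation.Nullary.Decidable.Core using (yes; no)
import Algebra.Solver.Ring.NaturalCoefficients.Default as NatSolver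
import Relation.Binary.Reasoning.Setoid as SetoidReasoning

-- Over a point y of the ball, the admissible x are described by two numbers p and m: p - m is minus
-- the total of y, and p + m depends only on s and the parity of the slack s - ‖y‖₁. For x in ℤ² the
-- number of x is a function of p + m; for x in ℤ³ it also involves (p - m)². Hence three sums over
-- the ball occur: the number of points, the number with even slack, and the second moment of the
-- total. Each is a combination of values `D` in neighbouring dimensions, which is why one
-- recurrence closes the chain. The price for H₃ₙ is that the coefficient of q n is a quadratic in y
-- instead of a constant; it is positive for real y, and the sign argument asks for nothing more.
-- Constructively, the sign of a real cannot be decided, and a vanishing product does not tell which
-- factor vanishes. The same polynomials are therefore read over three rings: over ℚ to decide
-- signs, over ℝ to hold the zeros, and over ℂ because the counts prescribe values at imaginary
-- points only.

-- Polynomial functions over a commutative ring: division and factorization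

module PolynomialFunctions (R : CommutativeRing 0ℓ 0ℓ) where
  open CommutativeRing R
  open RingProperties ring
  open SetoidReasoning setoid
  private module S = NatSolver commutativeSemiring

  prod : ℕ → (ℕ → Carrier) → Carrier
  prod zero    u = 1#
  prod (suc m) u = u 0 * prod m (u ∘ suc)

  prod-cong : ∀ m {u v} → (∀ i → i ℕ.< m → u i ≈ v i) → prod m u ≈ prod m v
  prod-cong zero    h = refl
  prod-cong (suc m) h = *-cong (h 0 ℕ.z<s) (prod-cong m λ i i<m → h (suc i) (ℕ.s<s i<m))

  -- The second equation pins `c` to an expression free of `u`. In the application `u` varies with
  -- the evaluation point, and the constant extracted from the product must not.
  prod-scale : ∀ m a u → ∃[ c ] prod m (λ i → a * u i) ≈ c * prod m u × c ≈ prod m (λ _ → a)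
  prod-scale zero    a u = 1# , sym (*-identityˡ 1#) , refl
  prod-scale (suc m) a u with prod-scale m a (u ∘ suc)
  ... | c , e , e′ = a * c
    , trans (*-congˡ e) (solve 4 (λ a u c p → (a :* u) :* (c :* p) := (a :* c) :* (u :* p)) refl
        a (u 0) c (prod m (u ∘ suc)))
    , *-congˡ e′
    where open S

  x≈r+[x-r] : ∀ x r → x ≈ r + (x - r)
  x≈r+[x-r] x r = sym (begin
    r + (x - r)  ≈⟨ solve 3 (λ x r y → r :+ (x :+ y) := x :+ (r :+ y)) refl x r (- r) ⟩
    x + (r - r)  ≈⟨ +-congˡ (-‿inverseʳ r) ⟩
    x + 0#       ≈⟨ +-identityʳ x ⟩
    x            ∎)
    where open S

  -- One step of synthetic division by x - r, with v the old and a + r v the new remainder.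
  divide-step : ∀ a x r v w → a + x * (v + (x - r) * w) ≈ (a + r * v) + (x - r) * (v + x * w)
  divide-step a x r v w = begin
    a + x * (v + (x - r) * w)                    ≈⟨ solve 5 (λ a x v d w →
        a :+ x :* (v :+ d :* w) := a :+ x :* v :+ d :* (x :* w)) refl a x v (x - r) w ⟩
    a + x * v + (x - r) * (x * w)                ≈⟨ +-congʳ (+-congˡ (*-congʳ (x≈r+[x-r] x r))) ⟩
    a + (r + (x - r)) * v + (x - r) * (x * w)    ≈⟨ solve 5 (λ a r d v y →
        a :+ (r :+ d) :* v :+ d :* y := (a :+ r :* v) :+ d :* (v :+ y)) refl a r (x - r) v (x * w) ⟩
    (a + r * v) + (x - r) * (v + x * w)          ∎
    where open S

  -- Horner form for functions: `m` bounds the degree from above, and the leading coefficient may be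
  -- zero. Factorization asks only for such a bound together with `m` zeros that are apart.
  IsPoly : ℕ → (Carrier → Carrier) → Set
  IsPoly zero    p = ∃[ a ] ∀ x → p x ≈ a
  IsPoly (suc m) p = ∃[ a ] ∃[ q ] IsPoly m q × (∀ x → p x ≈ a + x * q x)

  isPoly-resp : ∀ m {p q} → (∀ x → q x ≈ p x) → IsPoly m p → IsPoly m q
  isPoly-resp zero    e (a , h) = a , λ x → trans (e x) (h x)
  isPoly-resp (suc m) e (a , q , hq , h) = a , q , hq , λ x → trans (e x) (h x)

  isPoly-const : ∀ m a → IsPoly m (λ _ → a)
  isPoly-const zero    a = a , λ _ → refl
  isPoly-const (suc m) a = a , (λ _ → 0#) , isPoly-const m 0# ,
    λ x → sym (trans (+-congˡ (zeroʳ x)) (+-identityʳ a))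

  isPoly-suc : ∀ m {p} → IsPoly m p → IsPoly (suc m) p
  isPoly-suc zero    (a , h) = isPoly-resp 1 h (isPoly-const 1 a)
  isPoly-suc (suc m) (a , q , hq , h) = a , q , isPoly-suc m hq , h

  isPoly-x* : ∀ m {p} → IsPoly m p → IsPoly (suc m) (λ x → x * p x)
  isPoly-x* m {p} h = 0# , p , h , λ x → sym (+-identityˡ _)

  isPoly-+ : ∀ m {p q} → IsPoly m p → IsPoly m q → IsPoly m (λ x → p x + q x)
  isPoly-+ zero    (a , h) (b , k) = a + b , λ x → +-cong (h x) (k x)
  isPoly-+ (suc m) (a , p , hp , h) (b , q , hq , k) =
    a + b , _ , isPoly-+ m hp hq , λ x → trans (+-cong (h x) (k x))
      (solve 5 (λ a x p b q → (a :+ x :* p) :+ (b :+ x :* q) := (a :+ b) :+ x :* (p :+ q)) refl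
        a x (p x) b (q x))
    where open S

  isPoly-scale : ∀ m c {p} → IsPoly m p → IsPoly m (λ x → c * p x)
  isPoly-scale zero    c (a , h) = c * a , λ x → *-congˡ (h x)
  isPoly-scale (suc m) c (a , p , hp , h) =
    c * a , _ , isPoly-scale m c hp , λ x → trans (*-congˡ (h x))
      (solve 4 (λ c a x p → c :* (a :+ x :* p) := c :* a :+ x :* (c :* p)) refl c a x (p x))
    where open S

  -- Synthetic division with remainder `p r`: dividing the inner Horner polynomial first makes the
  -- recursion follow `IsPoly`, and `divide-step` restores the outer layer.
  factor : ∀ m {p} → IsPoly (suc m) p → ∀ r →
           ∃[ q ] IsPoly m q × (∀ x → p x ≈ p r + (x - r) * q x)
  factor zero {p} (a , p′ , (b , hp′) , h) r = (λ _ → b) , isPoly-const 0 b , λ x → begin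
    p x                                     ≈⟨ trans (h x) (+-congˡ (*-congˡ (trans (hp′ x) (sym (constant x))))) ⟩
    a + x * (b + (x - r) * 0#)              ≈⟨ divide-step a x r b 0# ⟩
    (a + r * b) + (x - r) * (b + x * 0#)    ≈⟨ +-cong (+-congˡ (*-congˡ (sym (hp′ r)))) (*-congˡ (trans (+-congˡ (zeroʳ x)) (+-identityʳ b))) ⟩
    (a + r * p′ r) + (x - r) * b            ≈⟨ +-congʳ (sym (h r)) ⟩
    p r + (x - r) * b                       ∎
    where
    constant : ∀ x → b + (x - r) * 0# ≈ b
    constant x = trans (+-congˡ (zeroʳ (x - r))) (+-identityʳ b)
  factor (suc m) {p} (a , p′ , hp′ , h) r with factor m hp′ r
  ... | w , hw , e = (λ x → p′ r + x * w x)
    , isPoly-+ (suc m) (isPoly-const (suc m) (p′ r)) (isPoly-x* m hw)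
    , λ x → begin
      p x                                              ≈⟨ trans (h x) (+-congˡ (*-congˡ (e x))) ⟩
      a + x * (p′ r + (x - r) * w x)                   ≈⟨ divide-step a x r (p′ r) (w x) ⟩
      (a + r * p′ r) + (x - r) * (p′ r + x * w x)      ≈⟨ +-congʳ (sym (h r)) ⟩
      p r + (x - r) * (p′ r + x * w x)                 ∎

  -- Stands in for being nonzero in a ring without decidable equality; over ℝ and ℂ, apartness from
  -- 0 provides it.
  Cancellable : Carrier → Set
  Cancellable x = ∀ y → x * y ≈ 0# → y ≈ 0#

  -- Every further zero of `p` is one of the quotient by `x - r 0`, because `r j - r 0` cancels. The
  -- factors read `r j - x` so that all of them are positive to the left of the real zeros; each
  -- reversal of sign goes into `c`.
  factorization : ∀ m {p} (r : ℕ → Carrier) → IsPoly m p →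
    (∀ i → i ℕ.< m → p (r i) ≈ 0#) →
    (∀ i j → i ℕ.< j → j ℕ.< m → Cancellable (r j - r i)) →
    ∃[ c ] ∀ x → p x ≈ c * prod m (λ j → r j - x)
  factorization zero r (a , h) zeros apart = a , λ x → trans (h x) (sym (*-identityʳ a))
  factorization (suc m) {p} r hp zeros apart with factor m hp (r 0)
  ... | q , hq , e with factorization m (r ∘ suc) hq
        (λ i i<m → apart 0 (suc i) ℕ.z<s (ℕ.s<s i<m) _
          (trans (sym (p≈ (r (suc i)))) (zeros (suc i) (ℕ.s<s i<m))))
        (λ i j i<j j<m → apart (suc i) (suc j) (ℕ.s<s i<j) (ℕ.s<s j<m))
    where
    p≈ : ∀ x → p x ≈ (x - r 0) * q x
    p≈ x = trans (e x) (trans (+-congʳ (zeros 0 ℕ.z<s)) (+-identityˡ _))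
  ... | c , k = - c , λ x → begin
    p x                                                ≈⟨ trans (e x) (trans (+-congʳ (zeros 0 ℕ.z<s)) (+-identityˡ _)) ⟩
    (x - r 0) * q x                                    ≈⟨ *-cong (neg-sub x (r 0)) (k x) ⟩
    - (r 0 - x) * (c * prod m (λ j → r (suc j) - x))   ≈⟨ -‿distribˡ-* _ _ ⟨
    - ((r 0 - x) * (c * prod m (λ j → r (suc j) - x))) ≈⟨ -‿cong (solve 3 (λ d c p → d :* (c :* p) := c :* (d :* p)) refl _ _ _) ⟩
    - (c * ((r 0 - x) * prod m (λ j → r (suc j) - x))) ≈⟨ -‿distribˡ-* _ _ ⟩
    - c * ((r 0 - x) * prod m (λ j → r (suc j) - x))   ∎
    where
    open S
    neg-sub : ∀ x y → x - y ≈ - (y - x)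
    neg-sub x y = sym (trans (sym (-‿+-comm y (- x))) (trans (+-congˡ (-‿involutive x)) (+-comm (- y) x)))

open import Relation.Binary.PropositionalEquality

-- Cauchy reals: equality, strict positivity and rational estimates

module Reals where
  open import Relation.Binary.Structures using (IsEquivalence)

  0≤*  : ∀ {p q} → 0ℚ ℚ.≤ p → 0ℚ ℚ.≤ q → 0ℚ ℚ.≤ p ℚ.* q
  0≤* {p} {q} a b = ℚ.nonNegative⁻¹ _ {{ℚ.nonNeg*nonNeg⇒nonNeg p {{ℚ.nonNegative a}} q {{ℚ.nonNegative b}}}}

  0<*  : ∀ {p q} → 0ℚ ℚ.< p → 0ℚ ℚ.< q → 0ℚ ℚ.< p ℚ.* q
  0<* {p} {q} a b = ℚ.positive⁻¹ _ {{ℚ.pos*pos⇒pos p {{ℚ.positive a}} q {{ℚ.positive b}}}}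

  0<1ℚ : 0ℚ ℚ.< 1ℚ
  0<1ℚ = ℚ.positive⁻¹ 1ℚ

  0<½* : ∀ {ε} → 0ℚ ℚ.< ε → 0ℚ ℚ.< ½ ℚ.* ε
  0<½* = 0<* (ℚ.positive⁻¹ ½)

  ½+½≡ : ∀ ε → ½ ℚ.* ε ℚ.+ ½ ℚ.* ε ≡ ε
  ½+½≡ ε = trans (sym (ℚ.*-distribʳ-+ ε ½ ½)) (ℚ.*-identityˡ ε)

  p≤∣p∣ : ∀ p → p ℚ.≤ ℚ.∣ p ∣
  p≤∣p∣ p with ℚ.≤-total 0ℚ p
  ... | inj₁ h = ℚ.≤-reflexive (sym (ℚ.0≤p⇒∣p∣≡p h))
  ... | inj₂ h = ℚ.≤-trans h (ℚ.0≤∣p∣ p)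

  -p≤∣p∣ : ∀ p → ℚ.- p ℚ.≤ ℚ.∣ p ∣
  -p≤∣p∣ p = subst (ℚ.- p ℚ.≤_) (ℚ.∣-p∣≡∣p∣ p) (p≤∣p∣ (ℚ.- p))

  ∣p∣<⇐ : ∀ {p q} → p ℚ.< q → ℚ.- p ℚ.< q → ℚ.∣ p ∣ ℚ.< q
  ∣p∣<⇐ {p} a b with ℚ.∣p∣≡p∨∣p∣≡-p p
  ... | inj₁ e = subst (ℚ._< _) (sym e) a
  ... | inj₂ e = subst (ℚ._< _) (sym e) b

  ∣p∣≤⇐ : ∀ {p q} → p ℚ.≤ q → ℚ.- p ℚ.≤ q → ℚ.∣ p ∣ ℚ.≤ q
  ∣p∣≤⇐ {p} a b with ℚ.∣p∣≡p∨∣p∣≡-p p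
  ... | inj₁ e = subst (ℚ._≤ _) (sym e) a
  ... | inj₂ e = subst (ℚ._≤ _) (sym e) b

  module _ where
    open ℚ-Solver.+-*-Solver

    p≡q+[p-q] : ∀ p q → p ≡ q ℚ.+ (p ℚ.- q)
    p≡q+[p-q] = solve 2 (λ p q → p := q :+ (p :- q)) refl

    neg-sub : ∀ p q → ℚ.- (p ℚ.- q) ≡ q ℚ.- p
    neg-sub = solve 2 (λ p q → :- (p :- q) := q :- p) refl

  0<q-p : ∀ {p q} → p ℚ.< q → 0ℚ ℚ.< q ℚ.- p
  0<q-p {p} {q} h = subst (ℚ._< q ℚ.- p) (ℚ.+-inverseʳ p) (ℚ.+-monoˡ-< (ℚ.- p) h)

  0≤q-p : ∀ {p q} → p ℚ.≤ q → 0ℚ ℚ.≤ q ℚ.- p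
  0≤q-p {p} {q} h = subst (ℚ._≤ q ℚ.- p) (ℚ.+-inverseʳ p) (ℚ.+-monoˡ-≤ (ℚ.- p) h)

  p<q⇐0<q-p : ∀ {p q} → 0ℚ ℚ.< q ℚ.- p → p ℚ.< q
  p<q⇐0<q-p {p} {q} h = subst₂ ℚ._<_ (ℚ.+-identityʳ p) (sym (p≡q+[p-q] q p)) (ℚ.+-monoʳ-< p h)

  p≤q⇐0≤q-p : ∀ {p q} → 0ℚ ℚ.≤ q ℚ.- p → p ℚ.≤ q
  p≤q⇐0≤q-p {p} {q} h = subst₂ ℚ._≤_ (ℚ.+-identityʳ p) (sym (p≡q+[p-q] q p)) (ℚ.+-monoʳ-≤ p h)

  square≥0 : ∀ p → 0ℚ ℚ.≤ p ℚ.* p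
  square≥0 p with ℚ.≤-total 0ℚ p
  ... | inj₁ h = 0≤* h h
  ... | inj₂ h = ℚ.nonNegative⁻¹ _ {{ℚ.nonPos*nonPos⇒nonPos p {{ℚ.nonPositive h}} p {{ℚ.nonPositive h}}}}

  divide : ∀ {b e} → 0ℚ ℚ.< b → 0ℚ ℚ.< e → ∃[ d ] 0ℚ ℚ.< d × b ℚ.* d ≡ e
  divide {b} {e} b>0 e>0 =
      1/b ℚ.* e
    , 0<* (ℚ.positive⁻¹ 1/b {{ℚ.1/pos⇒pos b}}) e>0
    , trans (sym (ℚ.*-assoc b 1/b e))
        (trans (cong (ℚ._* e) (ℚ.*-inverseʳ b)) (ℚ.*-identityˡ e))
    where
    instance
      b-pos = ℚ.positive b>0
      b-nonZero = ℚ.pos⇒nonZero b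
    1/b = ℚ.1/ b

  *-cancelˡ-< : ∀ b p q → 0ℚ ℚ.< b → b ℚ.* p ℚ.< b ℚ.* q → p ℚ.< q
  *-cancelˡ-< b p q b>0 = ℚ.*-cancelˡ-<-nonNeg b {{ℚ.nonNegative (ℚ.<⇒≤ b>0)}} {p} {q}

  _at_ : ∀ {P : ℕ → Set} → (e : Eventually P) → ∀ {n} → proj₁ e ℕ.≤ n → P n
  e at h = proj₂ e _ h

  eventually-map : {P Q : ℕ → Set} → (∀ n → P n → Q n) → Eventually P → Eventually Q
  eventually-map f (N , h) = N , λ n N≤n → f n (h n N≤n)

  eventually-∧ : {P Q : ℕ → Set} → Eventually P → Eventually Q → Eventually λ n → P n × Q n
  eventually-∧ (M , f) (N , g) = M ℕ.⊔ N , λ n h →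
    f n (ℕ.m⊔n≤o⇒m≤o M N h) , g n (ℕ.m⊔n≤o⇒n≤o M N h)

  eventually-zip : {P Q R : ℕ → Set} → (∀ n → P n → Q n → R n) →
                   Eventually P → Eventually Q → Eventually R
  eventually-zip f a b = eventually-map (λ n (p , q) → f n p q) (eventually-∧ a b)

  Null : (ℕ → ℚ) → Set
  Null f = ∀ ε → 0ℚ ℚ.< ε → Eventually λ n → ℚ.∣ f n ∣ ℚ.< ε

  Bounded : (ℕ → ℚ) → Set
  Bounded f = ∃[ B ] 0ℚ ℚ.< B × Eventually λ n → ℚ.∣ f n ∣ ℚ.≤ B

  module _ where
    open ℚ-Solver.+-*-Solver

    null-ext : ∀ {f g} → (∀ n → f n ≡ g n) → Null f → Null g
    null-ext e h ε ε>0 = eventually-map (λ n → subst (λ x → ℚ.∣ x ∣ ℚ.< ε) (e n)) (h ε ε>0)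

    null-0 : Null (λ _ → 0ℚ)
    null-0 ε ε>0 = 0 , λ _ _ → ε>0

    null-+ : ∀ {f g} → Null f → Null g → Null (λ n → f n ℚ.+ g n)
    null-+ {f} {g} hf hg ε ε>0 =
      eventually-zip
        (λ n a b → ℚ.≤-<-trans (ℚ.∣p+q∣≤∣p∣+∣q∣ (f n) (g n))
          (subst (ℚ.∣ f n ∣ ℚ.+ ℚ.∣ g n ∣ ℚ.<_) (½+½≡ ε) (ℚ.+-mono-< a b)))
        (hf _ (0<½* ε>0)) (hg _ (0<½* ε>0))

    null-neg : ∀ {f} → Null f → Null (λ n → ℚ.- f n)
    null-neg {f} h ε ε>0 = eventually-map (λ n → subst (ℚ._< ε) (sym (ℚ.∣-p∣≡∣p∣ (f n)))) (h ε ε>0)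

    null-* : ∀ f g → Bounded f → Null g → Null (λ n → f n ℚ.* g n)
    null-* f g (B , B>0 , bf) hg ε ε>0 with divide B>0 ε>0
    ... | δ , δ>0 , refl = eventually-zip
      (λ n a b → subst (ℚ._< B ℚ.* δ) (sym (ℚ.∣p*q∣≡∣p∣*∣q∣ (f n) (g n)))
        (ℚ.≤-<-trans
          (ℚ.*-monoʳ-≤-nonNeg ℚ.∣ g n ∣ {{ℚ.nonNegative (ℚ.0≤∣p∣ (g n))}} a)
          (ℚ.*-monoʳ-<-pos B {{ℚ.positive B>0}} b)))
      bf (hg δ δ>0)

    seq-bounded : ∀ x → Bounded (seq x)
    seq-bounded x with cauchy x 1ℚ 0<1ℚ
    ... | N , h = 1ℚ ℚ.+ ℚ.∣ seq x N ∣
      , ℚ.+-mono-<-≤ 0<1ℚ (ℚ.0≤∣p∣ (seq x N))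
      , N , λ n N≤n → ℚ.≤-trans
          (subst (λ t → ℚ.∣ t ∣ ℚ.≤ ℚ.∣ seq x n ℚ.- seq x N ∣ ℚ.+ ℚ.∣ seq x N ∣)
            (solve 2 (λ a b → (a :- b) :+ b := a) refl (seq x n) (seq x N))
            (ℚ.∣p+q∣≤∣p∣+∣q∣ (seq x n ℚ.- seq x N) (seq x N)))
          (ℚ.+-monoˡ-≤ ℚ.∣ seq x N ∣ (ℚ.<⇒≤ (h n N N≤n ℕ.≤-refl)))

  infix 4 _≋_

  -- A wrapper: _≈ʳ_ unfolds to a statement from which its arguments cannot be inferred.
  record _≋_ (x y : ℝ) : Set where
    constructor mk≋
    field un≋ : x ≈ʳ y
  open _≋_ public

  module _ where
    open ℚ-Solver.+-*-Solver

    -- Arithmetic on sequences is termwise, so this turns identities found by the rational ring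
    -- solver into identities of reals.
    ≋-pointwise : ∀ {x y} → (∀ n → seq x n ≡ seq y n) → x ≋ y
    ≋-pointwise {x} {y} e = mk≋ $ null-ext
      (λ n → trans (sym (ℚ.+-inverseʳ (seq x n))) (cong (λ t → seq x n ℚ.- t) (e n))) null-0

    ≋-refl : ∀ {x} → x ≋ x
    ≋-refl = ≋-pointwise λ _ → refl

    ≋-sym : ∀ {x y} → x ≋ y → y ≋ x
    ≋-sym {x} {y} (mk≋ h) = mk≋ $ null-ext (λ n → neg-sub (seq x n) (seq y n)) (null-neg h)

    ≋-trans : ∀ {x y z} → x ≋ y → y ≋ z → x ≋ z
    ≋-trans {x} {y} {z} (mk≋ h) (mk≋ k) = mk≋ $ null-ext
      (λ n → solve 3 (λ a b c → (a :- b) :+ (b :- c) := a :- c) refl (seq x n) (seq y n) (seq z n))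
      (null-+ h k)

    +ʳ-cong : ∀ {x y u v} → x ≋ y → u ≋ v → x +ʳ u ≋ y +ʳ v
    +ʳ-cong {x} {y} {u} {v} (mk≋ h) (mk≋ k) = mk≋ $ null-ext
      (λ n → solve 4 (λ x y u v → (x :- y) :+ (u :- v) := (x :+ u) :- (y :+ v)) refl
        (seq x n) (seq y n) (seq u n) (seq v n))
      (null-+ h k)

    -ʳ-cong : ∀ {x y} → x ≋ y → -ʳ x ≋ -ʳ y
    -ʳ-cong {x} {y} (mk≋ h) = mk≋ $ null-ext
      (λ n → solve 2 (λ x y → :- (x :- y) := (:- x) :- (:- y)) refl (seq x n) (seq y n))
      (null-neg h)

    *ʳ-cong : ∀ {x y u v} → x ≋ y → u ≋ v → x *ʳ u ≋ y *ʳ v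
    *ʳ-cong {x} {y} {u} {v} (mk≋ h) (mk≋ k) = mk≋ $ null-ext
      (λ n → solve 4 (λ x y u v → (x :* (u :- v)) :+ (v :* (x :- y)) := x :* u :- y :* v) refl
        (seq x n) (seq y n) (seq u n) (seq v n))
      (null-+ (null-* (seq x) _ (seq-bounded x) k) (null-* (seq v) _ (seq-bounded v) h))

  ℝ-isEquivalence : IsEquivalence _≋_
  ℝ-isEquivalence = record { refl = ≋-refl ; sym = ≋-sym ; trans = ≋-trans }

  ℝ-ring : CommutativeRing 0ℓ 0ℓ
  ℝ-ring = record
    { Carrier = ℝ ; _≈_ = _≋_ ; _+_ = _+ʳ_ ; _*_ = _*ʳ_ ; -_ = -ʳ_ ; 0# = 0ʳ ; 1# = 1ʳ
    ; isCommutativeRing = record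
      { isRing = record
        { +-isAbelianGroup = record
          { isGroup = record
            { isMonoid = record
              { isSemigroup = record
                { isMagma = record { isEquivalence = ℝ-isEquivalence ; ∙-cong = +ʳ-cong }
                ; assoc = λ x y z → ≋-pointwise λ n → ℚ.+-assoc (seq x n) (seq y n) (seq z n) }
              ; identity = (λ x → ≋-pointwise λ n → ℚ.+-identityˡ (seq x n))
                         , (λ x → ≋-pointwise λ n → ℚ.+-identityʳ (seq x n)) }
            ; inverse = (λ x → ≋-pointwise λ n → ℚ.+-inverseˡ (seq x n))
                      , (λ x → ≋-pointwise λ n → ℚ.+-inverseʳ (seq x n))
            ; ⁻¹-cong = -ʳ-cong }
          ; comm = λ x y → ≋-pointwise λ n → ℚ.+-comm (seq x n) (seq y n) }
        ; *-cong = *ʳ-cong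
        ; *-assoc = λ x y z → ≋-pointwise λ n → ℚ.*-assoc (seq x n) (seq y n) (seq z n)
        ; *-identity = (λ x → ≋-pointwise λ n → ℚ.*-identityˡ (seq x n))
                     , (λ x → ≋-pointwise λ n → ℚ.*-identityʳ (seq x n))
        ; distrib = (λ x y z → ≋-pointwise λ n → ℚ.*-distribˡ-+ (seq x n) (seq y n) (seq z n))
                  , (λ x y z → ≋-pointwise λ n → ℚ.*-distribʳ-+ (seq x n) (seq y n) (seq z n)) }
      ; *-comm = λ x y → ≋-pointwise λ n → ℚ.*-comm (seq x n) (seq y n) } }

  -- Strict positivity with its rational witness as a field: the intermediate value theorem measures
  -- its step size against these gaps.
  record Pos (x : ℝ) : Set where
    constructor mkPos
    field
      gap   : ℚ
      0<gap : 0ℚ ℚ.< gap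
      above : Eventually λ n → gap ℚ.< seq x n
  open Pos public

  infix 4 _⋖_

  _⋖_ : ℝ → ℝ → Set
  x ⋖ y = Pos (y -ʳ x)

  pos-fromℚ : ∀ {q} → 0ℚ ℚ.< q → Pos (fromℚ q)
  pos-fromℚ {q} h with ℚ.<-dense h
  ... | g , 0<g , g<q = mkPos g 0<g (0 , λ _ _ → g<q)

  pos-+ : ∀ {x y} → Pos x → Pos y → Pos (x +ʳ y)
  pos-+ (mkPos g g>0 a) (mkPos h h>0 b) = mkPos (g ℚ.+ h) (ℚ.+-mono-< g>0 h>0)
    (eventually-zip (λ n → ℚ.+-mono-<) a b)

  pos-* : ∀ {x y} → Pos x → Pos y → Pos (x *ʳ y)
  pos-* {x} {y} (mkPos g g>0 a) (mkPos h h>0 b) = mkPos (g ℚ.* h) (0<* g>0 h>0)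
    (eventually-zip
      (λ n p q → ℚ.<-trans (ℚ.*-monoˡ-<-pos h {{ℚ.positive h>0}} p)
        (ℚ.*-monoʳ-<-pos (seq x n) {{ℚ.positive (ℚ.<-trans g>0 p)}} q))
      a b)

  -- The standard way to prove a rational inequality here: `e` displays `q - p` as a sum of visibly
  -- positive terms, and the ring solver checks the identity.
  by-sub : ∀ {p q e} → 0ℚ ℚ.< e → e ≡ q ℚ.- p → p ℚ.< q
  by-sub h e = p<q⇐0<q-p (subst (0ℚ ℚ.<_) e h)

  module _ where
    open ℚ-Solver.+-*-Solver

    pos-resp : ∀ {x y} → x ≋ y → Pos x → Pos y
    pos-resp {x} {y} (mk≋ e) (mkPos g g>0 a) = mkPos (½ ℚ.* g) (0<½* g>0)
      (eventually-zip
        (λ n p q → by-sub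
          (ℚ.+-mono-< (0<q-p p) (0<q-p (ℚ.≤-<-trans (p≤∣p∣ (seq x n ℚ.- seq y n)) q)))
          (solve 3 (λ x y g → (x :- g) :+ (con ½ :* g :- (x :- y)) := y :- con ½ :* g) refl
            (seq x n) (seq y n) g))
        a (e _ (0<½* g>0)))

    -- Eventually `0 ≤ y ≤ B`, so `g < x y` forces `x > g / B`. This extracts the sign of a leading
    -- coefficient and shows that units of ℂ are apart from 0.
    pos-cancelʳ : ∀ {x y} → Pos (x *ʳ y) → (Eventually λ n → 0ℚ ℚ.≤ seq y n) → Pos x
    pos-cancelʳ {x} {y} (mkPos g g>0 a) y≥0 =
      let B , B>0 , c = seq-bounded y
          δ , δ>0 , Bδ≡g = divide B>0 g>0
      in mkPos δ δ>0 (eventually-zip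
        (λ n g<xy (0≤y , y≤B) →
          bound (seq x n) (seq y n) Bδ≡g B>0 g>0 g<xy 0≤y (ℚ.≤-trans (p≤∣p∣ (seq y n)) y≤B))
        a (eventually-∧ y≥0 c))
      where
      bound : ∀ {B δ g} u v → B ℚ.* δ ≡ g → 0ℚ ℚ.< B → 0ℚ ℚ.< g → g ℚ.< u ℚ.* v →
              0ℚ ℚ.≤ v → v ℚ.≤ B → δ ℚ.< u
      bound {B} {δ} {g} u v e B>0 g>0 g<uv v≥0 v≤B = *-cancelˡ-< B δ u B>0
        (subst₂ ℚ._<_ (sym e) (ℚ.*-comm u B)
          (ℚ.<-≤-trans g<uv
            (ℚ.*-monoˡ-≤-nonNeg u {{ℚ.nonNegative (ℚ.<⇒≤ u>0)}} v≤B)))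
        where
        u>0 : 0ℚ ℚ.< u
        u>0 = ℚ.*-cancelˡ-<-nonNeg v {{ℚ.nonNegative v≥0}} {0ℚ} {u}
          (subst₂ ℚ._<_ (sym (ℚ.*-zeroʳ v)) (ℚ.*-comm u v) (ℚ.<-trans g>0 g<uv))

    pos-cancel-0 : ∀ {x y} → Pos x → x *ʳ y ≋ 0ʳ → y ≋ 0ʳ
    pos-cancel-0 {x} {y} (mkPos g g>0 a) (mk≋ e) = mk≋ λ ε ε>0 →
      eventually-zip
        (λ n → bound ε (seq x n) (seq y n)) a (e (g ℚ.* ε) (0<* g>0 ε>0))
      where
      bound : ∀ ε u v → g ℚ.< u → ℚ.∣ u ℚ.* v ℚ.- 0ℚ ∣ ℚ.< g ℚ.* ε → ℚ.∣ v ℚ.- 0ℚ ∣ ℚ.< ε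
      bound ε u v g<u uv<gε = *-cancelˡ-< g ℚ.∣ v ℚ.- 0ℚ ∣ ε g>0
        (ℚ.≤-<-trans
          (ℚ.*-monoʳ-≤-nonNeg ℚ.∣ v ℚ.- 0ℚ ∣ {{ℚ.nonNegative (ℚ.0≤∣p∣ (v ℚ.- 0ℚ))}}
            (ℚ.≤-trans (ℚ.<⇒≤ g<u) (p≤∣p∣ u)))
          (subst (ℚ._< g ℚ.* ε)
            (trans (cong ℚ.∣_∣ (solve 2 (λ x y → x :* y :- con 0ℚ := x :* (y :- con 0ℚ)) refl u v))
              (ℚ.∣p*q∣≡∣p∣*∣q∣ u (v ℚ.- 0ℚ)))
            uv<gε))

    pos⇒eventually≥0 : ∀ {x} → Pos x → Eventually λ n → 0ℚ ℚ.≤ seq x n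
    pos⇒eventually≥0 (mkPos g g>0 a) = eventually-map (λ n h → ℚ.<⇒≤ (ℚ.<-trans g>0 h)) a

    pos-+-nonNeg : ∀ {x y} → Pos x → (∀ n → 0ℚ ℚ.≤ seq y n) → Pos (x +ʳ y)
    pos-+-nonNeg {x} {y} (mkPos g g>0 a) y≥0 = mkPos g g>0
      (eventually-map (λ n h → subst (ℚ._< seq x n ℚ.+ seq y n) (ℚ.+-identityʳ g) (ℚ.+-mono-<-≤ h (y≥0 n))) a)

    -- Apartness from 0 is tight: one term far enough along the sequence decides
    -- between being small and being apart from 0.
    ¬apart⇒≋0 : ∀ x → (Pos x → ⊥) → (Pos (-ʳ x) → ⊥) → x ≋ 0ʳ
    ¬apart⇒≋0 x ¬pos ¬neg = mk≋ λ ε ε>0 →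
      let N , h = cauchy x (½ ℚ.* (½ ℚ.* ε)) (0<½* (0<½* ε>0)) in
      N , λ n N≤n → small ε ε>0 N h n N≤n
      where
      apart : ∀ ε → 0ℚ ℚ.< ε → ∀ y N → (∀ n → N ℕ.≤ n → seq y N ℚ.- seq y n ℚ.< ½ ℚ.* (½ ℚ.* ε)) →
              ½ ℚ.* ε ℚ.≤ seq y N → Pos y
      apart ε ε>0 y N h k = mkPos (½ ℚ.* (½ ℚ.* ε)) (0<½* (0<½* ε>0)) (N , λ n N≤n → by-sub
        (ℚ.+-mono-<-≤ (0<q-p (h n N≤n)) (0≤q-p k))
        (solve 3 (λ e u v → (con ½ :* (con ½ :* e) :- (u :- v)) :+ (u :- con ½ :* e) := v :- con ½ :* (con ½ :* e)) refl
          ε (seq y N) (seq y n)))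
      small : ∀ ε → 0ℚ ℚ.< ε → ∀ N → (∀ m n → N ℕ.≤ m → N ℕ.≤ n → ℚ.∣ seq x m ℚ.- seq x n ∣ ℚ.< ½ ℚ.* (½ ℚ.* ε)) →
              ∀ n → N ℕ.≤ n → ℚ.∣ seq x n ℚ.- 0ℚ ∣ ℚ.< ε
      small ε ε>0 N h n N≤n with ½ ℚ.* ε ℚ.≤? seq x N | ½ ℚ.* ε ℚ.≤? ℚ.- seq x N
      ... | yes p | _ = ⊥-elim (¬pos (apart ε ε>0 x N
        (λ n N≤n → ℚ.≤-<-trans (p≤∣p∣ (seq x N ℚ.- seq x n)) (h N n ℕ.≤-refl N≤n)) p))
      ... | _ | yes p = ⊥-elim (¬neg (apart ε ε>0 (-ʳ x) N
        (λ n N≤n → ℚ.≤-<-trans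
          (subst (ℚ._≤ ℚ.∣ seq x N ℚ.- seq x n ∣)
            (solve 2 (λ u v → :- (u :- v) := :- u :- (:- v)) refl (seq x N) (seq x n))
            (-p≤∣p∣ (seq x N ℚ.- seq x n)))
          (h N n ℕ.≤-refl N≤n)) p))
      ... | no p | no q = ∣p∣<⇐
        (by-sub (ℚ.+-mono-< (ℚ.+-mono-< (0<q-p (ℚ.≰⇒> p)) (0<q-p (ℚ.≤-<-trans (p≤∣p∣ (seq x n ℚ.- seq x N)) close))) (0<½* (0<½* ε>0)))
          (solve 3 (λ e u v → (con ½ :* e :- u) :+ (con ½ :* (con ½ :* e) :- (v :- u)) :+ con ½ :* (con ½ :* e) := e :- (v :- con 0ℚ)) refl
            ε (seq x N) (seq x n)))
        (by-sub (ℚ.+-mono-< (ℚ.+-mono-< (0<q-p (ℚ.≰⇒> q)) (0<q-p (ℚ.≤-<-trans (-p≤∣p∣ (seq x n ℚ.- seq x N)) close))) (0<½* (0<½* ε>0)))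
          (solve 3 (λ e u v → (con ½ :* e :- (:- u)) :+ (con ½ :* (con ½ :* e) :- (:- (v :- u))) :+ con ½ :* (con ½ :* e) := e :- (:- (v :- con 0ℚ))) refl
            ε (seq x N) (seq x n)))
        where
        close : ℚ.∣ seq x n ℚ.- seq x N ∣ ℚ.< ½ ℚ.* (½ ℚ.* ε)
        close = h n N N≤n ℕ.≤-refl

    ⋖-trans : ∀ {x y z} → x ⋖ y → y ⋖ z → x ⋖ z
    ⋖-trans {x} {y} {z} h k = pos-resp
      (≋-pointwise λ n → solve 3 (λ x y z → (y :- x) :+ (z :- y) := z :- x) refl
        (seq x n) (seq y n) (seq z n))
      (pos-+ h k)

    ⋖⇒≤ʳ : ∀ {x y} → x ⋖ y → x ≤ʳ y
    ⋖⇒≤ʳ {x} {y} (mkPos g g>0 a) ε ε>0 = eventually-map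
      (λ n p → by-sub (ℚ.+-mono-< (ℚ.<-trans g>0 p) ε>0)
        (solve 3 (λ x y e → (y :- x) :+ e := (y :+ e) :- x) refl (seq x n) (seq y n) ε))
      a

    Pos⇒0<ʳ : ∀ {x} → Pos x → 0ʳ <ʳ x
    Pos⇒0<ʳ {x} (mkPos g g>0 a) = g , g>0 ,
      eventually-map (λ n → subst (ℚ._< seq x n) (sym (ℚ.+-identityˡ g))) a

  fromℚ-cancel-≤ : ∀ {p q} → fromℚ p ≤ʳ fromℚ q → p ℚ.≤ q
  fromℚ-cancel-≤ {p} {q} h = ℚ.≮⇒≥ λ q<p →
    let N , k = h (p ℚ.- q) (0<q-p q<p)
    in ℚ.<-irrefl (p≡q+[p-q] p q) (k N ℕ.≤-refl)

  fromℚ-injective : ∀ {p q} → fromℚ p ≋ fromℚ q → p ≡ q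
  fromℚ-injective {p} {q} h = ℚ.≤-antisym (one h) (one (≋-sym h))
    where
    one : ∀ {p q} → fromℚ p ≋ fromℚ q → p ℚ.≤ q
    one {p} {q} (mk≋ e) = fromℚ-cancel-≤ λ ε ε>0 → eventually-map
      (λ n k → by-sub (0<q-p (ℚ.≤-<-trans (p≤∣p∣ (p ℚ.- q)) k))
        (solve 3 (λ p q e → e :- (p :- q) := (q :+ e) :- p) refl p q ε))
      (e ε ε>0)
      where open ℚ-Solver.+-*-Solver

-- Polynomial expressions, their values in ℚ and ℝ, and Lipschitz bounds

module Expressions where
  open Reals
  import Data.Nat.Coprimality as Coprime
  open import Data.Rational.Base using (mkℚ)

  -- Abstract, because unfolding i / 1 runs the gcd algorithm on open terms.
  abstract
    ι : ℤ → ℚ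
    ι i = mkℚ i 0 (Coprime.sym (Coprime.1-coprimeTo ℤ.∣ i ∣))

    /1≡ι : ∀ i → i ℚ./ 1 ≡ ι i
    /1≡ι i = ℚ.↥p/↧p≡p (ι i)

    ι-0 : ι (+ 0) ≡ 0ℚ
    ι-0 = refl

    ι-1 : ι (+ 1) ≡ 1ℚ
    ι-1 = refl

    ι-+ : ∀ i j → ι (i ℤ.+ j) ≡ ι i ℚ.+ ι j
    ι-+ i j = trans (sym (/1≡ι (i ℤ.+ j)))
      (cong (ℚ._/ 1) (sym (cong₂ ℤ._+_ (ℤ.*-identityʳ i) (ℤ.*-identityʳ j))))

    ι-* : ∀ i j → ι (i ℤ.* j) ≡ ι i ℚ.* ι j
    ι-* i j = sym (/1≡ι (i ℤ.* j))

    ι-neg : ∀ i → ι (ℤ.- i) ≡ ℚ.- ι i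
    ι-neg (+ zero)     = refl
    ι-neg (+ suc n)    = refl
    ι-neg (ℤ.-[1+ n ]) = refl

    ι-mono-≤ : ∀ {i j} → i ℤ.≤ j → ι i ℚ.≤ ι j
    ι-mono-≤ {i} {j} h =
      ℚ.*≤* (subst₂ ℤ._≤_ (sym (ℤ.*-identityʳ i)) (sym (ℤ.*-identityʳ j)) h)

    ι-cancel-≤ : ∀ {i j} → ι i ℚ.≤ ι j → i ℤ.≤ j
    ι-cancel-≤ {i} {j} h = subst₂ ℤ._≤_ (ℤ.*-identityʳ i) (ℤ.*-identityʳ j) (ℚ.drop-*≤* h)

    archimedean : ∀ q → ∃[ n ] q ℚ.≤ ι (+ n)
    archimedean q@(mkℚ i d _) = ℤ.∣ i ∣ ,
      ℚ.*≤* (subst (ℤ._≤ + ℤ.∣ i ∣ ℤ.* (+ suc d)) (sym (ℤ.*-identityʳ i))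
        (ℤ.≤-trans (i≤∣i∣ i) (subst (+ ℤ.∣ i ∣ ℤ.≤_) (ℤ.pos-* ℤ.∣ i ∣ (suc d))
          (ℤ.+≤+ (ℕ.m≤m*n ℤ.∣ i ∣ (suc d))))))
      where
      i≤∣i∣ : ∀ i → i ℤ.≤ + ℤ.∣ i ∣
      i≤∣i∣ (+ n)       = ℤ.≤-refl
      i≤∣i∣ ℤ.-[1+ n ]  = ℤ.-≤+

  ι-nonNeg : ∀ n → 0ℚ ℚ.≤ ι (+ n)
  ι-nonNeg n = subst (ℚ._≤ ι (+ n)) ι-0 (ι-mono-≤ (ℤ.+≤+ ℕ.z≤n))

  ι-suc : ∀ n → ι (+ suc n) ≡ 1ℚ ℚ.+ ι (+ n)
  ι-suc n = trans (ι-+ (+ 1) (+ n)) (cong (ℚ._+ ι (+ n)) ι-1)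

  ι-pos : ∀ n → 0ℚ ℚ.< ι (+ suc n)
  ι-pos n = subst (0ℚ ℚ.<_) (sym (ι-suc n)) (ℚ.+-mono-<-≤ 0<1ℚ (ι-nonNeg n))

  halve : ℕ → ℚ → ℚ
  halve zero    w = w
  halve (suc n) w = ½ ℚ.* halve n w

  abstract
    -- The inequality `(n + 1) w / 2ⁿ ≤ w` reduces the decay of `w / 2ⁿ` to the Archimedean
    -- property.
    halve-small : ∀ {w} → 0ℚ ℚ.≤ w → ∀ ε → 0ℚ ℚ.< ε → Eventually λ n → halve n w ℚ.< ε
    halve-small {w} w≥0 ε ε>0 =
      -- `η = (w + 1) / ε`; the added 1 makes the dividend positive even if `w = 0`.
      let η , _ , εη≡w+1 = divide ε>0 (ℚ.+-mono-≤-< w≥0 0<1ℚ)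
          N , η≤N = archimedean η
      in N , λ n N≤n → *-cancelˡ-< (ι (+ suc n)) (halve n w) ε (ι-pos n)
        (ℚ.≤-<-trans (bound n)
          (ℚ.<-≤-trans (by-sub 0<1ℚ (solve 1 (λ w → con 1ℚ := (w :+ con 1ℚ) :- w) refl w))
            (ℚ.≤-trans (ℚ.≤-reflexive (sym εη≡w+1))
              (ℚ.≤-trans (ℚ.*-monoˡ-≤-nonNeg ε {{ℚ.nonNegative (ℚ.<⇒≤ ε>0)}}
                  (ℚ.≤-trans η≤N (ι-mono-≤ (ℤ.+≤+ (ℕ.≤-trans N≤n (ℕ.n≤1+n n))))))
                (ℚ.≤-reflexive (ℚ.*-comm ε (ι (+ suc n))))))))
      where
      open ℚ-Solver.+-*-Solver
      halve≥0 : ∀ n → 0ℚ ℚ.≤ halve n w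
      halve≥0 zero = w≥0
      halve≥0 (suc n) = 0≤* (ℚ.nonNegative⁻¹ ½) (halve≥0 n)
      bound : ∀ n → ι (+ suc n) ℚ.* halve n w ℚ.≤ w
      bound zero = ℚ.≤-reflexive (trans (cong (ℚ._* w) ι-1) (ℚ.*-identityˡ w))
      bound (suc n) = ℚ.≤-trans
        (p≤q⇐0≤q-p (subst (0ℚ ℚ.≤_)
          (trans (solve 2 (λ k h → con ½ :* (k :* h) := (con 1ℚ :+ k) :* h :- (con 1ℚ :+ (con 1ℚ :+ k)) :* (con ½ :* h)) refl
                   (ι (+ n)) (halve n w))
            (cong₂ (λ a b → a ℚ.* halve n w ℚ.- b ℚ.* (½ ℚ.* halve n w)) (sym (ι-suc n))
              (sym (trans (ι-suc (suc n)) (cong (1ℚ ℚ.+_) (ι-suc n))))))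
          (0≤* (ℚ.nonNegative⁻¹ ½) (0≤* (ι-nonNeg n) (halve≥0 n)))))
        (bound n)

  infixl 6 _⊕_
  infixl 7 _⊗_

  -- Syntax, because one polynomial is evaluated in several rings, and because Lipschitz bounds are
  -- computed by recursion on its construction.
  data Expr : Set where
    var     : Expr
    con     : ℚ → Expr
    _⊕_ _⊗_ : Expr → Expr → Expr

  module Eval (R : CommutativeRing 0ℓ 0ℓ) (ι : ℚ → CommutativeRing.Carrier R) where
    open CommutativeRing R
    ⟦_⟧ : Expr → Carrier → Carrier
    ⟦ var ⟧   x = x
    ⟦ con q ⟧ x = ι q
    ⟦ e ⊕ f ⟧ x = ⟦ e ⟧ x + ⟦ f ⟧ x
    ⟦ e ⊗ f ⟧ x = ⟦ e ⟧ x * ⟦ f ⟧ x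

  open Eval ℚ.+-*-commutativeRing id public renaming (⟦_⟧ to evalℚ)
  open Eval ℝ-ring fromℚ public renaming (⟦_⟧ to evalℝ)

  -- The terms of `evalℝ e x` are exact rational values of `e`, so estimates over ℚ transfer to ℝ.
  seq-evalℝ : ∀ e x n → seq (evalℝ e x) n ≡ evalℚ e (seq x n)
  seq-evalℝ var     x n = refl
  seq-evalℝ (con q) x n = refl
  seq-evalℝ (e ⊕ f) x n = cong₂ ℚ._+_ (seq-evalℝ e x n) (seq-evalℝ f x n)
  seq-evalℝ (e ⊗ f) x n = cong₂ ℚ._*_ (seq-evalℝ e x n) (seq-evalℝ f x n)

  evalℝ-fromℚ : ∀ e q → evalℝ e (fromℚ q) ≋ fromℚ (evalℚ e q)
  evalℝ-fromℚ e q = ≋-pointwise (seq-evalℝ e (fromℚ q))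

  -- The bound on the values accompanies the slope because the slope of a product involves the
  -- bounds of both factors.
  record LipschitzOn (B : ℚ) (f : ℚ → ℚ) : Set where
    field
      bound slope : ℚ
      0≤slope     : 0ℚ ℚ.≤ slope
      0≤bound     : 0ℚ ℚ.≤ bound
      isBound     : ∀ x → ℚ.∣ x ∣ ℚ.≤ B → ℚ.∣ f x ∣ ℚ.≤ bound
      isSlope     : ∀ x y → ℚ.∣ x ∣ ℚ.≤ B → ℚ.∣ y ∣ ℚ.≤ B →
                    ℚ.∣ f x ℚ.- f y ∣ ℚ.≤ slope ℚ.* ℚ.∣ x ℚ.- y ∣
  open LipschitzOn

  ∣*∣-mono : ∀ {a b c d} → ℚ.∣ a ∣ ℚ.≤ c → ℚ.∣ b ∣ ℚ.≤ d → 0ℚ ℚ.≤ c → ℚ.∣ a ℚ.* b ∣ ℚ.≤ c ℚ.* d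
  ∣*∣-mono {a} {b} {c} {d} a≤c b≤d c≥0 = subst (ℚ._≤ c ℚ.* d) (sym (ℚ.∣p*q∣≡∣p∣*∣q∣ a b))
    (ℚ.≤-trans (ℚ.*-monoʳ-≤-nonNeg ℚ.∣ b ∣ {{ℚ.nonNegative (ℚ.0≤∣p∣ b)}} a≤c)
      (ℚ.*-monoˡ-≤-nonNeg c {{ℚ.nonNegative c≥0}} b≤d))

  ∣+∣-mono : ∀ {a b c d} → ℚ.∣ a ∣ ℚ.≤ c → ℚ.∣ b ∣ ℚ.≤ d → ℚ.∣ a ℚ.+ b ∣ ℚ.≤ c ℚ.+ d
  ∣+∣-mono {a} {b} h k = ℚ.≤-trans (ℚ.∣p+q∣≤∣p∣+∣q∣ a b) (ℚ.+-mono-≤ h k)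

  abstract
    lipschitz : ∀ B → 0ℚ ℚ.≤ B → ∀ e → LipschitzOn B (evalℚ e)
    lipschitz B B≥0 var = record
      { bound = B ; slope = 1ℚ ; 0≤slope = ℚ.<⇒≤ 0<1ℚ ; 0≤bound = B≥0
      ; isBound = λ _ h → h ; isSlope = λ x y _ _ → ℚ.≤-reflexive (sym (ℚ.*-identityˡ _)) }
    lipschitz B B≥0 (con q) = record
      { bound = ℚ.∣ q ∣ ; slope = 0ℚ ; 0≤slope = ℚ.≤-refl ; 0≤bound = ℚ.0≤∣p∣ q
      ; isBound = λ _ _ → ℚ.≤-refl
      ; isSlope = λ x y _ _ → ℚ.≤-reflexive
          (trans (cong ℚ.∣_∣ (ℚ.+-inverseʳ q)) (sym (ℚ.*-zeroˡ ℚ.∣ x ℚ.- y ∣))) }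
    lipschitz B B≥0 (e ⊕ f) = record
      { bound = bound le ℚ.+ bound lf ; slope = slope le ℚ.+ slope lf
      ; 0≤slope = ℚ.+-mono-≤ (0≤slope le) (0≤slope lf)
      ; 0≤bound = ℚ.+-mono-≤ (0≤bound le) (0≤bound lf)
      ; isBound = λ x h → ∣+∣-mono {evalℚ e x} {evalℚ f x} (isBound le x h) (isBound lf x h)
      ; isSlope = λ x y h k → subst₂ ℚ._≤_
          (cong ℚ.∣_∣ (solve 4 (λ a b c d → (a :- b) :+ (c :- d) := (a :+ c) :- (b :+ d)) refl
            (evalℚ e x) (evalℚ e y) (evalℚ f x) (evalℚ f y)))
          (sym (ℚ.*-distribʳ-+ ℚ.∣ x ℚ.- y ∣ (slope le) (slope lf)))
          (∣+∣-mono {evalℚ e x ℚ.- evalℚ e y} {evalℚ f x ℚ.- evalℚ f y}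
            (isSlope le x y h k) (isSlope lf x y h k)) }
      where
      open ℚ-Solver.+-*-Solver hiding (con)
      le : LipschitzOn B (evalℚ e)
      le = lipschitz B B≥0 e
      lf : LipschitzOn B (evalℚ f)
      lf = lipschitz B B≥0 f
    lipschitz B B≥0 (e ⊗ f) = record
      { bound = bound le ℚ.* bound lf ; slope = bound le ℚ.* slope lf ℚ.+ bound lf ℚ.* slope le
      ; 0≤slope = ℚ.+-mono-≤ (0≤* (0≤bound le) (0≤slope lf)) (0≤* (0≤bound lf) (0≤slope le))
      ; 0≤bound = 0≤* (0≤bound le) (0≤bound lf)
      ; isBound = λ x h → ∣*∣-mono {evalℚ e x} {evalℚ f x} (isBound le x h) (isBound lf x h) (0≤bound le)
      ; isSlope = λ x y h k → subst₂ ℚ._≤_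
          (cong ℚ.∣_∣ (solve 4 (λ a b c d → a :* (c :- d) :+ d :* (a :- b) := a :* c :- b :* d) refl
            (evalℚ e x) (evalℚ e y) (evalℚ f x) (evalℚ f y)))
          (solve 5 (λ a b c d t → a :* (b :* t) :+ c :* (d :* t) := (a :* b :+ c :* d) :* t) refl
            (bound le) (slope lf) (bound lf) (slope le) ℚ.∣ x ℚ.- y ∣)
          (∣+∣-mono {evalℚ e x ℚ.* (evalℚ f x ℚ.- evalℚ f y)} {evalℚ f y ℚ.* (evalℚ e x ℚ.- evalℚ e y)}
            (∣*∣-mono {evalℚ e x} {evalℚ f x ℚ.- evalℚ f y} (isBound le x h) (isSlope lf x y h k) (0≤bound le))
            (∣*∣-mono {evalℚ f y} {evalℚ e x ℚ.- evalℚ e y} (isBound lf y k) (isSlope le x y h k) (0≤bound lf))) }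
      where
      open ℚ-Solver.+-*-Solver hiding (con)
      le : LipschitzOn B (evalℚ e)
      le = lipschitz B B≥0 e
      lf : LipschitzOn B (evalℚ f)
      lf = lipschitz B B≥0 f

-- The intermediate value theorem by bisection

module IntermediateValues where
  open Reals
  open Expressions

  open LipschitzOn

  ∣p-q∣≤⇐ : ∀ {p q w} → p ℚ.- q ℚ.≤ w → q ℚ.- p ℚ.≤ w → ℚ.∣ p ℚ.- q ∣ ℚ.≤ w
  ∣p-q∣≤⇐ {p} {q} h k = ∣p∣≤⇐ h (subst (ℚ._≤ _) (sym (neg-sub p q)) k)

  module Bisection (e : Expr) where

    -- Weak inequalities at both ends, since `≤` on ℚ is total: every midpoint can replace one end,
    -- even a midpoint that is itself a zero.
    record Bracket : Set where
      constructor bracket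
      field
        lo hi : ℚ
        0≤lo  : 0ℚ ℚ.≤ evalℚ e lo
        hi≤0  : evalℚ e hi ℚ.≤ 0ℚ
    open Bracket

    width : Bracket → ℚ
    width b = hi b ℚ.- lo b

    bisect : Bracket → Bracket
    bisect (bracket lo hi h k) with ℚ.≤-total 0ℚ (evalℚ e (½ ℚ.* (lo ℚ.+ hi)))
    ... | inj₁ m = bracket (½ ℚ.* (lo ℚ.+ hi)) hi m k
    ... | inj₂ m = bracket lo (½ ℚ.* (lo ℚ.+ hi)) h m

    open ℚ-Solver.+-*-Solver

    width-bisect : ∀ b → width (bisect b) ≡ ½ ℚ.* width b
    width-bisect (bracket lo hi h k) with ℚ.≤-total 0ℚ (evalℚ e (½ ℚ.* (lo ℚ.+ hi)))
    ... | inj₁ m = solve 2 (λ l h → h :- con ½ :* (l :+ h) := con ½ :* (h :- l)) refl lo hi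
    ... | inj₂ m = solve 2 (λ l h → con ½ :* (l :+ h) :- l := con ½ :* (h :- l)) refl lo hi

    0≤half : ∀ l h → l ℚ.≤ h → 0ℚ ℚ.≤ ½ ℚ.* (h ℚ.- l)
    0≤half l h l≤h = 0≤* (ℚ.nonNegative⁻¹ ½) (0≤q-p l≤h)

    lo-bisect : ∀ b → lo b ℚ.≤ hi b → lo b ℚ.≤ lo (bisect b)
    lo-bisect (bracket lo hi h k) l≤h with ℚ.≤-total 0ℚ (evalℚ e (½ ℚ.* (lo ℚ.+ hi)))
    ... | inj₁ m = p≤q⇐0≤q-p (subst (0ℚ ℚ.≤_)
      (solve 2 (λ l h → con ½ :* (h :- l) := con ½ :* (l :+ h) :- l) refl lo hi) (0≤half lo hi l≤h))
    ... | inj₂ m = ℚ.≤-refl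

    hi-bisect : ∀ b → lo b ℚ.≤ hi b → hi (bisect b) ℚ.≤ hi b
    hi-bisect (bracket lo hi h k) l≤h with ℚ.≤-total 0ℚ (evalℚ e (½ ℚ.* (lo ℚ.+ hi)))
    ... | inj₁ m = ℚ.≤-refl
    ... | inj₂ m = p≤q⇐0≤q-p (subst (0ℚ ℚ.≤_)
      (solve 2 (λ l h → con ½ :* (h :- l) := h :- con ½ :* (l :+ h)) refl lo hi) (0≤half lo hi l≤h))

    module _ (b₀ : Bracket) (lo≤hi : lo b₀ ℚ.≤ hi b₀) where
      w : ℚ
      w = width b₀

      0≤w : 0ℚ ℚ.≤ w
      0≤w = 0≤q-p lo≤hi

      iter : ℕ → Bracket
      iter zero    = b₀
      iter (suc n) = bisect (iter n)

      width-iter : ∀ n → width (iter n) ≡ halve n w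
      width-iter zero    = refl
      width-iter (suc n) = trans (width-bisect (iter n)) (cong (½ ℚ.*_) (width-iter n))

      lo≤hi-iter : ∀ n → lo (iter n) ℚ.≤ hi (iter n)
      lo≤hi-iter n = p≤q⇐0≤q-p (subst (0ℚ ℚ.≤_) (sym (width-iter n)) (halve≥0 n))
        where
        halve≥0 : ∀ n → 0ℚ ℚ.≤ halve n w
        halve≥0 zero    = 0≤w
        halve≥0 (suc n) = 0≤* (ℚ.nonNegative⁻¹ ½) (halve≥0 n)

      nested : ∀ m k → lo (iter m) ℚ.≤ lo (iter (k ℕ.+ m)) × hi (iter (k ℕ.+ m)) ℚ.≤ hi (iter m)
      nested m zero    = ℚ.≤-refl , ℚ.≤-refl
      nested m (suc k) = let h , g = nested m k in
          ℚ.≤-trans h (lo-bisect (iter (k ℕ.+ m)) (lo≤hi-iter (k ℕ.+ m)))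
        , ℚ.≤-trans (hi-bisect (iter (k ℕ.+ m)) (lo≤hi-iter (k ℕ.+ m))) g

      nested-≤ : ∀ {m n} → m ℕ.≤ n → lo (iter m) ℚ.≤ lo (iter n) × lo (iter n) ℚ.≤ hi (iter m)
      nested-≤ {m} {n} m≤n =
        subst (λ n → lo (iter m) ℚ.≤ lo (iter n) × lo (iter n) ℚ.≤ hi (iter m)) (ℕ.m∸n+n≡m m≤n)
          (let h , g = nested m (n ℕ.∸ m) in h , ℚ.≤-trans (lo≤hi-iter (n ℕ.∸ m ℕ.+ m)) g)

      close : ∀ {N m n} → N ℕ.≤ m → N ℕ.≤ n → lo (iter m) ℚ.- lo (iter n) ℚ.≤ halve N w
      close {N} {m} {n} N≤m N≤n = subst (lo (iter m) ℚ.- lo (iter n) ℚ.≤_) (width-iter N)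
        (ℚ.+-mono-≤ (proj₂ (nested-≤ N≤m)) (ℚ.neg-antimono-≤ (proj₁ (nested-≤ N≤n))))

      abstract
        iter-cauchy : Cauchy (lo ∘ iter)
        iter-cauchy ε ε>0 with halve-small 0≤w ε ε>0
        ... | N , small = N , λ m n N≤m N≤n → ℚ.≤-<-trans
          (∣p-q∣≤⇐ {lo (iter m)} {lo (iter n)} (close N≤m N≤n) (close N≤n N≤m)) (small N ℕ.≤-refl)

      root : ℝ
      root = mkℝ (lo ∘ iter) iter-cauchy

      root-bounds : ∀ n → lo b₀ ℚ.≤ seq root n × seq root n ℚ.≤ hi b₀
      root-bounds n = nested-≤ {0} {n} ℕ.z≤n

      -- Squeezing: `0 ≤ e lo ≤ e lo - e hi ≤ slope * (hi - lo)`, and every step halves the width.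
      root-zero : evalℝ e root ≋ 0ʳ
      root-zero = mk≋ λ ε ε>0 →
        let δ , δ>0 , kδ≡ε = divide k>0 ε>0 in
        eventually-map (λ n small →
          subst (λ t → ℚ.∣ t ∣ ℚ.< ε)
            (trans (sym (seq-evalℝ e root n)) (sym (ℚ.+-identityʳ (seq (evalℝ e root) n))))
            (value n small kδ≡ε))
          (halve-small 0≤w δ δ>0)
        where
        B : ℚ
        B = ℚ.∣ lo b₀ ∣ ℚ.+ ℚ.∣ hi b₀ ∣
        ℓ : LipschitzOn B (evalℚ e)
        ℓ = lipschitz B (ℚ.+-mono-≤ (ℚ.0≤∣p∣ (lo b₀)) (ℚ.0≤∣p∣ (hi b₀))) e
        -- One more than the slope, so that `ε` can be divided by it even when the slope is 0.
        k : ℚ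
        k = slope ℓ ℚ.+ 1ℚ
        k>0 : 0ℚ ℚ.< k
        k>0 = ℚ.+-mono-≤-< (0≤slope ℓ) 0<1ℚ
        within : ∀ x → lo b₀ ℚ.≤ x → x ℚ.≤ hi b₀ → ℚ.∣ x ∣ ℚ.≤ B
        within x l≤x x≤h = ∣p∣≤⇐
          (ℚ.≤-trans x≤h (ℚ.≤-trans (p≤∣p∣ (hi b₀))
            (subst (ℚ._≤ B) (ℚ.+-identityˡ ℚ.∣ hi b₀ ∣) (ℚ.+-monoˡ-≤ ℚ.∣ hi b₀ ∣ (ℚ.0≤∣p∣ (lo b₀))))))
          (ℚ.≤-trans (ℚ.neg-antimono-≤ l≤x) (ℚ.≤-trans (-p≤∣p∣ (lo b₀))
            (subst (ℚ._≤ B) (ℚ.+-identityʳ ℚ.∣ lo b₀ ∣) (ℚ.+-monoʳ-≤ ℚ.∣ lo b₀ ∣ (ℚ.0≤∣p∣ (hi b₀))))))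
        value : ∀ n {δ ε} → halve n w ℚ.< δ → k ℚ.* δ ≡ ε → ℚ.∣ evalℚ e (lo (iter n)) ∣ ℚ.< ε
        value n {δ} small refl = ℚ.≤-<-trans step (ℚ.*-monoʳ-<-pos k {{ℚ.positive k>0}} small)
          where
          l h : ℚ
          l = lo (iter n)
          h = hi (iter n)
          l≤h : l ℚ.≤ h
          l≤h = lo≤hi-iter n
          nest : lo b₀ ℚ.≤ l × h ℚ.≤ hi b₀
          nest = subst (λ j → lo b₀ ℚ.≤ lo (iter j) × hi (iter j) ℚ.≤ hi b₀) (ℕ.+-identityʳ n) (nested 0 n)
          gap≡ : ℚ.∣ l ℚ.- h ∣ ≡ halve n w
          gap≡ = trans (cong ℚ.∣_∣ (sym (neg-sub h l)))
            (trans (ℚ.∣-p∣≡∣p∣ (h ℚ.- l))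
              (trans (ℚ.0≤p⇒∣p∣≡p (0≤q-p l≤h)) (width-iter n)))
          step : ℚ.∣ evalℚ e l ∣ ℚ.≤ k ℚ.* halve n w
          step = ℚ.≤-trans (ℚ.≤-reflexive (ℚ.0≤p⇒∣p∣≡p (0≤lo (iter n))))
            (ℚ.≤-trans
              (subst (ℚ._≤ evalℚ e l ℚ.- evalℚ e h) (ℚ.+-identityʳ (evalℚ e l))
                (ℚ.+-monoʳ-≤ (evalℚ e l) (ℚ.neg-antimono-≤ (hi≤0 (iter n)))))
              (ℚ.≤-trans (p≤∣p∣ (evalℚ e l ℚ.- evalℚ e h))
                (ℚ.≤-trans
                  (isSlope ℓ l h
                    (within l (proj₁ nest) (ℚ.≤-trans l≤h (proj₂ nest)))
                    (within h (ℚ.≤-trans (proj₁ nest) l≤h) (proj₂ nest)))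
                  (subst (λ t → slope ℓ ℚ.* t ℚ.≤ k ℚ.* halve n w) (sym gap≡)
                    (ℚ.*-monoʳ-≤-nonNeg (halve n w)
                      {{ℚ.nonNegative (subst (0ℚ ℚ.≤_) (width-iter n) (0≤q-p l≤h))}}
                      (subst (ℚ._≤ k) (ℚ.+-identityʳ (slope ℓ)) (ℚ.+-monoʳ-≤ (slope ℓ) (ℚ.<⇒≤ 0<1ℚ))))))))

  common-lower : ∀ {p q} → 0ℚ ℚ.< p → 0ℚ ℚ.< q → ∃[ d ] 0ℚ ℚ.< d × d ℚ.≤ p × d ℚ.≤ q
  common-lower {p} {q} p>0 q>0 with ℚ.≤-total p q
  ... | inj₁ p≤q = p , p>0 , ℚ.≤-refl , p≤q
  ... | inj₂ q≤p = q , q>0 , q≤p , ℚ.≤-refl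

  module _ where
    open ℚ-Solver.+-*-Solver

    two four : ℚ
    two = 1ℚ ℚ.+ 1ℚ
    four = two ℚ.+ two

    two>0 : 0ℚ ℚ.< two
    two>0 = ℚ.+-mono-< 0<1ℚ 0<1ℚ

    value-near : ∀ {B f} (ℓ : LipschitzOn B f) {x y δ g} → ℚ.∣ x ∣ ℚ.≤ B → ℚ.∣ y ∣ ℚ.≤ B →
      ℚ.∣ x ℚ.- y ∣ ℚ.≤ two ℚ.* δ → (slope ℓ ℚ.+ 1ℚ) ℚ.* (two ℚ.* δ) ℚ.≤ g → 0ℚ ℚ.≤ δ →
      ℚ.∣ f x ℚ.- f y ∣ ℚ.≤ g
    value-near ℓ {x} {y} {δ} x≤B y≤B close small δ≥0 = ℚ.≤-trans (isSlope ℓ x y x≤B y≤B)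
      (ℚ.≤-trans (ℚ.*-monoˡ-≤-nonNeg (slope ℓ) {{ℚ.nonNegative (0≤slope ℓ)}} close)
        (ℚ.≤-trans (ℚ.*-monoʳ-≤-nonNeg (two ℚ.* δ) {{ℚ.nonNegative (0≤* (ℚ.<⇒≤ two>0) δ≥0)}}
          (subst (ℚ._≤ slope ℓ ℚ.+ 1ℚ) (ℚ.+-identityʳ (slope ℓ)) (ℚ.+-monoʳ-≤ (slope ℓ) (ℚ.<⇒≤ 0<1ℚ))))
          small))

    -- Bisection wants rational ends with decided signs, whereas `a` and `b` are real. The ends `a′`
    -- and `b′` are terms of the two sequences, taken far out and moved inwards by `2 δ`. Later
    -- terms stay within `δ` of the chosen ones, so the zero keeps distance `δ` from `a` and `b`,
    -- which makes the final inequalities strict.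
    module IVT (e : Expr) (a b : ℝ) (a<b : a ⋖ b) (e[a] : Pos (evalℝ e a)) (e[b] : Pos (-ʳ evalℝ e b)) where
      Ba Bb B : ℚ
      Ba = proj₁ (seq-bounded a)
      Bb = proj₁ (seq-bounded b)
      B = Ba ℚ.+ Bb ℚ.+ 1ℚ

      B≥0 : 0ℚ ℚ.≤ B
      B≥0 = ℚ.<⇒≤ (ℚ.+-mono-< (ℚ.+-mono-< (proj₁ (proj₂ (seq-bounded a))) (proj₁ (proj₂ (seq-bounded b)))) 0<1ℚ)

      ℓ : LipschitzOn B (evalℚ e)
      ℓ = lipschitz B B≥0 e

      k>0 : 0ℚ ℚ.< (slope ℓ ℚ.+ 1ℚ) ℚ.* two
      k>0 = 0<* (ℚ.+-mono-≤-< (0≤slope ℓ) 0<1ℚ) two>0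

      -- `2δ≤1` keeps the moved ends within `B`, whose summand 1 is reserved for that; `4δ≤gap`
      -- keeps `a′ ≤ b′`; the last two bounds keep the Lipschitz error of the move below the values
      -- at the ends, so that the signs survive.
      record Scale : Set where
        field
          δ      : ℚ
          δ>0    : 0ℚ ℚ.< δ
          2δ≤1   : two ℚ.* δ ℚ.≤ 1ℚ
          4δ≤gap : four ℚ.* δ ℚ.≤ gap a<b
          kδ≤a   : (slope ℓ ℚ.+ 1ℚ) ℚ.* (two ℚ.* δ) ℚ.≤ gap e[a]
          kδ≤b   : (slope ℓ ℚ.+ 1ℚ) ℚ.* (two ℚ.* δ) ℚ.≤ gap e[b]

      mult-≤ : ∀ {c d p g} → 0ℚ ℚ.< c → c ℚ.* p ≡ g → d ℚ.≤ p → c ℚ.* d ℚ.≤ g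
      mult-≤ {c} c>0 refl d≤p = ℚ.*-monoˡ-≤-nonNeg c {{ℚ.nonNegative (ℚ.<⇒≤ c>0)}} d≤p

      scale-exists : Scale
      scale-exists =
        let p₁ , p₁>0 , e₁ = divide two>0 0<1ℚ
            p₂ , p₂>0 , e₂ = divide (ℚ.+-mono-< two>0 two>0) (0<gap a<b)
            p₃ , p₃>0 , e₃ = divide k>0 (0<gap e[a])
            p₄ , p₄>0 , e₄ = divide k>0 (0<gap e[b])
            d , d>0 , d≤p₁ , d≤p₂ = common-lower p₁>0 p₂>0
            d′ , d′>0 , d′≤p₃ , d′≤p₄ = common-lower p₃>0 p₄>0
            δ , δ>0 , δ≤d , δ≤d′ = common-lower d>0 d′>0
            assoc = ℚ.*-assoc (slope ℓ ℚ.+ 1ℚ) two δ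
        in record
          { δ = δ ; δ>0 = δ>0
          ; 2δ≤1 = mult-≤ two>0 e₁ (ℚ.≤-trans δ≤d d≤p₁)
          ; 4δ≤gap = mult-≤ (ℚ.+-mono-< two>0 two>0) e₂ (ℚ.≤-trans δ≤d d≤p₂)
          ; kδ≤a = subst (ℚ._≤ _) assoc (mult-≤ k>0 e₃ (ℚ.≤-trans δ≤d′ d′≤p₃))
          ; kδ≤b = subst (ℚ._≤ _) assoc (mult-≤ k>0 e₄ (ℚ.≤-trans δ≤d′ d′≤p₄)) }

      open Scale scale-exists

      2δ≥0 : 0ℚ ℚ.≤ two ℚ.* δ
      2δ≥0 = 0≤* (ℚ.<⇒≤ two>0) (ℚ.<⇒≤ δ>0)

      moment : ∃[ n ] (gap a<b ℚ.< seq b n ℚ.- seq a n) × (gap e[a] ℚ.< evalℚ e (seq a n)) ×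
                      (gap e[b] ℚ.< ℚ.- evalℚ e (seq b n)) ×
                      (ℚ.∣ seq a n ∣ ℚ.≤ Ba) × (ℚ.∣ seq b n ∣ ℚ.≤ Bb) ×
                      (Eventually λ m → ℚ.∣ seq a m ℚ.- seq a n ∣ ℚ.< δ) ×
                      (Eventually λ m → ℚ.∣ seq b m ℚ.- seq b n ∣ ℚ.< δ)
      moment =
        let N , h = eventually-∧ (above a<b) (eventually-∧ (above e[a]) (eventually-∧ (above e[b])
                      (eventually-∧ (proj₂ (proj₂ (seq-bounded a))) (proj₂ (proj₂ (seq-bounded b))))))
            M₁ , c₁ = cauchy a δ δ>0
            M₂ , c₂ = cauchy b δ δ>0
            n = N ℕ.⊔ (M₁ ℕ.⊔ M₂)
            M₁⊔M₂≤n = ℕ.m≤n⊔m N (M₁ ℕ.⊔ M₂)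
            M₁≤n = ℕ.m⊔n≤o⇒m≤o M₁ M₂ M₁⊔M₂≤n
            M₂≤n = ℕ.m⊔n≤o⇒n≤o M₁ M₂ M₁⊔M₂≤n
            p , q , r , s , t = h n (ℕ.m≤m⊔n N (M₁ ℕ.⊔ M₂))
        in n , p
         , subst (gap e[a] ℚ.<_) (seq-evalℝ e a n) q
         , subst (λ u → gap e[b] ℚ.< ℚ.- u) (seq-evalℝ e b n) r
         , s , t
         , (M₁ , λ m M₁≤m → c₁ m n M₁≤m M₁≤n)
         , (M₂ , λ m M₂≤m → c₂ m n M₂≤m M₂≤n)

      n : ℕ
      n = proj₁ moment

      a′ b′ : ℚ
      a′ = seq a n ℚ.+ two ℚ.* δ
      b′ = seq b n ℚ.- two ℚ.* δ

      abstract
        a′≤b′ : a′ ℚ.≤ b′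
        a′≤b′ = p≤q⇐0≤q-p (subst (0ℚ ℚ.≤_)
          (solve 4 (λ a b d g → (g :- con four :* d) :+ ((b :- a) :- g) := (b :- con two :* d) :- (a :+ con two :* d)) refl
            (seq a n) (seq b n) δ (gap a<b))
          (ℚ.+-mono-≤ (0≤q-p 4δ≤gap) (0≤q-p (ℚ.<⇒≤ (proj₁ (proj₂ moment))))))

        weaken : ∀ {x y} → ℚ.∣ x ∣ ℚ.≤ y → 0ℚ ℚ.≤ B ℚ.- (y ℚ.+ 1ℚ) → ℚ.∣ x ∣ ℚ.≤ B
        weaken {x} {y} h k = ℚ.≤-trans h (p≤q⇐0≤q-p (subst (0ℚ ℚ.≤_)
          (solve 2 (λ B y → (B :- (y :+ con 1ℚ)) :+ con 1ℚ := B :- y) refl B y)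
          (ℚ.+-mono-≤ k (ℚ.<⇒≤ 0<1ℚ))))

        shifted : ∀ {x y s} → ℚ.∣ x ∣ ℚ.≤ y → ℚ.∣ s ∣ ℚ.≤ 1ℚ → 0ℚ ℚ.≤ B ℚ.- (y ℚ.+ 1ℚ) → ℚ.∣ x ℚ.+ s ∣ ℚ.≤ B
        shifted {x} {y} {s} h k l = ℚ.≤-trans (∣+∣-mono {x} {s} h k) (p≤q⇐0≤q-p l)

        slack-a : 0ℚ ℚ.≤ B ℚ.- (Ba ℚ.+ 1ℚ)
        slack-a = subst (0ℚ ℚ.≤_)
          (solve 2 (λ x y → y := (x :+ y :+ con 1ℚ) :- (x :+ con 1ℚ)) refl Ba Bb)
          (ℚ.<⇒≤ (proj₁ (proj₂ (seq-bounded b))))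

        slack-b : 0ℚ ℚ.≤ B ℚ.- (Bb ℚ.+ 1ℚ)
        slack-b = subst (0ℚ ℚ.≤_)
          (solve 2 (λ x y → x := (x :+ y :+ con 1ℚ) :- (y :+ con 1ℚ)) refl Ba Bb)
          (ℚ.<⇒≤ (proj₁ (proj₂ (seq-bounded a))))

        ∣2δ∣ : ℚ.∣ two ℚ.* δ ∣ ≡ two ℚ.* δ
        ∣2δ∣ = ℚ.0≤p⇒∣p∣≡p 2δ≥0

        0≤e[a′] : 0ℚ ℚ.≤ evalℚ e a′
        0≤e[a′] = p≤q⇐0≤q-p (subst (0ℚ ℚ.≤_)
          (solve 3 (λ u v g → (u :- g) :+ (g :- (u :- v)) := v :- con 0ℚ) refl
            (evalℚ e (seq a n)) (evalℚ e a′) (gap e[a]))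
          (ℚ.+-mono-≤ (0≤q-p (ℚ.<⇒≤ (proj₁ (proj₂ (proj₂ moment)))))
            (0≤q-p (ℚ.≤-trans (p≤∣p∣ (evalℚ e (seq a n) ℚ.- evalℚ e a′))
              (value-near ℓ {seq a n} {a′} (weaken {seq a n} ∣a∣≤ slack-a)
                (shifted {seq a n} ∣a∣≤ (ℚ.≤-trans (ℚ.≤-reflexive ∣2δ∣) 2δ≤1) slack-a)
                (ℚ.≤-reflexive (trans (cong ℚ.∣_∣ (solve 2 (λ a d → a :- (a :+ d) := :- d) refl (seq a n) (two ℚ.* δ)))
                  (trans (ℚ.∣-p∣≡∣p∣ (two ℚ.* δ)) ∣2δ∣)))
                kδ≤a (ℚ.<⇒≤ δ>0))))))
          where
          ∣a∣≤ : ℚ.∣ seq a n ∣ ℚ.≤ Ba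
          ∣a∣≤ = let _ , _ , _ , _ , h , _ = moment in h

        e[b′]≤0 : evalℚ e b′ ℚ.≤ 0ℚ
        e[b′]≤0 = p≤q⇐0≤q-p (subst (0ℚ ℚ.≤_)
          (solve 3 (λ u v g → (:- u :- g) :+ (g :- (v :- u)) := con 0ℚ :- v) refl
            (evalℚ e (seq b n)) (evalℚ e b′) (gap e[b]))
          (ℚ.+-mono-≤ (0≤q-p (ℚ.<⇒≤ (let _ , _ , _ , h , _ = moment in h)))
            (0≤q-p (ℚ.≤-trans (p≤∣p∣ (evalℚ e b′ ℚ.- evalℚ e (seq b n)))
              (value-near ℓ {b′} {seq b n}
                (shifted {seq b n} ∣b∣≤ (ℚ.≤-trans (ℚ.≤-reflexive (trans (ℚ.∣-p∣≡∣p∣ (two ℚ.* δ)) ∣2δ∣)) 2δ≤1) slack-b)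
                (weaken {seq b n} ∣b∣≤ slack-b)
                (ℚ.≤-reflexive (trans (cong ℚ.∣_∣ (solve 2 (λ a d → (a :- d) :- a := :- d) refl (seq b n) (two ℚ.* δ)))
                  (trans (ℚ.∣-p∣≡∣p∣ (two ℚ.* δ)) ∣2δ∣)))
                kδ≤b (ℚ.<⇒≤ δ>0))))))
          where
          ∣b∣≤ : ℚ.∣ seq b n ∣ ℚ.≤ Bb
          ∣b∣≤ = let _ , _ , _ , _ , _ , h , _ = moment in h

      open Bisection e

      t : ℝ
      t = root (bracket a′ b′ 0≤e[a′] e[b′]≤0) a′≤b′

      t-bounds : ∀ m → a′ ℚ.≤ seq t m × seq t m ℚ.≤ b′
      t-bounds = root-bounds (bracket a′ b′ 0≤e[a′] e[b′]≤0) a′≤b′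

      abstract
        a<t : a ⋖ t
        a<t = mkPos δ δ>0 (eventually-map
          (λ m c → by-sub
            (ℚ.+-mono-<-≤ (0<q-p (ℚ.≤-<-trans (p≤∣p∣ (seq a m ℚ.- seq a n)) c)) (0≤q-p (proj₁ (t-bounds m))))
            (solve 4 (λ d u v t → (d :- (u :- v)) :+ (t :- (v :+ con two :* d)) := (t :- u) :- d) refl
              δ (seq a m) (seq a n) (seq t m)))
          (let _ , _ , _ , _ , _ , _ , h , _ = moment in h))

        t<b : t ⋖ b
        t<b = mkPos δ δ>0 (eventually-map
          (λ m c → by-sub
            (ℚ.+-mono-<-≤ (0<q-p (ℚ.≤-<-trans (-p≤∣p∣ (seq b m ℚ.- seq b n)) c)) (0≤q-p (proj₂ (t-bounds m))))
            (solve 4 (λ d u v t → (d :- (:- (u :- v))) :+ ((v :- con two :* d) :- t) := (u :- t) :- d) refl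
              δ (seq b m) (seq b n) (seq t m)))
          (let _ , _ , _ , _ , _ , _ , _ , h = moment in h))

    ivt : ∀ e a b → a ⋖ b → Pos (evalℝ e a) → Pos (-ʳ evalℝ e b) →
          ∃[ t ] a ⋖ t × t ⋖ b × evalℝ e t ≋ 0ʳ
    ivt e a b a<b e[a] e[b] = t , a<t , t<b ,
      Bisection.root-zero e (Bisection.bracket a′ b′ 0≤e[a′] e[b′]≤0) a′≤b′
      where open IVT e a b a<b e[a] e[b]

-- Sign alternation and interlacing real zeros

module Interlacing where
  open Reals
  open Expressions
  open IntermediateValues

  open PolynomialFunctions ℝ-ring public using () renaming
    (prod to prodʳ; IsPoly to IsPolyʳ; factorization to factorizationʳ; Cancellable to Cancellableʳ)

  private
    module ℝR = CommutativeRing ℝ-ring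
    module ℝP = RingProperties ℝR.ring

  alt : ℕ → ℝ → ℝ
  alt zero    x = x
  alt (suc i) x = -ʳ alt i x

  alt-cong : ∀ i {x y} → x ≋ y → alt i x ≋ alt i y
  alt-cong zero    h = h
  alt-cong (suc i) h = -ʳ-cong (alt-cong i h)

  alt-* : ∀ i x y → alt i (x *ʳ y) ≋ x *ʳ alt i y
  alt-* zero    x y = ≋-refl
  alt-* (suc i) x y = ≋-trans (-ʳ-cong (alt-* i x y)) (ℝP.-‿distribʳ-* x (alt i y))

  alt-neg : ∀ i x → alt i (-ʳ x) ≋ -ʳ alt i x
  alt-neg zero    x = ≋-refl
  alt-neg (suc i) x = -ʳ-cong (alt-neg i x)

  neg-neg : ∀ x → -ʳ (-ʳ x) ≋ x
  neg-neg x = ≋-pointwise λ n → solve 1 (λ x → :- (:- x) := x) refl (seq x n)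
    where open ℚ-Solver.+-*-Solver

  alt-zero : ∀ i {x} → alt i x ≋ 0ʳ → x ≋ 0ʳ
  alt-zero zero    h = h
  alt-zero (suc i) {x} h = alt-zero i (≋-trans (≋-sym (neg-neg (alt i x)))
    (≋-trans (-ʳ-cong h) (≋-pointwise λ _ → refl)))

  altᴱ : ℕ → Expr → Expr
  altᴱ zero    e = e
  altᴱ (suc i) e = con (ℚ.- 1ℚ) ⊗ altᴱ i e

  fromℚ-1* : ∀ x → fromℚ (ℚ.- 1ℚ) *ʳ x ≋ -ʳ x
  fromℚ-1* x = ≋-pointwise λ n → solve 1 (λ x → con (ℚ.- 1ℚ) :* x := :- x) refl (seq x n)
    where open ℚ-Solver.+-*-Solver

  evalℝ-altᴱ : ∀ i e x → evalℝ (altᴱ i e) x ≋ alt i (evalℝ e x)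
  evalℝ-altᴱ zero    e x = ≋-refl
  evalℝ-altᴱ (suc i) e x = ≋-trans (fromℚ-1* (evalℝ (altᴱ i e) x)) (-ʳ-cong (evalℝ-altᴱ i e x))

  -- `ivt` finds a passage from positive to negative; for odd `i` it is applied to the negated
  -- expression.
  ivt-alt : ∀ i e a b → a ⋖ b → Pos (alt i (evalℝ e a)) → Pos (alt (suc i) (evalℝ e b)) →
            ∃[ t ] a ⋖ t × t ⋖ b × evalℝ e t ≋ 0ʳ
  ivt-alt i e a b a<b h k =
    let t , a<t , t<b , z = ivt (altᴱ i e) a b a<b
          (pos-resp (≋-sym (evalℝ-altᴱ i e a)) h)
          (pos-resp (-ʳ-cong (≋-sym (evalℝ-altᴱ i e b))) k)
    in t , a<t , t<b , alt-zero i (≋-trans (≋-sym (evalℝ-altᴱ i e t)) z)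

  alt-prod-pos : ∀ m i (u : ℕ → ℝ) → i ℕ.≤ m → (∀ j → j ℕ.< i → Pos (-ʳ u j)) →
                 (∀ j → i ℕ.≤ j → j ℕ.< m → Pos (u j)) → Pos (alt i (prodʳ m u))
  alt-prod-pos zero    zero    u _ neg pos = pos-fromℚ 0<1ℚ
  alt-prod-pos (suc m) zero    u _ neg pos =
    pos-* (pos 0 ℕ.z≤n ℕ.z<s) (alt-prod-pos m 0 (u ∘ suc) ℕ.z≤n (λ _ ()) λ j _ j<m → pos (suc j) ℕ.z≤n (ℕ.s<s j<m))
  alt-prod-pos (suc m) (suc i) u (ℕ.s≤s i≤m) neg pos = pos-resp
    (≋-trans (≋-sym (ℝP.-‿distribˡ-* (u 0) (alt i (prodʳ m (u ∘ suc)))))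
      (-ʳ-cong (≋-sym (alt-* i (u 0) (prodʳ m (u ∘ suc))))))
    (pos-* (neg 0 ℕ.z<s)
      (alt-prod-pos m i (u ∘ suc) i≤m (λ j j<i → neg (suc j) (ℕ.s<s j<i))
        λ j i≤j j<m → pos (suc j) (ℕ.s≤s i≤j) (ℕ.s<s j<m)))

  -- The range `i < k` is decidable, so existence at each of its points yields one total function.
  -- The default `d`, taken at `k`, becomes the sentinel after the zeros.
  choose : ∀ k (P : ℕ → ℝ → Set) → (∀ i → i ℕ.< k → ∃[ x ] P i x) → ∀ d →
           ∃[ t ] (∀ i → i ℕ.< k → P i (t i)) × t k ≡ d
  choose k P h d = t , t-P , t-k
    where
    t : ℕ → ℝ
    t i with i ℕ.<? k
    ... | yes i<k = proj₁ (h i i<k)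
    ... | no  _   = d
    t-P : ∀ i → i ℕ.< k → P i (t i)
    t-P i i<k with i ℕ.<? k
    ... | yes i<k′ = proj₂ (h i i<k′)
    ... | no  i≮k  = ⊥-elim (i≮k i<k)
    t-k : t k ≡ d
    t-k with k ℕ.<? k
    ... | yes k<k = ⊥-elim (ℕ.<-irrefl refl k<k)
    ... | no  _   = refl

  -- Only r 0, …, r (m - 1) are zeros of f; r m = L is a sentinel, and later values are irrelevant.
  record AlternatesOnZeros (L : ℚ) (m : ℕ) (f g : Expr) (r : ℕ → ℝ) : Set where
    field
      poly  : IsPolyʳ m (evalℝ f)
      left  : Pos (evalℝ f (fromℚ (ℚ.- L)))
      first : fromℚ (ℚ.- L) ⋖ r 0
      last  : r m ≡ fromℚ L
      mono  : ∀ i → i ℕ.< m → r i ⋖ r (suc i)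
      zeros : ∀ i → i ℕ.< m → evalℝ f (r i) ≋ 0ʳ
      signs : ∀ i → i ℕ.< m → Pos (alt i (evalℝ g (r i)))

    above-upto : ∀ {x i j} → i ℕ.≤ j → j ℕ.≤ m → x ⋖ r i → x ⋖ r j
    above-upto {x} {i} i≤j = go (ℕ.≤⇒≤′ i≤j)
      where
      go : ∀ {j} → i ℕ.≤′ j → j ℕ.≤ m → x ⋖ r i → x ⋖ r j
      go ℕ.≤′-refl       _   h = h
      go (ℕ.≤′-step i≤j) j<m h = ⋖-trans (go i≤j (ℕ.<⇒≤ j<m) h) (mono _ j<m)

    below-from : ∀ {x i j} → i ℕ.≤ j → j ℕ.≤ m → r j ⋖ x → r i ⋖ x
    below-from {x} {i} i≤j = go (ℕ.≤⇒≤′ i≤j)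
      where
      go : ∀ {j} → i ℕ.≤′ j → j ℕ.≤ m → r j ⋖ x → r i ⋖ x
      go ℕ.≤′-refl       _   h = h
      go (ℕ.≤′-step i≤j) j<m h = go i≤j (ℕ.<⇒≤ j<m) (⋖-trans (mono _ j<m) h)

    mono-< : ∀ {i j} → i ℕ.< j → j ℕ.≤ m → r i ⋖ r j
    mono-< {i} i<j j≤m = above-upto i<j j≤m (mono i (ℕ.<-≤-trans i<j j≤m))

    cancellable : ∀ i j → i ℕ.< j → j ℕ.< m → Cancellableʳ (r j -ʳ r i)
    cancellable i j i<j j<m y h = pos-cancel-0 (mono-< i<j (ℕ.<⇒≤ j<m)) h

    -- At `-L`, left of all zeros, every factor is positive, hence `c` inherits the sign of `f`
    -- there.
    factored : ∃[ c ] Pos c × (∀ x → evalℝ f x ≋ c *ʳ prodʳ m (λ j → r j -ʳ x))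
    factored =
      let c , h = factorizationʳ m r poly zeros cancellable
      in c
       , pos-cancelʳ (pos-resp (h (fromℚ (ℚ.- L))) left)
           (pos⇒eventually≥0 (alt-prod-pos m 0 (λ j → r j -ʳ fromℚ (ℚ.- L)) ℕ.z≤n (λ _ ())
             λ j _ j<m → above-upto {fromℚ (ℚ.- L)} {0} {j} ℕ.z≤n (ℕ.<⇒≤ j<m) first))
       , h

  combine : (ℓ P f g : Expr) → Expr
  combine ℓ P f g = con (ℚ.- 1ℚ) ⊗ (ℓ ⊗ f ⊕ P ⊗ g)

  -- At the zeros of f the sign of combine ℓ P f g is opposite to that of g.  Together with the
  -- signs at ±L this gives one sign change, hence one zero, in each of m + 1 intervals.
  module _ {L m f g r} (A : AlternatesOnZeros L m f g r) (ℓ P : Expr)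
    (P>0 : ∀ x → Pos (evalℝ P x))
    (h-poly : IsPolyʳ (suc m) (evalℝ (combine ℓ P f g)))
    (h-left : Pos (evalℝ (combine ℓ P f g) (fromℚ (ℚ.- L))))
    (h-right : Pos (alt (suc m) (evalℝ (combine ℓ P f g) (fromℚ L))))
    where
    open AlternatesOnZeros A

    private
      h : Expr
      h = combine ℓ P f g

      -- The ends of the intervals: `-L`, the `m` zeros, and finally `L` in the form of the sentinel
      -- `r m`.
      node : ℕ → ℝ
      node zero    = fromℚ (ℚ.- L)
      node (suc i) = r i

      node-mono : ∀ i → i ℕ.< suc m → node i ⋖ node (suc i)
      node-mono zero    _           = first
      node-mono (suc i) (ℕ.s<s i<m) = mono i i<m

      h-at-zero : ∀ i → i ℕ.< m → evalℝ P (r i) *ʳ alt i (evalℝ g (r i)) ≋ alt (suc i) (evalℝ h (r i))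
      h-at-zero i i<m = ≋-trans (≋-sym (alt-* i _ _))
        (≋-trans (≋-sym (neg-neg _)) (-ʳ-cong (≋-trans (≋-sym (alt-neg i _)) (alt-cong i (≋-sym h≋)))))
        where
        h≋ : evalℝ h (r i) ≋ -ʳ (evalℝ P (r i) *ʳ evalℝ g (r i))
        h≋ = ≋-trans (fromℚ-1* (evalℝ ℓ (r i) *ʳ evalℝ f (r i) +ʳ evalℝ P (r i) *ʳ evalℝ g (r i)))
          (-ʳ-cong (≋-trans (+ʳ-cong (≋-trans (*ʳ-cong ≋-refl (zeros i i<m)) (ℝR.zeroʳ (evalℝ ℓ (r i)))) ≋-refl)
            (ℝR.+-identityˡ _)))

      h-at-node : ∀ i → i ℕ.≤ suc m → Pos (alt i (evalℝ h (node i)))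
      h-at-node zero    _ = h-left
      h-at-node (suc i) (ℕ.s≤s i≤m) with i ℕ.≟ m
      ... | yes refl = subst (λ x → Pos (alt (suc m) (evalℝ h x))) (sym last) h-right
      ... | no  i≢m  = pos-resp (h-at-zero i i<m) (pos-* (P>0 (r i)) (signs i i<m))
        where i<m = ℕ.≤∧≢⇒< i≤m i≢m

      Between : ℕ → ℝ → Set
      Between i t = node i ⋖ t × t ⋖ r i × evalℝ h t ≋ 0ʳ

      between : ∀ i → i ℕ.< suc m → ∃[ t ] Between i t
      between i i≤m = ivt-alt i h (node i) (r i) (node-mono i i≤m)
        (h-at-node i (ℕ.<⇒≤ i≤m)) (h-at-node (suc i) i≤m)

      -- Between node `i` and the next one, exactly `i` of the factors `r j - t` are negative. As
      -- `f` is the predecessor of `h`, this provides the field `signs` of the extended chain.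
      f-sign : ∀ i → i ℕ.< suc m → ∀ t → Between i t → Pos (alt i (evalℝ f t))
      f-sign i (ℕ.s<s i≤m) t (a , b , _) =
        let c , c>0 , e = factored
        in pos-resp (≋-trans (≋-sym (alt-* i c _)) (alt-cong i (≋-sym (e t))))
             (pos-* c>0 (alt-prod-pos m i (λ j → r j -ʳ t) i≤m
               (λ j j<i → pos-resp (≋-pointwise λ n → sym (neg-sub (seq (r j) n) (seq t n))) (below j j<i a))
               λ j i≤j j<m → above-upto {t} {i} {j} i≤j (ℕ.<⇒≤ j<m) b))
        where
        below : ∀ j → j ℕ.< i → node i ⋖ t → r j ⋖ t
        below j (ℕ.s<s j≤i) k = below-from {t} {j} j≤i (ℕ.≤-trans (ℕ.n≤1+n _) i≤m) k

    extend : ∃[ t ] AlternatesOnZeros L (suc m) (combine ℓ P f g) f t ×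
                    (∀ i → i ℕ.< m → t i ⋖ r i × r i ⋖ t (suc i))
    extend =
      let t , bt , t-last = choose (suc m) Between between (fromℚ L)
          mono-t : ∀ i → i ℕ.< suc m → t i ⋖ t (suc i)
          mono-t = λ i i≤m → mono′ t bt t-last i i≤m
      in t
       , record
         { poly = h-poly ; left = h-left ; first = proj₁ (bt 0 ℕ.z<s) ; last = t-last
         ; mono = mono-t
         ; zeros = λ i i≤m → proj₂ (proj₂ (bt i i≤m))
         ; signs = λ i i≤m → f-sign i i≤m (t i) (bt i i≤m) }
       , λ i i<m → proj₁ (proj₂ (bt i (ℕ.<-trans i<m (ℕ.n<1+n m)))) , proj₁ (bt (suc i) (ℕ.s<s i<m))
      where
      mono′ : ∀ t → (∀ i → i ℕ.< suc m → Between i (t i)) → t (suc m) ≡ fromℚ L →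
              ∀ i → i ℕ.< suc m → t i ⋖ t (suc i)
      mono′ t bt t-last i i≤m with i ℕ.≟ m
      ... | yes refl = subst (t i ⋖_) (trans last (sym t-last)) (proj₁ (proj₂ (bt i i≤m)))
      ... | no  i≢m  = ⋖-trans (proj₁ (proj₂ (bt i i≤m)))
        (proj₁ (bt (suc i) (ℕ.s<s (ℕ.≤∧≢⇒< (ℕ.s≤s⁻¹ i≤m) i≢m))))

-- The chain of polynomials in y: degrees, parity and growth

module OrthogonalChain where
  open Reals
  open Expressions
  open Interlacing

  -- Unlike the abstract `ι`, this computes on closed numerals, so the ring solver can normalise
  -- with them.
  lit : ℕ → ℚ
  lit k = + k ℚ./ 1

  -- The square appears when the recurrence of `D` is multiplied by `(k + 1)!`: the term
  -- `(k + 1) D k` turns into `(k + 1)²` times `k! D k`, and the polynomials become monic up to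
  -- sign.
  square : ℕ → ℚ
  square k = ι (+ suc k) ℚ.* ι (+ suc k)

  -- With y = i (2 s + 1), up to powers of i and positive constants, q k is the Ehrhart polynomial
  -- of the k-dimensional cross-polytope, F n is H₂ₙ and G n is H₃ₙ (F 0 is junk).
  q : ℕ → Expr
  q zero          = con 1ℚ
  q (suc zero)    = con (ℚ.- 1ℚ) ⊗ var
  q (suc (suc k)) = combine var (con (square k)) (q (suc k)) (q k)

  -- Eliminating the cross-polytopes of dimensions n - 1 and n + 2 from 16 (n + 1) (n + 2) H₃ₙ by the
  -- three-term recurrence leaves -(α y F + (A y² + B) q n).
  coeffα coeffA coeffB : ℚ → ℚ
  coeffα ν = lit 4 ℚ.* (ν ℚ.* ν) ℚ.+ lit 18 ℚ.* ν ℚ.+ lit 12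
  coeffA ν = ν ℚ.* ν ℚ.+ lit 11 ℚ.* ν ℚ.+ lit 6
  coeffB ν = (ν ℚ.+ 1ℚ) ℚ.* (lit 9 ℚ.* ν ℚ.+ lit 14)

  -- Multiplying `2 H₂ₙ = (2 s + 1) D n + D (n - 1)` by `n!` leaves the coefficient `n` in `F n`,
  -- where the recurrence for `q (n + 1)` has `n²`.
  F G : ℕ → Expr
  F zero    = con 1ℚ
  F (suc k) = combine var (con (ι (+ suc k))) (q (suc k)) (q k)
  G n = combine (con (coeffα (ι (+ n))) ⊗ var) (con (coeffA (ι (+ n))) ⊗ (var ⊗ var) ⊕ con (coeffB (ι (+ n)))) (F n) (q n)

  -- Parametrised by the ring because the degree bounds serve twice: over ℝ for the factorization in
  -- the sign argument, and over ℂ for the one that is evaluated at imaginary points.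
  module Degree (R : CommutativeRing 0ℓ 0ℓ) (κ : ℚ → CommutativeRing.Carrier R) where
    open CommutativeRing R renaming (sym to ≈-sym; trans to ≈-trans; refl to ≈-refl)
    open PolynomialFunctions R
    open Eval R κ
    
    isPoly-step : ∀ m c {f g} → IsPoly (suc m) ⟦ f ⟧ → IsPoly m ⟦ g ⟧ →
                  IsPoly (suc (suc m)) ⟦ combine var (con c) f g ⟧
    isPoly-step m c {f} {g} hf hg = isPoly-scale (suc (suc m)) _
      (isPoly-+ (suc (suc m)) (isPoly-x* (suc m) hf)
        (isPoly-scale (suc (suc m)) _ (isPoly-suc (suc m) (isPoly-suc m hg))))

    isPoly-q : ∀ k → IsPoly k ⟦ q k ⟧
    isPoly-q zero          = isPoly-const 0 _
    isPoly-q (suc zero)    = isPoly-scale 1 _ (isPoly-resp 1 (λ x → ≈-sym (*-identityʳ x)) (isPoly-x* 0 (isPoly-const 0 1#)))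
    isPoly-q (suc (suc k)) = isPoly-step k (square k) {q (suc k)} {q k} (isPoly-q (suc k)) (isPoly-q k)

    isPoly-F : ∀ k → IsPoly (suc (suc k)) ⟦ F (suc k) ⟧
    isPoly-F k = isPoly-step k (ι (+ suc k)) {q (suc k)} {q k} (isPoly-q (suc k)) (isPoly-q k)

    isPoly-G : ∀ k → IsPoly (suc (suc (suc k))) ⟦ G (suc k) ⟧
    isPoly-G k = isPoly-scale d _
      (isPoly-+ d
        (isPoly-resp d (λ x → ≈-trans (*-assoc _ x _) ≈-refl)
          (isPoly-scale d _ (isPoly-x* (suc (suc k)) (isPoly-F k))))
        (isPoly-resp d
          (λ x → ≈-trans (distribʳ _ _ _) (+-congʳ (≈-trans (*-assoc _ _ _) (*-congˡ (*-assoc x x _)))))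
          (isPoly-+ d
            (isPoly-scale d _ (isPoly-x* (suc (suc k)) (isPoly-x* (suc k) (isPoly-q (suc k)))))
            (isPoly-scale d _ (isPoly-suc (suc (suc k)) (isPoly-suc (suc k) (isPoly-q (suc k))))))))
      where d = suc (suc (suc k))

  module Degreeʳ = Degree ℝ-ring fromℚ

  sgn : ℕ → ℚ
  sgn zero    = 1ℚ
  sgn (suc i) = ℚ.- sgn i

  module _ where
    open ℚ-Solver.+-*-Solver

    sgn² : ∀ i → sgn i ℚ.* sgn i ≡ 1ℚ
    sgn² zero    = refl
    sgn² (suc i) = trans (solve 1 (λ s → :- s :* :- s := s :* s) refl (sgn i)) (sgn² i)

    alt-fromℚ : ∀ i p → alt i (fromℚ p) ≋ fromℚ (sgn i ℚ.* p)
    alt-fromℚ zero    p = ≋-pointwise λ _ → sym (ℚ.*-identityˡ p)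
    alt-fromℚ (suc i) p = ≋-trans (-ʳ-cong (alt-fromℚ i p))
      (≋-pointwise λ _ → ℚ.neg-distribˡ-* (sgn i) p)

    alt-fromℚ-sgn : ∀ i p → alt i (fromℚ (sgn i ℚ.* p)) ≋ fromℚ p
    alt-fromℚ-sgn i p = ≋-trans (alt-fromℚ i (sgn i ℚ.* p))
      (≋-pointwise λ _ → trans (sym (ℚ.*-assoc (sgn i) (sgn i) p))
        (trans (cong (ℚ._* p) (sgn² i)) (ℚ.*-identityˡ p)))

    -- Each member of the chain is even or odd, so its sign at `L` follows from the one at `-L`, the
    -- end where growth is estimated.
    Parity : ℕ → Expr → Set
    Parity i e = ∀ x → evalℚ e x ≡ sgn i ℚ.* evalℚ e (ℚ.- x)

    parity-step : ∀ i c {f g} → Parity (suc i) f → Parity i g → Parity (suc (suc i)) (combine var (con c) f g)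
    parity-step i c {f} {g} hf hg x = trans
      (cong₂ (λ u v → ℚ.- 1ℚ ℚ.* (x ℚ.* u ℚ.+ c ℚ.* v)) (hf x) (hg x))
      (solve 5 (λ s x c f g →
          :- con 1ℚ :* (x :* (:- s :* f) :+ c :* (s :* g)) := :- (:- s) :* (:- con 1ℚ :* (:- x :* f :+ c :* g)))
        refl (sgn i) x c (evalℚ f (ℚ.- x)) (evalℚ g (ℚ.- x)))

    parity-q : ∀ k → Parity k (q k)
    parity-q zero          x = refl
    parity-q (suc zero)    x = solve 1 (λ x → :- con 1ℚ :* x := :- con 1ℚ :* (:- con 1ℚ :* :- x)) refl x
    parity-q (suc (suc k)) = parity-step k (square k) {q (suc k)} {q k} (parity-q (suc k)) (parity-q k)

    parity-F : ∀ k → Parity (suc (suc k)) (F (suc k))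
    parity-F k = parity-step k (ι (+ suc k)) {q (suc k)} {q k} (parity-q (suc k)) (parity-q k)

    parity-G : ∀ k → Parity (suc (suc (suc k))) (G (suc k))
    parity-G k x = trans
      (cong₂ (λ u v → ℚ.- 1ℚ ℚ.* (a ℚ.* x ℚ.* u ℚ.+ (b ℚ.* (x ℚ.* x) ℚ.+ c) ℚ.* v)) (parity-F k x) (parity-q (suc k) x))
      (solve 7 (λ s x a b c f g →
          :- con 1ℚ :* (a :* x :* (:- s :* f) :+ (b :* (x :* x) :+ c) :* (s :* g))
            := :- (:- s) :* (:- con 1ℚ :* (a :* (:- x) :* f :+ (b :* (:- x :* :- x) :+ c) :* g)))
        refl (sgn (suc k)) x a b c (evalℚ (F (suc k)) (ℚ.- x)) (evalℚ (q (suc k)) (ℚ.- x)))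
      where
      a = coeffα (ι (+ suc k))
      b = coeffA (ι (+ suc k))
      c = coeffB (ι (+ suc k))

    left⇒right : ∀ i e L → Parity i e → 0ℚ ℚ.< evalℚ e (ℚ.- L) → Pos (alt i (evalℝ e (fromℚ L)))
    left⇒right i e L par h = pos-resp
      (≋-sym (≋-trans (alt-cong i (≋-trans (evalℝ-fromℚ e L) (≋-pointwise λ _ → par L)))
        (alt-fromℚ-sgn i (evalℚ e (ℚ.- L)))))
      (pos-fromℚ h)

    left-pos : ∀ e L → 0ℚ ℚ.< evalℚ e (ℚ.- L) → Pos (evalℝ e (fromℚ (ℚ.- L)))
    left-pos e L h = pos-resp (≋-sym (evalℝ-fromℚ e (ℚ.- L))) (pos-fromℚ h)

    -- At -L = -4 (n + 1) each member of the chain is at least 3 (n + 1) times its predecessor.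
    module Growth (n : ℕ) where
      ν M L : ℚ
      ν = ι (+ n)
      M = ν ℚ.+ 1ℚ
      L = lit 4 ℚ.* M

      0≤ν : 0ℚ ℚ.≤ ν
      0≤ν = ι-nonNeg n

      M>0 : 0ℚ ℚ.< M
      M>0 = ℚ.+-mono-≤-< 0≤ν 0<1ℚ

      L>0 : 0ℚ ℚ.< L
      L>0 = 0<* (ℚ.positive⁻¹ (lit 4)) M>0

      val : Expr → ℚ
      val e = evalℚ e (ℚ.- L)

      -- With `f` and `g` denoting values at `-L`, the next value is `4 M f - c g`. Subtracting
      -- `3 M f` leaves `M (f - 3 M g) + (3 M² - c) g`, and both summands are nonnegative.
      growth-step : ∀ c {f g} → 0ℚ ℚ.≤ val g → 0ℚ ℚ.≤ c → c ℚ.≤ lit 3 ℚ.* (M ℚ.* M) → lit 3 ℚ.* M ℚ.* val g ℚ.≤ val f →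
        lit 3 ℚ.* M ℚ.* val f ℚ.≤ val (combine var (con c) f g)
      growth-step c {f} {g} g≥0 c≥0 c≤ h = p≤q⇐0≤q-p (subst (0ℚ ℚ.≤_)
        (solve 4 (λ M c f g →
            M :* (f :- con (lit 3) :* M :* g) :+ (con (lit 3) :* (M :* M) :- c) :* g
            := (:- con 1ℚ :* (:- (con (lit 4) :* M) :* f :+ c :* g)) :- con (lit 3) :* M :* f)
          refl M c (val f) (val g))
        (ℚ.+-mono-≤ (0≤* (ℚ.<⇒≤ M>0) (0≤q-p h)) (0≤* (0≤q-p c≤) g≥0)))

      3M>0 : 0ℚ ℚ.< lit 3 ℚ.* M
      3M>0 = 0<* (ℚ.positive⁻¹ (lit 3)) M>0

      M≤3M² : ∀ {c} → 0ℚ ℚ.≤ c → c ℚ.≤ ν → c ℚ.* c ℚ.≤ lit 3 ℚ.* (M ℚ.* M)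
      M≤3M² {c} c≥0 c≤ν = p≤q⇐0≤q-p (subst (0ℚ ℚ.≤_)
        (solve 2 (λ c v → (v :- c) :* (v :+ c) :+ (con (lit 2) :* (v :* v) :+ con (lit 6) :* v :+ con (lit 3))
          := con (lit 3) :* ((v :+ con 1ℚ) :* (v :+ con 1ℚ)) :- c :* c) refl c ν)
        (ℚ.+-mono-≤ (0≤* (0≤q-p c≤ν) (ℚ.+-mono-≤ 0≤ν c≥0))
          (ℚ.+-mono-≤ (ℚ.+-mono-≤ (0≤* (ℚ.nonNegative⁻¹ (lit 2)) (0≤* 0≤ν 0≤ν)) (0≤* (ℚ.nonNegative⁻¹ (lit 6)) 0≤ν))
            (ℚ.nonNegative⁻¹ (lit 3)))))

      ν≤3M² : ν ℚ.≤ lit 3 ℚ.* (M ℚ.* M)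
      ν≤3M² = p≤q⇐0≤q-p (subst (0ℚ ℚ.≤_)
        (solve 1 (λ v → con (lit 3) :* (v :* v) :+ con (lit 5) :* v :+ con (lit 3)
          := con (lit 3) :* ((v :+ con 1ℚ) :* (v :+ con 1ℚ)) :- v) refl ν)
        (ℚ.+-mono-≤ (ℚ.+-mono-≤ (0≤* (ℚ.nonNegative⁻¹ (lit 3)) (0≤* 0≤ν 0≤ν)) (0≤* (ℚ.nonNegative⁻¹ (lit 5)) 0≤ν))
            (ℚ.nonNegative⁻¹ (lit 3))))

      positive-from : ∀ {g f} → 0ℚ ℚ.< g → lit 3 ℚ.* M ℚ.* g ℚ.≤ f → 0ℚ ℚ.< f
      positive-from g>0 h = ℚ.<-≤-trans (0<* 3M>0 g>0) h

      growth-q : ∀ k → k ℕ.≤ n → 0ℚ ℚ.< val (q k) × lit 3 ℚ.* M ℚ.* val (q k) ℚ.≤ val (q (suc k))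
      growth-q zero    _   = 0<1ℚ , p≤q⇐0≤q-p (subst (0ℚ ℚ.≤_)
        (solve 1 (λ M → M := :- con 1ℚ :* :- (con (lit 4) :* M) :- con (lit 3) :* M :* con 1ℚ) refl M) (ℚ.<⇒≤ M>0))
      growth-q (suc k) k<n =
        let g>0 , h = growth-q k (ℕ.<⇒≤ k<n)
        in positive-from g>0 h
         , growth-step (square k) {q (suc k)} {q k} (ℚ.<⇒≤ g>0) (0≤* (ι-nonNeg (suc k)) (ι-nonNeg (suc k)))
             (M≤3M² (ι-nonNeg (suc k)) (ι-mono-≤ (ℤ.+≤+ k<n))) h

    module _ (k : ℕ) where
      open Growth (suc k)

      growth-F : lit 3 ℚ.* M ℚ.* val (q (suc k)) ℚ.≤ val (F (suc k))
      growth-F = let g>0 , h = growth-q k (ℕ.n≤1+n k) in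
        growth-step ν {q (suc k)} {q k} (ℚ.<⇒≤ g>0) 0≤ν ν≤3M² h

      0<F : 0ℚ ℚ.< val (F (suc k))
      0<F = positive-from (proj₁ (growth-q (suc k) ℕ.≤-refl)) growth-F

      0<G : 0ℚ ℚ.< val (G (suc k))
      0<G = subst (0ℚ ℚ.<_)
        (solve 3 (λ v f g →
            let m = v :+ con 1ℚ
                α = con (lit 4) :* (v :* v) :+ con (lit 18) :* v :+ con (lit 12)
                a = v :* v :+ con (lit 11) :* v :+ con (lit 6)
                b = (v :+ con 1ℚ) :* (con (lit 9) :* v :+ con (lit 14))
                l = con (lit 4) :* m
            in con (lit 4) :* α :* m :* (f :- con (lit 3) :* m :* g)
               -- Replacing f by `3 m g` in `4 α m f - (16 a m² + b) g` leaves
               -- `12 α m² - 16 a m² - b` times g. This is that quartic in ν; all of its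
               -- coefficients are positive.
               :+ (con (lit 32) :* (v :* v :* (v :* v)) :+ con (lit 104) :* (v :* v :* v) :+ con (lit 151) :* (v :* v)
                   :+ con (lit 113) :* v :+ con (lit 34)) :* g
               := :- con 1ℚ :* (α :* (:- l) :* f :+ (a :* (:- l :* :- l) :+ b) :* g))
          refl ν (val (F (suc k))) (val (q (suc k))))
        (ℚ.+-mono-≤-<
          (0≤* (0≤* (0≤* (ℚ.nonNegative⁻¹ (lit 4)) 0≤α) (ℚ.<⇒≤ M>0)) (0≤q-p growth-F))
          (0<* (ℚ.+-mono-≤-< (ℚ.+-mono-≤ (ℚ.+-mono-≤ (ℚ.+-mono-≤
                  (0≤* (ℚ.nonNegative⁻¹ (lit 32)) (0≤* 0≤ν² 0≤ν²))
                  (0≤* (ℚ.nonNegative⁻¹ (lit 104)) (0≤* 0≤ν² 0≤ν)))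
                  (0≤* (ℚ.nonNegative⁻¹ (lit 151)) 0≤ν²))
                  (0≤* (ℚ.nonNegative⁻¹ (lit 113)) 0≤ν))
                (ℚ.positive⁻¹ (lit 34)))
            (proj₁ (growth-q (suc k) ℕ.≤-refl))))
        where
        0≤ν² : 0ℚ ℚ.≤ ν ℚ.* ν
        0≤ν² = 0≤* 0≤ν 0≤ν
        0≤α : 0ℚ ℚ.≤ coeffα ν
        0≤α = ℚ.+-mono-≤ (ℚ.+-mono-≤ (0≤* (ℚ.nonNegative⁻¹ (lit 4)) 0≤ν²) (0≤* (ℚ.nonNegative⁻¹ (lit 18)) 0≤ν))
          (ℚ.nonNegative⁻¹ (lit 12))

      private
        step-const : ∀ {m c f g r} → 0ℚ ℚ.< c → AlternatesOnZeros L (suc m) f g r →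
          IsPolyʳ m (evalℝ g) → Parity (suc (suc m)) (combine var (con c) f g) → 0ℚ ℚ.< val (combine var (con c) f g) →
          ∃[ t ] AlternatesOnZeros L (suc (suc m)) (combine var (con c) f g) f t ×
                 (∀ i → i ℕ.< suc m → t i ⋖ r i × r i ⋖ t (suc i))
        step-const {m} {c} {f} {g} c>0 A pg par h>0 = extend A var (con c) (λ _ → pos-fromℚ c>0)
          (Degreeʳ.isPoly-step m c {f} {g} (AlternatesOnZeros.poly A) pg)
          (left-pos (combine var (con c) f g) L h>0)
          (left⇒right (suc (suc m)) (combine var (con c) f g) L par h>0)

        start : AlternatesOnZeros L 1 (q 1) (q 0) (λ { zero → 0ʳ ; (suc _) → fromℚ L })
        start = record
          { poly = Degreeʳ.isPoly-q 1
          ; left = left-pos (q 1) L (positive-from 0<1ℚ (proj₂ (growth-q 0 ℕ.z≤n)))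
          ; first = pos-resp (≋-pointwise λ _ → solve 1 (λ l → l := con 0ℚ :- (:- l)) refl L) (pos-fromℚ L>0)
          ; last = refl
          ; mono = λ { zero _ → pos-resp (≋-pointwise λ _ → solve 1 (λ l → l := l :- con 0ℚ) refl L) (pos-fromℚ L>0)
                     ; (suc _) (ℕ.s≤s ()) }
          ; zeros = λ { zero _ → ≋-pointwise λ _ → refl ; (suc _) (ℕ.s≤s ()) }
          ; signs = λ { zero _ → pos-fromℚ 0<1ℚ ; (suc _) (ℕ.s≤s ()) } }

      q-alternates : ∀ j → j ℕ.≤ k → ∃[ r ] AlternatesOnZeros L (suc j) (q (suc j)) (q j) r
      q-alternates zero    _   = _ , start
      q-alternates (suc j) j<k =
        let r , A = q-alternates j (ℕ.<⇒≤ j<k)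
            t , A′ , _ = step-const {j} {square j} {q (suc j)} {q j} {r}
              (0<* (ι-pos j) (ι-pos j)) A (Degreeʳ.isPoly-q j) (parity-q (suc (suc j)))
              (let g>0 , h = growth-q (suc j) (ℕ.m≤n⇒m≤1+n j<k) in positive-from g>0 h)
        in t , A′

      real-interlacing : ∃[ t ] ∃[ s ]
        AlternatesOnZeros L (suc (suc (suc k))) (G (suc k)) (F (suc k)) t ×
        AlternatesOnZeros L (suc (suc k)) (F (suc k)) (q (suc k)) s ×
        (∀ i → i ℕ.< suc (suc k) → t i ⋖ s i × s i ⋖ t (suc i))
      real-interlacing =
        let r , A = q-alternates k ℕ.≤-refl
            s , A′ , _ = step-const {k} {ν} {q (suc k)} {q k} {r}
              (ι-pos k) A (Degreeʳ.isPoly-q k) (parity-F k) 0<F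
            t , A″ , il = extend A′ (con (coeffα ν) ⊗ var) (con (coeffA ν) ⊗ (var ⊗ var) ⊕ con (coeffB ν)) P>0
              (Degreeʳ.isPoly-G k) (left-pos (G (suc k)) L 0<G)
              (left⇒right (suc (suc (suc k))) (G (suc k)) L (parity-G k) 0<G)
        in t , s , A″ , A′ , il
        where
        0≤A : 0ℚ ℚ.≤ coeffA ν
        0≤A = ℚ.+-mono-≤ (ℚ.+-mono-≤ (0≤* 0≤ν 0≤ν) (0≤* (ℚ.nonNegative⁻¹ (lit 11)) 0≤ν)) (ℚ.nonNegative⁻¹ (lit 6))
        0<B : 0ℚ ℚ.< coeffB ν
        0<B = 0<* M>0 (ℚ.+-mono-≤-< (0≤* (ℚ.nonNegative⁻¹ (lit 9)) 0≤ν) (ℚ.positive⁻¹ (lit 14)))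
        -- `A x² + B ≥ B` holds at every term of the sequence of `x`, so any rational strictly
        -- between 0 and `B` is a gap.
        P>0 : ∀ x → Pos (evalℝ (con (coeffA ν) ⊗ (var ⊗ var) ⊕ con (coeffB ν)) x)
        P>0 x = let g , 0<g , g<B = ℚ.<-dense 0<B in mkPos g 0<g (0 , λ n _ →
          subst (ℚ._< coeffA ν ℚ.* (seq x n ℚ.* seq x n) ℚ.+ coeffB ν) (ℚ.+-identityˡ g)
            (ℚ.+-mono-≤-< (0≤* 0≤A (square≥0 (seq x n))) g<B))

-- Counting sequences of cross-polytopes and their recurrences

module PartialSums where
  open import Data.Integer.Base using (_+_; _*_; _-_; -_; 0ℤ; 1ℤ)

  open ℤ-Solver.+-*-Solver

  -- `T f r` is the sum of `f (r - |x|)` over the integers `x` with `|x| ≤ r`: the effect of one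
  -- more coordinate on a sum over the ball of radius `r`. On generating functions in u, `S`
  -- multiplies by `u / (1 - u)` and `T` by `(1 + u) / (1 - u)`.
  S T : (ℕ → ℤ) → ℕ → ℤ
  S f zero    = 0ℤ
  S f (suc r) = S f r + f r
  T f r = S f r + S f r + f r

  S-cong : ∀ {f g} → (∀ r → f r ≡ g r) → ∀ r → S f r ≡ S g r
  S-cong h zero    = refl
  S-cong h (suc r) = cong₂ _+_ (S-cong h r) (h r)

  T-suc : ∀ f r → T f (suc r) ≡ T f r + f r + f (suc r)
  T-suc f r = solve 3 (λ s a b → (s :+ a) :+ (s :+ a) :+ b := (s :+ s :+ a) :+ a :+ b) refl
    (S f r) (f r) (f (suc r))

  -- The Delannoy numbers, here as the number of points of ℤⁿ with ℓ¹ norm at most `r`.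
  D : ℕ → ℕ → ℤ
  D zero    r = 1ℤ
  D (suc n) r = T (D n) r

  D-0 : ∀ n → D n 0 ≡ 1ℤ
  D-0 zero    = refl
  D-0 (suc n) = trans (ℤ.+-identityˡ (D n 0)) (D-0 n)

  D₁ : ∀ r → D 1 r ≡ + 2 * + r + 1ℤ
  D₁ zero    = refl
  D₁ (suc r) = trans (T-suc (D 0) r) (trans (cong (λ d → d + 1ℤ + 1ℤ) (D₁ r))
    (solve 1 (λ r → con (+ 2) :* r :+ con 1ℤ :+ con 1ℤ :+ con 1ℤ := con (+ 2) :* (con 1ℤ :+ r) :+ con 1ℤ) refl (+ r)))

  private
    from-difference : ∀ {a b} h → h ≡ 0ℤ → a - b ≡ h → a ≡ b
    from-difference {a} {b} h e k = ℤ.i-j≡0⇒i≡j a b (trans k e)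

    difference : ∀ {a b} → a ≡ b → a - b ≡ 0ℤ
    difference {a} refl = ℤ.+-inverseʳ a

  -- By `T-suc`, `D` satisfies the Delannoy rule `D (n + 1) (r + 1) = D (n + 1) r + D n r + D n (r +
  -- 1)`. The difference of the two sides of the claim satisfies the same rule, so it vanishes once
  -- it does for `d = 0` and for `s = 0`.
  three-term : ∀ d s → + suc (suc d) * D (suc (suc d)) s ≡
               (+ 2 * + s + 1ℤ) * D (suc d) s + + suc d * D d s
  three-term d zero = trans (cong (+ suc (suc d) *_) (D-0 (suc (suc d))))
    (trans (solve 1 (λ d → (con (+ 2) :+ d) :* con 1ℤ := con 1ℤ :* con 1ℤ :+ (con 1ℤ :+ d) :* con 1ℤ) refl (+ d))
      (sym (cong₂ (λ a b → (+ 2 * + 0 + 1ℤ) * a + + suc d * b) (D-0 (suc d)) (D-0 d))))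
  three-term zero (suc s) = trans (cong (+ 2 *_) (T-suc (D 1) s))
    (trans (solve 3 (λ a b c → con (+ 2) :* (a :+ b :+ c) := con (+ 2) :* a :+ (con (+ 2) :* b :+ con (+ 2) :* c)) refl
      (D 2 s) (D 1 s) (D 1 (suc s)))
    (trans (cong₂ _+_ (three-term zero s) refl)
    (trans (cong₂ (λ a b → (+ 2 * + s + 1ℤ) * a + 1ℤ * 1ℤ + (+ 2 * a + + 2 * b)) (D₁ s) (D₁ (suc s)))
    (trans (solve 1 (λ s → let a = con (+ 2) :* s :+ con 1ℤ
                               b = con (+ 2) :* (con 1ℤ :+ s) :+ con 1ℤ in
      a :* a :+ con 1ℤ :* con 1ℤ :+ (con (+ 2) :* a :+ con (+ 2) :* b) := b :* b :+ con 1ℤ :* con 1ℤ) refl (+ s))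
    (cong (λ a → (+ 2 * + suc s + 1ℤ) * a + 1ℤ * 1ℤ) (sym (D₁ (suc s))))))))
  three-term (suc d) (suc s) = from-difference _
    (cong₂ _+_ (cong₂ _+_ (difference (three-term (suc d) s)) (difference (three-term d s))) (difference (three-term d (suc s))))
    (trans (cong (λ a → + suc (suc (suc d)) * a - ((+ 2 * + suc s + 1ℤ) * D (suc (suc d)) (suc s) + + suc (suc d) * D (suc d) (suc s)))
             (T-suc (D (suc (suc d))) s))
    (trans (cong₂ (λ b c → + suc (suc (suc d)) * (D (suc (suc (suc d))) s + D (suc (suc d)) s + b)
               - ((+ 2 * + suc s + 1ℤ) * b + + suc (suc d) * c))
             (trans (T-suc (D (suc d)) s) (cong (λ c → D (suc (suc d)) s + D (suc d) s + c) (T-suc (D d) s)))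
             (T-suc (D d) s))
    (trans (solve 7 (λ d s a b c e e′ →
        let d3 = con (+ 3) :+ d ; d2 = con (+ 2) :+ d ; d1 = con 1ℤ :+ d
            s1 = con (+ 2) :* s :+ con 1ℤ ; s3 = con (+ 2) :* (con 1ℤ :+ s) :+ con 1ℤ
            c′ = c :+ e :+ e′
            b′ = b :+ c :+ c′
        in d3 :* (a :+ b :+ b′) :- (s3 :* b′ :+ d2 :* c′)
           := (d3 :* a :- (s1 :* b :+ d2 :* c)) :+ (d2 :* b :- (s1 :* c :+ d1 :* e)) :+ (d2 :* b′ :- (s3 :* c′ :+ d1 :* e′)))
        refl (+ d) (+ s) (D (suc (suc (suc d))) s) (D (suc (suc d)) s) (D (suc d) s) (D d s) (D d (suc s)))
      (cong₂ (λ b c → (+ suc (suc (suc d)) * D (suc (suc (suc d))) s - ((+ 2 * + s + 1ℤ) * D (suc (suc d)) s + + suc (suc d) * D (suc d) s))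
          + (+ suc (suc d) * D (suc (suc d)) s - ((+ 2 * + s + 1ℤ) * D (suc d) s + + suc d * D d s))
          + (+ suc (suc d) * b - ((+ 2 * + suc s + 1ℤ) * c + + suc d * D d (suc s))))
        (sym (trans (T-suc (D (suc d)) s) (cong (λ c → D (suc (suc d)) s + D (suc d) s + c) (T-suc (D d) s))))
        (sym (T-suc (D d) s))))))

  ev : ℕ → ℤ
  ev zero    = 1ℤ
  ev (suc k) = 1ℤ - ev k

  -- Counts the points `y` of the ball for which `r - ‖y‖₁` is even, the parity on which the size of
  -- a fibre depends.
  E : ℕ → ℕ → ℤ
  E zero    r = ev r
  E (suc n) r = T (E n) r

  private
    T-ev : ∀ r → T ev r ≡ 1ℤ + + r
    T-ev zero    = refl
    T-ev (suc r) = trans (T-suc ev r) (trans (cong (λ t → t + ev r + (1ℤ - ev r)) (T-ev r))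
      (solve 2 (λ r e → con 1ℤ :+ r :+ e :+ (con 1ℤ :- e) := con 1ℤ :+ (con 1ℤ :+ r)) refl (+ r) (ev r)))

    S-double : ∀ {f g h : ℕ → ℤ} → (∀ r → + 2 * f r ≡ g r + h r) → ∀ r → + 2 * S f r ≡ S g r + S h r
    S-double e zero = refl
    S-double {f} {g} {h} e (suc r) = trans (ℤ.*-distribˡ-+ (+ 2) (S f r) (f r))
      (trans (cong₂ _+_ (S-double e r) (e r))
        (solve 4 (λ a b c d → a :+ b :+ (c :+ d) := a :+ c :+ (b :+ d)) refl (S g r) (S h r) (g r) (h r)))

  -- The linear operator `T` carries the identity from one dimension to the next, which leaves
  -- `2 (r + 1) = (2 r + 1) + 1` in dimension one.
  2E : ∀ n r → + 2 * E (suc n) r ≡ D (suc n) r + D n r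
  2E zero    r = trans (cong (+ 2 *_) (T-ev r))
    (trans (solve 1 (λ r → con (+ 2) :* (con 1ℤ :+ r) := con (+ 2) :* r :+ con 1ℤ :+ con 1ℤ) refl (+ r))
      (cong (_+ 1ℤ) (sym (D₁ r))))
  2E (suc n) r = trans (solve 2 (λ s e → con (+ 2) :* (s :+ s :+ e) := con (+ 2) :* s :+ con (+ 2) :* s :+ con (+ 2) :* e) refl (S (E (suc n)) r) (E (suc n) r))
    (trans (cong₂ (λ a b → a + a + b) (S-double (2E n) r) (2E n r))
      (solve 4 (λ a b c d → (a :+ b) :+ (a :+ b) :+ (c :+ d) := (a :+ a :+ c) :+ (b :+ b :+ d)) refl
        (S (D (suc n)) r) (S (D n) r) (D (suc n) r) (D n r)))

  -- At `i = 0` these are the sums of `x g (r - x)` and of `x² g (r - x)` over `1 ≤ x ≤ r`. The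
  -- offset `i` allows recursion on `r` starting from the smallest `x`.
  linear quadratic : (ℕ → ℤ) → ℕ → ℕ → ℤ
  linear g zero    i = 0ℤ
  linear g (suc r) i = + suc i * g r + linear g r (suc i)
  quadratic g zero    i = 0ℤ
  quadratic g (suc r) i = + suc i * + suc i * g r + quadratic g r (suc i)

  -- The sum of the squared totals over the ball. A new coordinate `x` adds `x²` to each, and the
  -- cross terms cancel between `x` and `-x`.
  Z : ℕ → ℕ → ℤ
  Z zero    r = 0ℤ
  Z (suc n) r = T (Z n) r + + 2 * quadratic (D n) r 0

  private
    S̄ : (ℕ → ℤ) → ℕ → ℤ
    S̄ f r = S f r + f r

    linear-suc : ∀ g r i → linear g r (suc i) ≡ linear g r i + S g r
    linear-suc g zero    i = refl
    linear-suc g (suc r) i = trans (cong (λ t → + suc (suc i) * g r + t) (linear-suc g r (suc i)))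
      (solve 4 (λ i g l s → (con (+ 2) :+ i) :* g :+ (l :+ s) := (con 1ℤ :+ i) :* g :+ l :+ (s :+ g)) refl
        (+ i) (g r) (linear g r (suc i)) (S g r))

    quadratic-suc : ∀ g r i → quadratic g r (suc i) ≡ quadratic g r i + + 2 * linear g r i + S g r
    quadratic-suc g zero    i = refl
    quadratic-suc g (suc r) i = trans (cong (λ t → + suc (suc i) * + suc (suc i) * g r + t) (quadratic-suc g r (suc i)))
      (solve 5 (λ i g q l s → (con (+ 2) :+ i) :* (con (+ 2) :+ i) :* g :+ (q :+ con (+ 2) :* l :+ s)
          := (con 1ℤ :+ i) :* (con 1ℤ :+ i) :* g :+ q :+ con (+ 2) :* ((con 1ℤ :+ i) :* g :+ l) :+ (s :+ g)) refl
        (+ i) (g r) (quadratic g r (suc i)) (linear g r (suc i)) (S g r))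

    linear≡ : ∀ g r → linear g r 0 ≡ S (S̄ g) r
    linear≡ g zero    = refl
    linear≡ g (suc r) = trans (cong (λ t → 1ℤ * g r + t) (trans (linear-suc g r 0) (cong (_+ S g r) (linear≡ g r))))
      (solve 3 (λ g l s → con 1ℤ :* g :+ (l :+ s) := l :+ (s :+ g)) refl (g r) (S (S̄ g) r) (S g r))

    S̄T : ∀ g r → S̄ (T g) r ≡ + 2 * S (S̄ g) r + S̄ g r
    S̄T g zero    = solve 1 (λ g → con 0ℤ :+ (con 0ℤ :+ con 0ℤ :+ g) := con 0ℤ :+ (con 0ℤ :+ g)) refl (g 0)
    S̄T g (suc r) = trans (cong (_+ T g (suc r)) (S̄T g r))
      (solve 4 (λ t s g h → con (+ 2) :* t :+ (s :+ g) :+ ((s :+ g) :+ (s :+ g) :+ h)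
          := con (+ 2) :* (t :+ (s :+ g)) :+ ((s :+ g) :+ h)) refl (S (S̄ g) r) (S g r) (g r) (g (suc r)))

    -- The generating function of the squares is `u (1 + u) / (1 - u)³`, the product of the
    -- multipliers of `S`, of `S̄`, which is `1 / (1 - u)`, and of `T`.
    quadratic≡ : ∀ g r → quadratic g r 0 ≡ S (S̄ (T g)) r
    quadratic≡ g zero    = refl
    quadratic≡ g (suc r) = trans (cong (λ t → 1ℤ * 1ℤ * g r + t)
        (trans (quadratic-suc g r 0) (cong₂ (λ a b → a + + 2 * b + S g r) (quadratic≡ g r) (linear≡ g r))))
      (trans (solve 4 (λ g q l s → con 1ℤ :* con 1ℤ :* g :+ (q :+ con (+ 2) :* l :+ s) := q :+ (con (+ 2) :* l :+ (s :+ g))) refl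
          (g r) (S (S̄ (T g)) r) (S (S̄ g) r) (S g r))
        (cong (λ t → S (S̄ (T g)) r + t) (sym (S̄T g r))))

    ST : ∀ f r → S (T f) r + S f r ≡ + 2 * S (S̄ f) r
    ST f zero    = refl
    ST f (suc r) = trans (solve 4 (λ a b s f → (a :+ (s :+ s :+ f)) :+ (b :+ f) := (a :+ b) :+ con (+ 2) :* (s :+ f)) refl
        (S (T f) r) (S f r) (S f r) (f r))
      (trans (cong (_+ + 2 * S̄ f r) (ST f r)) (sym (ℤ.*-distribˡ-+ (+ 2) (S (S̄ f) r) (S̄ f r))))

    -- In generating functions: `((1 + u) / (1 - u))² - 1 = 4 u / (1 - u)²`.
    TT : ∀ f r → T (T f) r ≡ f r + + 4 * S (S̄ f) r
    TT f r = trans (solve 3 (λ a s f → a :+ a :+ (s :+ s :+ f) := f :+ con (+ 2) :* (a :+ s)) refl (S (T f) r) (S f r) (f r))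
      (trans (cong (λ t → f r + + 2 * t) (ST f r))
        (solve 2 (λ f t → f :+ con (+ 2) :* (con (+ 2) :* t) := f :+ con (+ 4) :* t) refl (f r) (S (S̄ f) r)))

    S-moment : ∀ k {f g h : ℕ → ℤ} → (∀ r → + 2 * f r ≡ k * (g r - h r)) → ∀ r → + 2 * S f r ≡ k * (S g r - S h r)
    S-moment k e zero = sym (ℤ.*-zeroʳ k)
    S-moment k {f} {g} {h} e (suc r) = trans (ℤ.*-distribˡ-+ (+ 2) (S f r) (f r))
      (trans (cong₂ _+_ (S-moment k e r) (e r))
        (solve 5 (λ k a b c d → k :* (a :- b) :+ k :* (c :- d) := k :* ((a :+ c) :- (b :+ d))) refl k (S g r) (S h r) (g r) (h r)))

  -- By `quadratic≡` and `TT`, coordinate number `n + 1` contributes `D (n + 3) - D (n + 1)` to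
  -- twice the moment, and `T` raises the dimensions in the inductive hypothesis by one.
  2Z : ∀ n r → + 2 * Z n r ≡ + n * (D (suc (suc n)) r - D n r)
  2Z zero    r = refl
  2Z (suc n) r = trans (solve 3 (λ s z q → con (+ 2) :* (s :+ s :+ z :+ con (+ 2) :* q)
        := con (+ 2) :* s :+ con (+ 2) :* s :+ con (+ 2) :* z :+ con (+ 4) :* q) refl
      (S (Z n) r) (Z n r) (quadratic (D n) r 0))
    (trans (cong₂ _+_ (cong₂ (λ a b → a + a + b) (S-moment (+ n) {Z n} {D (suc (suc n))} {D n} (2Z n) r) (2Z n r))
        (trans (cong (+ 4 *_) (quadratic≡ (D n) r))
          (trans (solve 2 (λ t d → t := (d :+ t) :- d) refl (+ 4 * S (S̄ (D (suc n))) r) (D (suc n) r))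
            (cong (_- D (suc n) r) (sym (TT (D (suc n)) r))))))
      (solve 5 (λ n a b c d → n :* (a :- b) :+ n :* (a :- b) :+ n :* (c :- d) :+ ((a :+ a :+ c) :- (b :+ b :+ d))
          := (con 1ℤ :+ n) :* ((a :+ a :+ c) :- (b :+ b :+ d))) refl
        (+ n) (S (D (suc (suc n))) r) (S (D n) r) (D (suc (suc n)) r) (D n r)))

-- Enumeration of lattice balls and sums over them

module Balls where
  open PartialSums
  open import Data.Integer.Base using (_+_; _*_; _-_; -_; 0ℤ; 1ℤ)
  open import Data.List.Base as List using (List; []; _∷_; _++_; map; concatMap; length)
  import Data.List.Properties as List
  open import Data.List.Membership.Propositional using (_∈_)
  open import Data.List.Membership.Propositional.Properties
  open import Data.List.Relation.Unary.Any using (here; there)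
  open import Data.List.Relation.Unary.All using (All; []; _∷_)
  open import Data.List.Relation.Unary.AllPairs using ([]; _∷_)
  open import Data.List.Relation.Unary.Unique.Propositional using (Unique)
  import Data.List.Relation.Unary.Unique.Propositional.Properties as Unique
  open import Data.Vec.Base as Vec using (Vec; []; _∷_)
  import Data.Vec.Properties as Vec

  pos neg : ℤ → ℕ
  pos (+ k)    = k
  pos -[1+ k ] = 0
  neg (+ k)    = 0
  neg -[1+ k ] = suc k

  -- The ℓ¹ norm is the sum of these two and the total is their difference; as separate naturals
  -- they keep the conditions on lattice points free of absolute values and subtraction.
  Pos# Neg# : ∀ {n} → Vec ℤ n → ℕ
  Pos# []       = 0
  Pos# (x ∷ xs) = pos x ℕ.+ Pos# xs
  Neg# []       = 0
  Neg# (x ∷ xs) = neg x ℕ.+ Neg# xs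

  total : ∀ {n} → Vec ℤ n → ℤ
  total []       = 0ℤ
  total (x ∷ xs) = x + total xs

  pos-neg : ∀ x → x ≡ + pos x - + neg x
  pos-neg (+ k)    = sym (ℤ.+-identityʳ (+ k))
  pos-neg -[1+ k ] = refl

  total≡ : ∀ {n} (xs : Vec ℤ n) → total xs ≡ + Pos# xs - + Neg# xs
  total≡ []       = refl
  total≡ (x ∷ xs) = trans (cong₂ _+_ (pos-neg x) (total≡ xs))
    (solve 4 (λ a b c d → (a :- b) :+ (c :- d) := (a :+ c) :- (b :+ d)) refl
      (+ pos x) (+ neg x) (+ Pos# xs) (+ Neg# xs))
    where open ℤ-Solver.+-*-Solver

  sumL : ∀ {A : Set} → (A → ℤ) → List A → ℤ
  sumL φ []       = 0ℤ
  sumL φ (x ∷ xs) = φ x + sumL φ xs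

  module _ {A : Set} where
    sumL-++ : ∀ (φ : A → ℤ) xs ys → sumL φ (xs ++ ys) ≡ sumL φ xs + sumL φ ys
    sumL-++ φ []       ys = sym (ℤ.+-identityˡ (sumL φ ys))
    sumL-++ φ (x ∷ xs) ys = trans (cong (λ t → φ x + t) (sumL-++ φ xs ys)) (sym (ℤ.+-assoc (φ x) (sumL φ xs) (sumL φ ys)))

    sumL-map : ∀ {B : Set} (φ : A → ℤ) (f : B → A) xs → sumL φ (map f xs) ≡ sumL (φ ∘ f) xs
    sumL-map φ f []       = refl
    sumL-map φ f (x ∷ xs) = cong (λ t → φ (f x) + t) (sumL-map φ f xs)

    sumL-cong : ∀ {φ ψ : A → ℤ} xs → (∀ x → x ∈ xs → φ x ≡ ψ x) → sumL φ xs ≡ sumL ψ xs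
    sumL-cong []       h = refl
    sumL-cong (x ∷ xs) h = cong₂ _+_ (h x (here refl)) (sumL-cong xs λ y y∈ → h y (there y∈))

    sumL-+ : ∀ (φ ψ : A → ℤ) xs → sumL (λ x → φ x + ψ x) xs ≡ sumL φ xs + sumL ψ xs
    sumL-+ φ ψ []       = refl
    sumL-+ φ ψ (x ∷ xs) = trans (cong (λ t → φ x + ψ x + t) (sumL-+ φ ψ xs))
      (solve 4 (λ a b c d → a :+ b :+ (c :+ d) := a :+ c :+ (b :+ d)) refl (φ x) (ψ x) (sumL φ xs) (sumL ψ xs))
      where open ℤ-Solver.+-*-Solver

    sumL-* : ∀ c (φ : A → ℤ) xs → sumL (λ x → c * φ x) xs ≡ c * sumL φ xs
    sumL-* c φ []       = sym (ℤ.*-zeroʳ c)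
    sumL-* c φ (x ∷ xs) = trans (cong (λ t → c * φ x + t) (sumL-* c φ xs)) (sym (ℤ.*-distribˡ-+ c (φ x) (sumL φ xs)))

    length≡sumL : ∀ (xs : List A) → + length xs ≡ sumL (λ _ → 1ℤ) xs
    length≡sumL []       = refl
    length≡sumL (x ∷ xs) = cong (λ t → 1ℤ + t) (length≡sumL xs)

    length-concatMap : ∀ {B : Set} (f : A → List B) xs → + length (concatMap f xs) ≡ sumL (λ x → + length (f x)) xs
    length-concatMap f []       = refl
    length-concatMap f (x ∷ xs) = trans (cong +_ (List.length-++ (f x)))
      (cong (λ t → + length (f x) + t) (length-concatMap f xs))

    unique-concatMap : ∀ {B : Set} (f : A → List B) xs → Unique xs → (∀ x → Unique (f x)) →
      (∀ {x y z} → z ∈ f x → z ∈ f y → x ≡ y) → Unique (concatMap f xs)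
    unique-concatMap f []       _          _  _   = []
    unique-concatMap f (x ∷ xs) (x∉ ∷ uxs) uf inj = Unique.++⁺ (uf x) (unique-concatMap f xs uxs uf inj)
      λ { (z∈fx , z∈rest) → disjoint xs x∉ z∈fx (∈-concatMap⁻ f {xs = xs} z∈rest) }
      where
      open import Data.List.Relation.Unary.Any using (Any)
      disjoint : ∀ xs {z} → All (λ y → x ≢ y) xs → z ∈ f x → Any (λ y → z ∈ f y) xs → ⊥
      disjoint (y ∷ ys) (x≢y ∷ _) z∈fx (here z∈fy)  = x≢y (inj z∈fx z∈fy)
      disjoint (y ∷ ys) (_ ∷ x∉)  z∈fx (there z∈ys) = disjoint ys x∉ z∈fx z∈ys

  -- The vectors c (k + i) ∷ y with y in f j and k + j + 1 = r.
  sweep : ∀ {n} → (ℕ → ℤ) → (ℕ → List (Vec ℤ n)) → ℕ → ℕ → List (Vec ℤ (suc n))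
  sweep c f zero    i = []
  sweep c f (suc r) i = map (c i ∷_) (f r) ++ sweep c f r (suc i)

  module _ {n} (c : ℕ → ℤ) (f : ℕ → List (Vec ℤ n)) where

    ∈-sweep⁻ : ∀ r i {x y} → x ∷ y ∈ sweep c f r i → ∃[ k ] ∃[ j ] x ≡ c (k ℕ.+ i) × suc (k ℕ.+ j) ≡ r × y ∈ f j
    ∈-sweep⁻ (suc r) i h with ∈-++⁻ (map (c i ∷_) (f r)) h
    ... | inj₁ h₁ with ∈-map⁻ (c i ∷_) h₁
    ... | y , y∈ , refl = 0 , r , refl , refl , y∈
    ∈-sweep⁻ (suc r) i h | inj₂ h₂ =
      let k , j , e , e′ , y∈ = ∈-sweep⁻ r (suc i) h₂
      in suc k , j , trans e (cong c (ℕ.+-suc k i)) , cong suc e′ , y∈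

    ∈-sweep⁺ : ∀ r i k j {y} → suc (k ℕ.+ j) ≡ r → y ∈ f j → c (k ℕ.+ i) ∷ y ∈ sweep c f r i
    ∈-sweep⁺ (suc r) i zero    j refl y∈ = ∈-++⁺ˡ (∈-map⁺ (c i ∷_) y∈)
    ∈-sweep⁺ (suc r) i (suc k) j {y} refl y∈ = ∈-++⁺ʳ (map (c i ∷_) (f r))
      (subst (λ t → c t ∷ y ∈ sweep c f r (suc i)) (ℕ.+-suc k i) (∈-sweep⁺ r (suc i) k j refl y∈))

    unique-sweep : (∀ {a b} → c a ≡ c b → a ≡ b) → (∀ j → Unique (f j)) → ∀ r i → Unique (sweep c f r i)
    unique-sweep c-inj uf zero    i = []
    unique-sweep c-inj uf (suc r) i = Unique.++⁺ (Unique.map⁺ Vec.∷-injectiveʳ (uf r)) (unique-sweep c-inj uf r (suc i))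
      λ { (h₁ , h₂) → disjoint (∈-map⁻ (c i ∷_) h₁) h₂ }
      where
      disjoint : ∀ {z} → ∃[ y ] y ∈ f r × z ≡ c i ∷ y → z ∈ sweep c f r (suc i) → ⊥
      disjoint (y , _ , refl) h = let k , _ , e , _ = ∈-sweep⁻ r (suc i) h in
        ℕ.<-irrefl (c-inj e) (ℕ.m≤n+m (suc i) k)

    sumL-sweep : ∀ (φ : Vec ℤ (suc n) → ℤ) (g : ℕ → ℤ) r i →
      (∀ k j → suc (k ℕ.+ j) ≡ r → sumL (λ y → φ (c (k ℕ.+ i) ∷ y)) (f j) ≡ g j) →
      sumL φ (sweep c f r i) ≡ S g r
    sumL-sweep φ g zero    i h = refl
    sumL-sweep φ g (suc r) i h = trans (sumL-++ φ (map (c i ∷_) (f r)) (sweep c f r (suc i)))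
      (trans (cong₂ _+_ (trans (sumL-map φ (c i ∷_) (f r)) (h 0 r refl))
               (sumL-sweep φ g r (suc i) λ k j e →
                 trans (cong (λ t → sumL (λ y → φ (c t ∷ y)) (f j)) (ℕ.+-suc k i)) (h (suc k) j (cong suc e))))
        (ℤ.+-comm (g r) (S g r)))

  +suc : ℕ → ℤ
  +suc k = + suc k

  private
    +suc-injective : ∀ {a b} → +suc a ≡ +suc b → a ≡ b
    +suc-injective refl = refl

    -suc-injective : ∀ {a b} → -[1+ a ] ≡ -[1+ b ] → a ≡ b
    -suc-injective refl = refl

  -- The first coordinate is zero, positive or negative, the last two cases with budgets `p` and `m`
  -- of their own. Equal budgets and tails give balls, separate ones give slices.
  triple : ∀ {n} → List (Vec ℤ n) → (ℕ → List (Vec ℤ n)) → ℕ → (ℕ → List (Vec ℤ n)) → ℕ → List (Vec ℤ (suc n))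
  triple zs f p g m = map (+ 0 ∷_) zs ++ (sweep +suc f p 0 ++ sweep -[1+_] g m 0)

  module _ {n} {zs : List (Vec ℤ n)} {f : ℕ → List (Vec ℤ n)} {p : ℕ} {g : ℕ → List (Vec ℤ n)} {m : ℕ} where

    data InTriple : ℤ → Vec ℤ n → Set where
      null     : ∀ {y} → y ∈ zs → InTriple (+ 0) y
      positive : ∀ k {j y} → suc (k ℕ.+ j) ≡ p → y ∈ f j → InTriple (+suc k) y
      negative : ∀ k {j y} → suc (k ℕ.+ j) ≡ m → y ∈ g j → InTriple -[1+ k ] y

    ∈-triple⁻ : ∀ {x y} → x ∷ y ∈ triple zs f p g m → InTriple x y
    ∈-triple⁻ h with ∈-++⁻ (map (+ 0 ∷_) zs) h
    ... | inj₁ h₁ with ∈-map⁻ (+ 0 ∷_) h₁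
    ... | y , y∈ , refl = null y∈
    ∈-triple⁻ h | inj₂ h₂ with ∈-++⁻ (sweep +suc f p 0) h₂
    ... | inj₁ h₃ with ∈-sweep⁻ +suc f p 0 h₃
    ... | k , j , refl , e , y∈ = positive (k ℕ.+ 0) (trans (cong (λ t → suc (t ℕ.+ j)) (ℕ.+-identityʳ k)) e) y∈
    ∈-triple⁻ h | inj₂ h₂ | inj₂ h₃ with ∈-sweep⁻ -[1+_] g m 0 h₃
    ... | k , j , refl , e , y∈ = negative (k ℕ.+ 0) (trans (cong (λ t → suc (t ℕ.+ j)) (ℕ.+-identityʳ k)) e) y∈

    ∈-triple⁺ : ∀ {x y} → InTriple x y → x ∷ y ∈ triple zs f p g m
    ∈-triple⁺ (null y∈) = ∈-++⁺ˡ (∈-map⁺ (+ 0 ∷_) y∈)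
    ∈-triple⁺ (positive k {j} {y} e y∈) = ∈-++⁺ʳ (map (+ 0 ∷_) zs) (∈-++⁺ˡ
      (subst (λ t → +suc t ∷ y ∈ sweep +suc f p 0) (ℕ.+-identityʳ k) (∈-sweep⁺ +suc f p 0 k j e y∈)))
    ∈-triple⁺ (negative k {j} {y} e y∈) = ∈-++⁺ʳ (map (+ 0 ∷_) zs) (∈-++⁺ʳ (sweep +suc f p 0)
      (subst (λ t → -[1+ t ] ∷ y ∈ sweep -[1+_] g m 0) (ℕ.+-identityʳ k) (∈-sweep⁺ -[1+_] g m 0 k j e y∈)))

    unique-triple : Unique zs → (∀ j → Unique (f j)) → (∀ j → Unique (g j)) → Unique (triple zs f p g m)
    unique-triple uz uf ug = Unique.++⁺ (Unique.map⁺ Vec.∷-injectiveʳ uz)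
      (Unique.++⁺ (unique-sweep +suc f +suc-injective uf p 0) (unique-sweep -[1+_] g -suc-injective ug m 0)
        λ { {_ ∷ _} (h₁ , h₂) → ±-disjoint (∈-sweep⁻ +suc f p 0 h₁) (∈-sweep⁻ -[1+_] g m 0 h₂) })
      λ { {_ ∷ _} (h₁ , h₂) → 0-disjoint (∈-map⁻ (+ 0 ∷_) h₁) (∈-++⁻ (sweep +suc f p 0) h₂) }
      where
      ±-disjoint : ∀ {x} {A B : ℕ → ℕ → Set} → ∃[ k ] ∃[ j ] x ≡ +suc (k ℕ.+ 0) × A k j → ∃[ k ] ∃[ j ] x ≡ -[1+ k ℕ.+ 0 ] × B k j → ⊥
      ±-disjoint (_ , _ , refl , _) (_ , _ , () , _)
      0-disjoint : ∀ {x y} → ∃[ y′ ] y′ ∈ zs × (x ∷ y) ≡ (+ 0 ∷ y′) →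
                   (x ∷ y) ∈ sweep +suc f p 0 ⊎ (x ∷ y) ∈ sweep -[1+_] g m 0 → ⊥
      0-disjoint (_ , _ , refl) (inj₁ h) with ∈-sweep⁻ +suc f p 0 h
      ... | _ , _ , () , _
      0-disjoint (_ , _ , refl) (inj₂ h) with ∈-sweep⁻ -[1+_] g m 0 h
      ... | _ , _ , () , _

    sumL-triple : ∀ (φ : Vec ℤ (suc n) → ℤ) → sumL φ (triple zs f p g m) ≡
      sumL (φ ∘ (+ 0 ∷_)) zs + (sumL φ (sweep +suc f p 0) + sumL φ (sweep -[1+_] g m 0))
    sumL-triple φ = trans (sumL-++ φ (map (+ 0 ∷_) zs) _)
      (cong₂ _+_ (sumL-map φ (+ 0 ∷_) zs) (sumL-++ φ (sweep +suc f p 0) (sweep -[1+_] g m 0)))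

  ball : ∀ n → ℕ → List (Vec ℤ n)
  ball zero    r = [] ∷ []
  ball (suc n) r = triple (ball n r) (ball n) r (ball n) r

  ∈-ball⁻ : ∀ n r {y} → y ∈ ball n r → Pos# y ℕ.+ Neg# y ℕ.≤ r
  ∈-ball⁻ zero    r {[]} _ = ℕ.z≤n
  ∈-ball⁻ (suc n) r {x ∷ y} h with ∈-triple⁻ {n} {ball n r} {ball n} {r} {ball n} {r} h
  ... | null y∈ = ∈-ball⁻ n r y∈
  ... | positive k {j} e y∈ = subst (suc (k ℕ.+ Pos# y ℕ.+ Neg# y) ℕ.≤_) e
    (subst (ℕ._≤ suc (k ℕ.+ j)) (cong suc (sym (ℕ.+-assoc k (Pos# y) (Neg# y))))
      (ℕ.s≤s (ℕ.+-monoʳ-≤ k (∈-ball⁻ n j y∈))))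
  ... | negative k {j} e y∈ = subst (Pos# y ℕ.+ suc (k ℕ.+ Neg# y) ℕ.≤_) e
    (subst (ℕ._≤ suc (k ℕ.+ j)) (solve 3 (λ k a b → con 1 :+ (k :+ (a :+ b)) := a :+ (con 1 :+ (k :+ b))) refl k (Pos# y) (Neg# y))
      (ℕ.s≤s (ℕ.+-monoʳ-≤ k (∈-ball⁻ n j y∈))))
    where open ℕ-Solver.+-*-Solver

  BallStep : ∀ n → ℕ → ℤ → Vec ℤ n → Set
  BallStep n r = InTriple {n} {ball n r} {ball n} {r} {ball n} {r}

  ∈-ball⁺ : ∀ n r y → Pos# y ℕ.+ Neg# y ℕ.≤ r → y ∈ ball n r
  ∈-ball⁺ zero    r []      _ = here refl
  ∈-ball⁺ (suc n) r (x ∷ y) h = ∈-triple⁺ {n} {ball n r} {ball n} {r} {ball n} {r} (step x h)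
    where
    open ℕ-Solver.+-*-Solver
    step : ∀ x → Pos# (x ∷ y) ℕ.+ Neg# (x ∷ y) ℕ.≤ r → BallStep n r x y
    step (+ 0)     h = null (∈-ball⁺ n r y h)
    step (+ suc k) h = let o , e = ℕ.m≤n⇒∃[o]m+o≡n h in
      positive k {Pos# y ℕ.+ Neg# y ℕ.+ o}
        (trans (solve 4 (λ k a b o → con 1 :+ (k :+ (a :+ b :+ o)) := con 1 :+ (k :+ a :+ b :+ o)) refl k (Pos# y) (Neg# y) o) e)
        (∈-ball⁺ n _ y (ℕ.m≤m+n _ o))
    step -[1+ k ]  h = let o , e = ℕ.m≤n⇒∃[o]m+o≡n h in
      negative k {Pos# y ℕ.+ Neg# y ℕ.+ o}
        (trans (solve 4 (λ k a b o → con 1 :+ (k :+ (a :+ b :+ o)) := a :+ (con 1 :+ (k :+ b)) :+ o) refl k (Pos# y) (Neg# y) o) e)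
        (∈-ball⁺ n _ y (ℕ.m≤m+n _ o))

  unique-ball : ∀ n r → Unique (ball n r)
  unique-ball zero    r = [] ∷ []
  unique-ball (suc n) r = unique-triple {n} {ball n r} {ball n} {r} {ball n} {r} (unique-ball n r) (unique-ball n) (unique-ball n)

  private
    T-form : ∀ f r → f r + (S f r + S f r) ≡ T f r
    T-form f r = ℤ.+-comm (f r) (S f r + S f r)

  ball-count : ∀ n r → sumL (λ _ → 1ℤ) (ball n r) ≡ D n r
  ball-count zero    r = refl
  ball-count (suc n) r = trans (sumL-triple {zs = ball n r} {ball n} {r} {ball n} {r} (λ _ → 1ℤ))
    (trans (cong₂ _+_ (ball-count n r) (cong₂ _+_
        (sumL-sweep +suc (ball n) (λ _ → 1ℤ) (D n) r 0 λ _ j _ → ball-count n j)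
        (sumL-sweep -[1+_] (ball n) (λ _ → 1ℤ) (D n) r 0 λ _ j _ → ball-count n j)))
      (T-form (D n) r))

  slack : ∀ {n} → ℕ → Vec ℤ n → ℕ
  slack r y = r ℕ.∸ (Pos# y ℕ.+ Neg# y)

  ball-even : ∀ n r → sumL (λ y → ev (slack r y)) (ball n r) ≡ E n r
  ball-even zero    r = ℤ.+-identityʳ (ev r)
  ball-even (suc n) r = trans (sumL-triple {zs = ball n r} {ball n} {r} {ball n} {r} (λ y → ev (slack r y)))
    (trans (cong₂ _+_ (ball-even n r) (cong₂ _+_
        (sumL-sweep +suc (ball n) (λ y → ev (slack r y)) (E n) r 0 λ k j e →
          trans (sumL-cong (ball n j) λ y _ → cong ev (shift⁺ k j y e)) (ball-even n j))
        (sumL-sweep -[1+_] (ball n) (λ y → ev (slack r y)) (E n) r 0 λ k j e →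
          trans (sumL-cong (ball n j) λ y _ → cong ev (shift⁻ k j y e)) (ball-even n j))))
      (T-form (E n) r))
    where
    open ℕ-Solver.+-*-Solver
    shift⁺ : ∀ k j y → suc (k ℕ.+ j) ≡ r → slack r (+suc (k ℕ.+ 0) ∷ y) ≡ slack j y
    shift⁺ k j y refl = trans (cong (suc (k ℕ.+ j) ℕ.∸_)
      (solve 3 (λ k a b → con 1 :+ (k :+ con 0 :+ a) :+ b := con 1 :+ (k :+ (a :+ b))) refl k (Pos# y) (Neg# y)))
      (ℕ.[m+n]∸[m+o]≡n∸o k j (Pos# y ℕ.+ Neg# y))
    shift⁻ : ∀ k j y → suc (k ℕ.+ j) ≡ r → slack r (-[1+ k ℕ.+ 0 ] ∷ y) ≡ slack j y
    shift⁻ k j y refl = trans (cong (suc (k ℕ.+ j) ℕ.∸_)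
      (solve 3 (λ k a b → a :+ (con 1 :+ (k :+ con 0 :+ b)) := con 1 :+ (k :+ (a :+ b))) refl k (Pos# y) (Neg# y)))
      (ℕ.[m+n]∸[m+o]≡n∸o k j (Pos# y ℕ.+ Neg# y))

  square-total : ∀ {n} → Vec ℤ n → ℤ
  square-total y = total y * total y

  -- Opposite values of the first coordinate make the cross terms cancel.
  opposite-squares : ∀ {n} a (ys : List (Vec ℤ n)) →
    sumL (λ y → square-total (a ∷ y)) ys + sumL (λ y → square-total (- a ∷ y)) ys ≡
    + 2 * (a * a * sumL (λ _ → 1ℤ) ys) + (sumL square-total ys + sumL square-total ys)
  opposite-squares a []       = solve 1 (λ a → con 0ℤ := con (+ 2) :* (a :* a :* con 0ℤ) :+ con 0ℤ) refl a
    where open ℤ-Solver.+-*-Solver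
  opposite-squares a (y ∷ ys) = trans
    (solve 4 (λ a t u v → (a :+ t) :* (a :+ t) :+ u :+ ((:- a :+ t) :* (:- a :+ t) :+ v)
        := con (+ 2) :* (a :* a) :+ (t :* t :+ t :* t) :+ (u :+ v)) refl a (total y)
      (sumL (λ y → square-total (a ∷ y)) ys) (sumL (λ y → square-total (- a ∷ y)) ys))
    (trans (cong (λ s → + 2 * (a * a) + (total y * total y + total y * total y) + s) (opposite-squares a ys))
      (solve 4 (λ a t l s → con (+ 2) :* (a :* a) :+ (t :* t :+ t :* t) :+ (con (+ 2) :* (a :* a :* l) :+ (s :+ s))
          := con (+ 2) :* (a :* a :* (con 1ℤ :+ l)) :+ (t :* t :+ s :+ (t :* t :+ s))) refl
        a (total y) (sumL (λ _ → 1ℤ) ys) (sumL square-total ys)))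
    where open ℤ-Solver.+-*-Solver

  -- The two sweeps are summed together, layer by layer, so that `opposite-squares` applies to each
  -- pair of first coordinates `i + 1` and `-(i + 1)`.
  sweep-squares : ∀ {n} (f : ℕ → List (Vec ℤ n)) (d z : ℕ → ℤ) → (∀ j → sumL (λ _ → 1ℤ) (f j) ≡ d j) →
    (∀ j → sumL square-total (f j) ≡ z j) → ∀ r i →
    sumL square-total (sweep +suc f r i) + sumL square-total (sweep -[1+_] f r i) ≡
    + 2 * quadratic d r i + (S z r + S z r)
  sweep-squares f d z hd hz zero    i = refl
  sweep-squares f d z hd hz (suc r) i = trans
    (cong₂ _+_ (trans (sumL-++ square-total (map (+suc i ∷_) (f r)) _) (cong (_+ rest⁺) (sumL-map square-total (+suc i ∷_) (f r))))
      (trans (sumL-++ square-total (map (-[1+ i ] ∷_) (f r)) _) (cong (_+ rest⁻) (sumL-map square-total (-[1+ i ] ∷_) (f r)))))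
    (trans (solve 4 (λ a b c d → a :+ b :+ (c :+ d) := (a :+ c) :+ (b :+ d)) refl
        (sumL (λ y → square-total (+suc i ∷ y)) (f r)) rest⁺ (sumL (λ y → square-total (-[1+ i ] ∷ y)) (f r)) rest⁻)
      (trans (cong₂ _+_
          (trans (opposite-squares (+suc i) (f r)) (cong₂ (λ d z → + 2 * (+suc i * +suc i * d) + (z + z)) (hd r) (hz r)))
          (sweep-squares f d z hd hz r (suc i)))
        (solve 5 (λ i d z q s → con (+ 2) :* (i :* i :* d) :+ (z :+ z) :+ (con (+ 2) :* q :+ (s :+ s))
            := con (+ 2) :* (i :* i :* d :+ q) :+ (s :+ z :+ (s :+ z))) refl (+suc i) (d r) (z r) (quadratic d r (suc i)) (S z r))))
    where
    open ℤ-Solver.+-*-Solver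
    rest⁺ rest⁻ : ℤ
    rest⁺ = sumL square-total (sweep +suc f r (suc i))
    rest⁻ = sumL square-total (sweep -[1+_] f r (suc i))

  ball-squares : ∀ n r → sumL square-total (ball n r) ≡ Z n r
  ball-squares zero    r = refl
  ball-squares (suc n) r = trans (sumL-triple {zs = ball n r} {ball n} {r} {ball n} {r} square-total)
    (trans (cong₂ _+_
        (trans (sumL-cong (ball n r) λ y _ → cong (λ t → t * t) (ℤ.+-identityˡ (total y))) (ball-squares n r))
        (sweep-squares (ball n) (D n) (Z n) (ball-count n) (ball-squares n) r 0))
      (solve 3 (λ z q s → z :+ (con (+ 2) :* q :+ (s :+ s)) := s :+ s :+ z :+ con (+ 2) :* q) refl
        (Z n r) (quadratic (D n) r 0) (S (Z n) r)))
    where open ℤ-Solver.+-*-Solver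

-- Counting balanced pairs by fibres over the ball

module LatticeCount where
  open PartialSums
  open Balls
  open import Data.Nat.Base using (⌊_/2⌋)
  open import Data.Integer.Base using (_+_; _*_; _-_; -_; 1ℤ)
  open import Data.List.Base using (List; []; _∷_; map; concatMap; length)
  import Data.List.Properties as List
  open import Data.List.Membership.Propositional using (_∈_; lose; find)
  open import Data.List.Membership.Propositional.Properties
  open import Data.List.Relation.Unary.Any using (here)
  open import Data.List.Relation.Unary.All using ([]; _∷_)
  open import Data.List.Relation.Unary.AllPairs using ([]; _∷_)
  open import Data.List.Relation.Unary.Unique.Propositional using (Unique)
  import Data.List.Relation.Unary.Unique.Propositional.Properties as Unique
  open import Data.Vec.Base as Vec using (Vec; []; _∷_; _++_)
  import Data.Vec.Properties as Vec

  -- p - m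
  diff : ℕ → ℕ → ℤ
  diff p       zero    = + p
  diff zero    (suc m) = -[1+ m ]
  diff (suc p) (suc m) = diff p m

  -- The vectors of total p - m with negative part at most m, hence positive part at most p.
  slice : ∀ a → ℕ → ℕ → List (Vec ℤ (suc a))
  slice zero    p m = (diff p m ∷ []) ∷ []
  slice (suc a) p m = triple (slice a p m) (λ j → slice a j m) p (λ j → slice a p j) m

  -- The condition on the total is an equation in ℕ to avoid truncated subtraction; it also turns
  -- the bound on the negative part into the one on the positive part.
  InSlice : ∀ {a} → ℕ → ℕ → Vec ℤ a → Set
  InSlice p m x = Pos# x ℕ.+ m ≡ Neg# x ℕ.+ p × Neg# x ℕ.≤ m

  private
    inSlice-diff : ∀ p m → pos (diff p m) ℕ.+ m ≡ neg (diff p m) ℕ.+ p × neg (diff p m) ℕ.≤ m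
    inSlice-diff p       zero    = ℕ.+-identityʳ p , ℕ.z≤n
    inSlice-diff zero    (suc m) = cong suc (sym (ℕ.+-identityʳ m)) , ℕ.≤-refl
    inSlice-diff (suc p) (suc m) = let e , h = inSlice-diff p m in
        trans (ℕ.+-suc (pos (diff p m)) m) (trans (cong suc e) (sym (ℕ.+-suc (neg (diff p m)) p)))
      , ℕ.m≤n⇒m≤1+n h

    diff-unique : ∀ p m x → pos x ℕ.+ m ≡ neg x ℕ.+ p → neg x ℕ.≤ m → x ≡ diff p m
    diff-unique p       zero    (+ k)    e h = cong +_ (trans (sym (ℕ.+-identityʳ k)) e)
    diff-unique zero    (suc m) (+ k)    e h = ⊥-elim (ℕ.1+n≢0 (trans (sym (ℕ.+-suc k m)) e))
    diff-unique (suc p) (suc m) (+ k)    e h = diff-unique p m (+ k) (ℕ.suc-injective (trans (sym (ℕ.+-suc k m)) e)) ℕ.z≤n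
    diff-unique zero    (suc m) -[1+ k ] e h = cong -[1+_] (trans (sym (ℕ.+-identityʳ k)) (sym (ℕ.suc-injective e)))
    diff-unique (suc p) (suc m) -[1+ k ] e h = diff-unique p m -[1+ k ]
      (trans (ℕ.suc-injective e) (ℕ.+-suc k p))
      (subst (suc k ℕ.≤_) (sym (trans (ℕ.suc-injective e) (ℕ.+-suc k p))) (ℕ.m≤m+n (suc k) p))

  SliceStep : ∀ a → ℕ → ℕ → ℤ → Vec ℤ (suc a) → Set
  SliceStep a p m = InTriple {suc a} {slice a p m} {λ j → slice a j m} {p} {λ j → slice a p j} {m}

  ∈-slice⁻ : ∀ a p m {x} → x ∈ slice a p m → InSlice p m x
  ∈-slice⁻ zero p m (here refl) = let e , h = inSlice-diff p m in
      trans (cong (ℕ._+ m) (ℕ.+-identityʳ _)) (trans e (cong (ℕ._+ p) (sym (ℕ.+-identityʳ _))))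
    , subst (ℕ._≤ m) (sym (ℕ.+-identityʳ _)) h
  ∈-slice⁻ (suc a) p m {x ∷ y} h = step (∈-triple⁻ {suc a} {slice a p m} {λ j → slice a j m} {p} {λ j → slice a p j} {m} h)
    where
    open ℕ-Solver.+-*-Solver
    step : SliceStep a p m x y → InSlice p m (x ∷ y)
    step (null y∈) = ∈-slice⁻ a p m y∈
    step (positive k {j} refl y∈) = let e , h = ∈-slice⁻ a j m y∈ in
        trans (cong suc (ℕ.+-assoc k (Pos# y) m)) (trans (cong (λ t → suc (k ℕ.+ t)) e)
          (solve 3 (λ k n j → con 1 :+ (k :+ (n :+ j)) := n :+ (con 1 :+ (k :+ j))) refl k (Neg# y) j))
      , h
    step (negative k {j} refl y∈) = let e , h = ∈-slice⁻ a p j y∈ in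
        trans (solve 3 (λ k n j → n :+ (con 1 :+ (k :+ j)) := con 1 :+ (k :+ (n :+ j))) refl k (Pos# y) j)
          (trans (cong (λ t → suc (k ℕ.+ t)) e) (cong suc (sym (ℕ.+-assoc k (Neg# y) p))))
      , ℕ.s≤s (ℕ.+-monoʳ-≤ k h)

  ∈-slice⁺ : ∀ a p m x → InSlice p m x → x ∈ slice a p m
  ∈-slice⁺ zero p m (x ∷ []) (e , h) = here (cong (_∷ []) (diff-unique p m x
    (trans (cong (ℕ._+ m) (sym (ℕ.+-identityʳ (pos x)))) (trans e (cong (ℕ._+ p) (ℕ.+-identityʳ (neg x)))))
    (subst (ℕ._≤ m) (ℕ.+-identityʳ (neg x)) h)))
  ∈-slice⁺ (suc a) p m (x ∷ y) h = ∈-triple⁺ {suc a} {slice a p m} {λ j → slice a j m} {p} {λ j → slice a p j} {m} (step x h)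
    where
    open ℕ-Solver.+-*-Solver
    step : ∀ x → InSlice p m (x ∷ y) → SliceStep a p m x y
    step (+ 0)     h = null (∈-slice⁺ a p m y h)
    step (+ suc k) (e , h) with ℕ.m≤n⇒∃[o]m+o≡n h
    ... | o , refl = positive k {Pos# y ℕ.+ o} (sym p≡)
      (∈-slice⁺ a (Pos# y ℕ.+ o) m y (trans (solve 3 (λ a b c → a :+ (b :+ c) := b :+ (a :+ c)) refl (Pos# y) (Neg# y) o) refl , h))
      where
      p≡ : p ≡ suc (k ℕ.+ (Pos# y ℕ.+ o))
      p≡ = ℕ.+-cancelˡ-≡ (Neg# y) _ _ (trans (sym e)
        (solve 4 (λ k a b c → con 1 :+ (k :+ a) :+ (b :+ c) := b :+ (con 1 :+ (k :+ (a :+ c)))) refl k (Pos# y) (Neg# y) o))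
    step -[1+ k ]  (e , h) with ℕ.m≤n⇒∃[o]m+o≡n h
    ... | o , refl = negative k {Neg# y ℕ.+ o} (cong suc (sym (ℕ.+-assoc k (Neg# y) o)))
      (∈-slice⁺ a p (Neg# y ℕ.+ o) y
        ( ℕ.+-cancelˡ-≡ (suc k) _ _ (trans
            (solve 4 (λ k a b c → con 1 :+ k :+ (a :+ (b :+ c)) := a :+ (con 1 :+ (k :+ b) :+ c)) refl k (Pos# y) (Neg# y) o)
            (trans e (cong suc (ℕ.+-assoc k (Neg# y) p))))
        , ℕ.m≤m+n (Neg# y) o))

  unique-slice : ∀ a p m → Unique (slice a p m)
  unique-slice zero    p m = [] ∷ []
  unique-slice (suc a) p m = unique-triple {suc a} {slice a p m} {λ j → slice a j m} {p} {λ j → slice a p j} {m}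
    (unique-slice a p m) (λ j → unique-slice a j m) (λ j → unique-slice a p j)

  slice-length : ∀ a p m → + length (slice (suc a) p m) ≡ + length (slice a p m) +
    (S (λ j → + length (slice a j m)) p + S (λ j → + length (slice a p j)) m)
  slice-length a p m = trans (length≡sumL (slice (suc a) p m))
    (trans (sumL-triple {suc a} {slice a p m} {λ j → slice a j m} {p} {λ j → slice a p j} {m} (λ _ → 1ℤ))
      (cong₂ _+_ (sym (length≡sumL (slice a p m)))
        (cong₂ _+_
          (sumL-sweep +suc (λ j → slice a j m) (λ _ → 1ℤ) (λ j → + length (slice a j m)) p 0 λ _ j _ → sym (length≡sumL (slice a j m)))
          (sumL-sweep -[1+_] (λ j → slice a p j) (λ _ → 1ℤ) (λ j → + length (slice a p j)) m 0 λ _ j _ → sym (length≡sumL (slice a p j))))))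

  private
    S-1 : ∀ r → S (λ _ → 1ℤ) r ≡ + r
    S-1 zero    = refl
    S-1 (suc r) = trans (cong (_+ 1ℤ) (S-1 r)) (ℤ.+-comm (+ r) 1ℤ)

    S-affine : ∀ c r → + 2 * S (λ j → 1ℤ + (+ j + c)) r ≡ + r * (+ r + 1ℤ) + + 2 * (+ r * c)
    S-affine c zero    = refl
    S-affine c (suc r) = trans (ℤ.*-distribˡ-+ (+ 2) (S (λ j → 1ℤ + (+ j + c)) r) (1ℤ + (+ r + c)))
      (trans (cong (_+ + 2 * (1ℤ + (+ r + c))) (S-affine c r))
        (solve 2 (λ c r → r :* (r :+ con 1ℤ) :+ con (+ 2) :* (r :* c) :+ con (+ 2) :* (con 1ℤ :+ (r :+ c))
            := (con 1ℤ :+ r) :* (con 1ℤ :+ r :+ con 1ℤ) :+ con (+ 2) :* ((con 1ℤ :+ r) :* c)) refl c (+ r)))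
      where open ℤ-Solver.+-*-Solver

  slice₂-length : ∀ p m → + length (slice 1 p m) ≡ 1ℤ + (+ p + + m)
  slice₂-length p m = trans (slice-length 0 p m) (cong₂ (λ a b → 1ℤ + (a + b)) (S-1 p) (S-1 m))

  slice₃-length : ∀ p m → + 2 * + length (slice 2 p m) ≡
    + p * + p + + m * + m + + 4 * (+ p * + m) + + 3 * + p + + 3 * + m + + 2
  slice₃-length p m = trans (cong (+ 2 *_) (trans (slice-length 1 p m) (cong₂ _+_ (slice₂-length p m)
      (cong₂ _+_ (S-cong (λ j → slice₂-length j m) p)
        (S-cong (λ j → trans (slice₂-length p j) (cong (λ t → 1ℤ + t) (ℤ.+-comm (+ p) (+ j)))) m)))))
    (trans (solve 3 (λ a b c → con (+ 2) :* (a :+ (b :+ c)) := con (+ 2) :* a :+ (con (+ 2) :* b :+ con (+ 2) :* c)) refl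
        (1ℤ + (+ p + + m)) (S (λ j → 1ℤ + (+ j + + m)) p) (S (λ j → 1ℤ + (+ j + + p)) m))
      (trans (cong (λ t → + 2 * (1ℤ + (+ p + + m)) + t) (cong₂ _+_ (S-affine (+ m) p) (S-affine (+ p) m)))
        (solve 2 (λ p m → con (+ 2) :* (con 1ℤ :+ (p :+ m)) :+ (p :* (p :+ con 1ℤ) :+ con (+ 2) :* (p :* m)
              :+ (m :* (m :+ con 1ℤ) :+ con (+ 2) :* (m :* p)))
            := p :* p :+ m :* m :+ con (+ 4) :* (p :* m) :+ con (+ 3) :* p :+ con (+ 3) :* m :+ con (+ 2)) refl (+ p) (+ m))))
    where open ℤ-Solver.+-*-Solver

  Balanced : ∀ {a b} → ℕ → Vec ℤ a → Vec ℤ b → Set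
  Balanced s x y = Pos# x ℕ.+ Pos# y ≡ Neg# x ℕ.+ Neg# y × Pos# x ℕ.+ Neg# x ℕ.≤ s × Pos# y ℕ.+ Neg# y ℕ.≤ s

  module _ (a : ℕ) {n : ℕ} (s : ℕ) where

    -- Given y, the vectors x completing it to a lattice point form a slice: x has total - total y, and
    -- half of the slack of y (rounded down) bounds by how much x may exceed the parts of y.
    half : Vec ℤ n → ℕ
    half y = ⌊ slack s y /2⌋

    fibre : Vec ℤ n → List (Vec ℤ (suc a))
    fibre y = slice a (Neg# y ℕ.+ half y) (Pos# y ℕ.+ half y)

    fibre⁻ : ∀ {x y} → Pos# y ℕ.+ Neg# y ℕ.≤ s → x ∈ fibre y → Balanced s x y
    fibre⁻ {x} {y} y≤s x∈ =
      let e , h = ∈-slice⁻ a _ _ x∈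
          k = half y
          e′ : Pos# x ℕ.+ Pos# y ≡ Neg# x ℕ.+ Neg# y
          e′ = ℕ.+-cancelʳ-≡ k _ _ (trans (ℕ.+-assoc (Pos# x) (Pos# y) k) (trans e (sym (ℕ.+-assoc (Neg# x) (Neg# y) k))))
      in e′ , ℕ.≤-trans (bound (Pos# x) (Neg# x) (Pos# y) (Neg# y) k e h)
           (subst (Neg# y ℕ.+ k ℕ.+ (Pos# y ℕ.+ k) ℕ.≤_) (ℕ.m+[n∸m]≡n y≤s)
             (subst (ℕ._≤ Pos# y ℕ.+ Neg# y ℕ.+ slack s y)
               (solve 3 (λ a b k → a :+ b :+ (k :+ k) := b :+ k :+ (a :+ k)) refl (Pos# y) (Neg# y) k)
               (ℕ.+-monoʳ-≤ (Pos# y ℕ.+ Neg# y) (twice-half (slack s y)))))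
        , y≤s
      where
      open ℕ-Solver.+-*-Solver
      bound : ∀ px nx py ny k → px ℕ.+ (py ℕ.+ k) ≡ nx ℕ.+ (ny ℕ.+ k) → nx ℕ.≤ py ℕ.+ k →
              px ℕ.+ nx ℕ.≤ ny ℕ.+ k ℕ.+ (py ℕ.+ k)
      bound px nx py ny k e h = ℕ.+-mono-≤ (ℕ.+-cancelʳ-≤ (py ℕ.+ k) px (ny ℕ.+ k)
        (subst₂ ℕ._≤_ (sym e) (ℕ.+-comm (py ℕ.+ k) (ny ℕ.+ k)) (ℕ.+-monoˡ-≤ (ny ℕ.+ k) h))) h
      twice-half : ∀ k → ⌊ k /2⌋ ℕ.+ ⌊ k /2⌋ ℕ.≤ k
      twice-half k = subst (⌊ k /2⌋ ℕ.+ ⌊ k /2⌋ ℕ.≤_) (ℕ.⌊n/2⌋+⌈n/2⌉≡n k) (ℕ.+-monoʳ-≤ ⌊ k /2⌋ (ℕ.⌊n/2⌋≤⌈n/2⌉ k))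

    -- If `Neg# x = Pos# y + d`, balance gives `Pos# x = Neg# y + d`, so the norm of `x` exceeds
    -- that of `y` by `2 d`. Hence `2 d` is at most the slack.
    fibre⁺ : ∀ x y → Balanced s x y → x ∈ fibre y
    fibre⁺ x y (e , x≤s , y≤s) = ∈-slice⁺ a _ _ x
      ( trans (sym (ℕ.+-assoc (Pos# x) (Pos# y) (half y))) (trans (cong (ℕ._+ half y) e) (ℕ.+-assoc (Neg# x) (Neg# y) (half y)))
      , bound (ℕ.≤-total (Neg# x) (Pos# y)))
      where
      open ℕ-Solver.+-*-Solver
      bound : Neg# x ℕ.≤ Pos# y ⊎ Pos# y ℕ.≤ Neg# x → Neg# x ℕ.≤ Pos# y ℕ.+ half y
      bound (inj₁ h) = ℕ.≤-trans h (ℕ.m≤m+n _ _)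
      bound (inj₂ h) with ℕ.m≤n⇒∃[o]m+o≡n h
      ... | d , Neg≡ = subst (ℕ._≤ Pos# y ℕ.+ half y) Neg≡ (ℕ.+-monoʳ-≤ (Pos# y)
          (subst (ℕ._≤ half y) (half-double d) (ℕ.⌊n/2⌋-mono 2d≤slack)))
        where
        half-double : ∀ d → ⌊ d ℕ.+ d /2⌋ ≡ d
        half-double zero    = refl
        half-double (suc d) = trans (cong (⌊_/2⌋ ∘ suc) (ℕ.+-suc d d)) (cong suc (half-double d))
        Pos≡ : Pos# x ≡ Neg# y ℕ.+ d
        Pos≡ = ℕ.+-cancelʳ-≡ (Pos# y) _ _ (trans e (trans (cong (ℕ._+ Neg# y) (sym Neg≡))
          (solve 3 (λ p d n → p :+ d :+ n := n :+ d :+ p) refl (Pos# y) d (Neg# y))))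
        2d≤slack : d ℕ.+ d ℕ.≤ slack s y
        2d≤slack = ℕ.+-cancelˡ-≤ (Pos# y ℕ.+ Neg# y) (d ℕ.+ d) (slack s y)
          (subst₂ ℕ._≤_
            (trans (cong₂ ℕ._+_ Pos≡ (sym Neg≡)) (solve 3 (λ p d n → n :+ d :+ (p :+ d) := p :+ n :+ (d :+ d)) refl (Pos# y) d (Neg# y)))
            (sym (ℕ.m+[n∸m]≡n y≤s)) x≤s)

    points : List (Vec ℤ (suc a ℕ.+ n))
    points = concatMap (λ y → map (_++ y) (fibre y)) (ball n s)

    ∈-points⁺ : ∀ x y → Balanced s x y → x ++ y ∈ points
    ∈-points⁺ x y b@(_ , _ , y≤s) = ∈-concatMap⁺ (λ y → map (_++ y) (fibre y))
      (lose (∈-ball⁺ n s y y≤s) (∈-map⁺ (_++ y) (fibre⁺ x y b)))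

    ∈-points⁻ : ∀ x y → x ++ y ∈ points → Balanced s x y
    ∈-points⁻ x y h =
      let y′ , y′∈ , z∈ = find (∈-concatMap⁻ (λ y → map (_++ y) (fibre y)) {xs = ball n s} h)
          x′ , x′∈ , e = ∈-map⁻ (_++ y′) z∈
      in step x′∈ (∈-ball⁻ n s y′∈) (Vec.++-injectiveˡ x x′ e) (Vec.++-injectiveʳ x x′ e)
      where
      step : ∀ {x′ y′} → x′ ∈ fibre y′ → Pos# y′ ℕ.+ Neg# y′ ℕ.≤ s → x ≡ x′ → y ≡ y′ → Balanced s x y
      step x∈ y≤s refl refl = fibre⁻ {x} {y} y≤s x∈

    unique-points : Unique points
    unique-points = unique-concatMap (λ y → map (_++ y) (fibre y)) (ball n s) (unique-ball n s)
      (λ y → Unique.map⁺ (λ {x} {x′} → Vec.++-injectiveˡ x x′) (unique-slice a _ _))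
      λ {y} {y′} h h′ → same y y′ (∈-map⁻ (_++ y) h) (∈-map⁻ (_++ y′) h′)
      where
      same : ∀ y y′ {z : Vec ℤ (suc a ℕ.+ n)} → ∃[ x ] x ∈ fibre y × z ≡ x ++ y → ∃[ x ] x ∈ fibre y′ × z ≡ x ++ y′ → y ≡ y′
      same y y′ (x , _ , refl) (x′ , _ , e) = Vec.++-injectiveʳ x x′ e

    length-points : + length points ≡ sumL (λ y → + length (fibre y)) (ball n s)
    length-points = trans (length-concatMap (λ y → map (_++ y) (fibre y)) (ball n s))
      (sumL-cong (ball n s) λ y _ → cong +_ (List.length-map (_++ y) (fibre y)))

  private
    half-even : ∀ k → + ⌊ k /2⌋ + + ⌊ k /2⌋ + 1ℤ ≡ + k + ev k
    half-even zero          = refl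
    half-even (suc zero)    = refl
    half-even (suc (suc k)) = trans
      (solve 1 (λ h → (con 1ℤ :+ h) :+ (con 1ℤ :+ h) :+ con 1ℤ := con (+ 2) :+ (h :+ h :+ con 1ℤ)) refl (+ ⌊ k /2⌋))
      (trans (cong (λ t → + 2 + t) (half-even k))
        (solve 2 (λ k e → con (+ 2) :+ (k :+ e) := (con (+ 2) :+ k) :+ (con 1ℤ :- (con 1ℤ :- e))) refl (+ k) (ev k)))
      where open ℤ-Solver.+-*-Solver

    ev-idem : ∀ k → ev k * ev k ≡ ev k
    ev-idem zero    = refl
    ev-idem (suc k) = trans (solve 1 (λ e → (con 1ℤ :- e) :* (con 1ℤ :- e) := con 1ℤ :- e :- e :+ e :* e) refl (ev k))
      (trans (cong (λ t → 1ℤ - ev k - ev k + t) (ev-idem k)) (solve 1 (λ e → con 1ℤ :- e :- e :+ e := con 1ℤ :- e) refl (ev k)))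
      where open ℤ-Solver.+-*-Solver

    fibre-size : ∀ {n} s (y : Vec ℤ n) → Pos# y ℕ.+ Neg# y ℕ.≤ s → ∀ (let k = ⌊ slack s y /2⌋) →
      + (Neg# y ℕ.+ k) + + (Pos# y ℕ.+ k) ≡ + s + ev (slack s y) - 1ℤ
    fibre-size s y y≤s =
      trans (solve 3 (λ a b k → (b :+ k) :+ (a :+ k) := a :+ b :+ (k :+ k :+ con 1ℤ) :- con 1ℤ) refl
          (+ Pos# y) (+ Neg# y) (+ ⌊ slack s y /2⌋))
        (trans (cong (λ t → + Pos# y + + Neg# y + t - 1ℤ) (half-even (slack s y)))
          (trans (cong (_- 1ℤ) (sym (ℤ.+-assoc (+ Pos# y + + Neg# y) (+ slack s y) (ev (slack s y)))))
            (cong (λ t → + t + ev (slack s y) - 1ℤ) (ℕ.m+[n∸m]≡n y≤s))))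
      where open ℤ-Solver.+-*-Solver

  -- A fibre has `1 + p + m` points, where `p + m = s - 1 + ev (slack s y)`, so its size depends on
  -- `y` through a parity alone.
  count₂ : ∀ n s → + length (points 1 {n} s) ≡ + s * D n s + E n s
  count₂ n s = trans (length-points 1 {n} s) (trans
    (sumL-cong (ball n s) λ y y∈ → trans (slice₂-length (Neg# y ℕ.+ half 1 s y) (Pos# y ℕ.+ half 1 s y))
      (trans (cong (λ t → 1ℤ + t) (fibre-size s y (∈-ball⁻ n s y∈)))
        (solve 2 (λ s e → con 1ℤ :+ (s :+ e :- con 1ℤ) := s :* con 1ℤ :+ e) refl (+ s) (ev (slack s y)))))
    (trans (sumL-+ (λ _ → + s * 1ℤ) (λ y → ev (slack s y)) (ball n s))
      (cong₂ _+_ (trans (sumL-* (+ s) (λ _ → 1ℤ) (ball n s)) (cong (+ s *_) (ball-count n s))) (ball-even n s))))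
    where open ℤ-Solver.+-*-Solver

  -- With `t = p + m`, adding `(p - m)²` to four times the size of a fibre gives `3 t² + 6 t + 4`.
  -- Since `p - m` is minus the total of `y`, the added squares sum to `Z`. As `ev` is idempotent,
  -- the result is linear in it.
  count₃ : ∀ n s → + 4 * + length (points 2 {n} s) + Z n s ≡
    (+ 3 * (+ s * + s) + 1ℤ) * D n s + (+ 6 * + s + + 3) * E n s
  count₃ n s = trans (cong₂ _+_
      (trans (cong (+ 4 *_) (length-points 2 {n} s)) (sym (sumL-* (+ 4) (λ y → + length (fibre 2 s y)) (ball n s))))
      (sym (ball-squares n s)))
    (trans (sym (sumL-+ (λ y → + 4 * + length (fibre 2 s y)) square-total (ball n s)))
    (trans (sumL-cong (ball n s) pointwise)
    (trans (sumL-+ (λ _ → c₁ * 1ℤ) (λ y → c₂ * ev (slack s y)) (ball n s))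
      (cong₂ _+_
        (trans (sumL-* c₁ (λ _ → 1ℤ) (ball n s)) (cong (c₁ *_) (ball-count n s)))
        (trans (sumL-* c₂ (λ y → ev (slack s y)) (ball n s)) (cong (c₂ *_) (ball-even n s)))))))
    where
    open ℤ-Solver.+-*-Solver
    c₁ c₂ : ℤ
    c₁ = + 3 * (+ s * + s) + 1ℤ
    c₂ = + 6 * + s + + 3
    pointwise : ∀ y → y ∈ ball n s → + 4 * + length (fibre 2 s y) + square-total y ≡ c₁ * 1ℤ + c₂ * ev (slack s y)
    pointwise y y∈ = trans
      (cong₂ (λ l t → l + t * t)
        (trans (ℤ.*-assoc (+ 2) (+ 2) (+ length (fibre 2 s y))) (cong (+ 2 *_) (slice₃-length (Neg# y ℕ.+ h) (Pos# y ℕ.+ h))))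
        (total≡ y))
      (trans (solve 3 (λ a b h → let p = b :+ h ; m = a :+ h ; t = p :+ m in
          con (+ 2) :* (p :* p :+ m :* m :+ con (+ 4) :* (p :* m) :+ con (+ 3) :* p :+ con (+ 3) :* m :+ con (+ 2)) :+ (a :- b) :* (a :- b)
          := con (+ 3) :* (t :* t) :+ con (+ 6) :* t :+ con (+ 4)) refl (+ Pos# y) (+ Neg# y) (+ h))
        (trans (cong (λ t → + 3 * (t * t) + + 6 * t + + 4) (fibre-size s y (∈-ball⁻ n s y∈)))
          (trans (solve 2 (λ s e → let t = s :+ e :- con 1ℤ in
              con (+ 3) :* (t :* t) :+ con (+ 6) :* t :+ con (+ 4)
              := (con (+ 3) :* (s :* s) :+ con 1ℤ) :* con 1ℤ :+ con (+ 6) :* s :* e :+ con (+ 3) :* (e :* e)) refl (+ s) (ev (slack s y)))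
            (trans (cong (λ t → c₁ * 1ℤ + + 6 * + s * ev (slack s y) + + 3 * t) (ev-idem (slack s y)))
              (solve 3 (λ c s e → c :+ con (+ 6) :* s :* e :+ con (+ 3) :* e := c :+ (con (+ 6) :* s :+ con (+ 3)) :* e) refl
                (c₁ * 1ℤ) (+ s) (ev (slack s y)))))))
      where h = half 2 s y

-- Linear functionals on dilated symmetric edge polytopes

module Functionals where
  open Reals
  open Expressions
  open import Data.Fin.Base using (Fin; zero; suc)
  open import Data.List.Base using ([]; _∷_)
  open import Data.Vec.Base using (Vec; []; _∷_; lookup)
  import Algebra.Properties.CommutativeMonoid.Sum as MonoidSum
  import Algebra.Properties.Semiring.Sum as SemiringSum

  private
    module ℝR = CommutativeRing ℝ-ring
    module ∑M = MonoidSum ℝR.+-commutativeMonoid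
    module ∑S = SemiringSum ℝR.semiring

  fromℤ≋ι : ∀ i → fromℤ i ≋ fromℚ (ι i)
  fromℤ≋ι i = ≋-pointwise λ _ → /1≡ι i

  record NonNeg (x : ℝ) : Set where
    constructor mkNonNeg
    field un : 0ʳ ≤ʳ x

  module _ where
    open ℚ-Solver.+-*-Solver

    nonNeg-0 : NonNeg 0ʳ
    nonNeg-0 = mkNonNeg λ ε ε>0 → 0 , λ _ _ → subst (0ℚ ℚ.<_) (sym (ℚ.+-identityˡ ε)) ε>0

    nonNeg-+ : ∀ {x y} → NonNeg x → NonNeg y → NonNeg (x +ʳ y)
    nonNeg-+ {x} {y} (mkNonNeg h) (mkNonNeg k) = mkNonNeg λ ε ε>0 → eventually-zip
      (λ n p q → subst (0ℚ ℚ.<_)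
        (trans (solve 3 (λ x y e → (x :+ e) :+ (y :+ e) := (x :+ y) :+ (e :+ e)) refl (seq x n) (seq y n) (½ ℚ.* ε))
          (cong (seq x n ℚ.+ seq y n ℚ.+_) (½+½≡ ε)))
        (ℚ.+-mono-< p q))
      (h _ (0<½* ε>0)) (k _ (0<½* ε>0))

    nonNeg-resp : ∀ {x y} → x ≋ y → NonNeg x → NonNeg y
    nonNeg-resp {x} {y} (mk≋ e) (mkNonNeg h) = mkNonNeg λ ε ε>0 → eventually-zip
      (λ n p q → subst (0ℚ ℚ.<_)
        (trans (solve 3 (λ x y e → (x :+ e) :+ (e :- (x :- y)) := y :+ (e :+ e)) refl (seq x n) (seq y n) (½ ℚ.* ε))
          (cong (seq y n ℚ.+_) (½+½≡ ε)))
        (ℚ.+-mono-< p (0<q-p (ℚ.≤-<-trans (p≤∣p∣ (seq x n ℚ.- seq y n)) q))))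
      (h _ (0<½* ε>0)) (e _ (0<½* ε>0))

    nonNeg-scale : ∀ {x q} → NonNeg x → 0ℚ ℚ.≤ q → NonNeg (x *ʳ fromℚ q)
    nonNeg-scale {x} {q} (mkNonNeg h) q≥0 = mkNonNeg λ ε ε>0 →
      let δ , δ>0 , e = divide q+1>0 ε>0 in eventually-map
        (λ n p → subst (0ℚ ℚ.<_)
          (trans (solve 3 (λ x q d → q :* (x :+ d) :+ d := x :* q :+ (q :+ con 1ℚ) :* d) refl (seq x n) q δ)
            (cong (seq x n ℚ.* q ℚ.+_) e))
          (ℚ.+-mono-≤-< (0≤* q≥0 (ℚ.<⇒≤ p)) δ>0))
        (h δ δ>0)
      where
      q+1>0 : 0ℚ ℚ.< q ℚ.+ 1ℚ
      q+1>0 = ℚ.+-mono-≤-< q≥0 0<1ℚ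

  nonNeg-∑ : ∀ {k} (x : Fin k → ℝ) → (∀ i → NonNeg (x i)) → NonNeg (∑ x)
  nonNeg-∑ {zero}  x h = nonNeg-0
  nonNeg-∑ {suc k} x h = nonNeg-+ (h zero) (nonNeg-∑ (x ∘ suc) (h ∘ suc))

  dot : ∀ {N} → Vec ℤ N → Vec ℤ N → ℤ
  dot []       []       = ℤ.0ℤ
  dot (e ∷ es) (x ∷ xs) = e ℤ.* x ℤ.+ dot es xs

  ∑-basis : ∀ {N} (f : Fin N → ℝ) v → ∑ (λ u → f u *ʳ basis v u) ≋ f v
  ∑-basis {suc N} f zero = ≋-trans
    (+ʳ-cong (ℝR.*-identityʳ (f zero)) (zeros (f ∘ suc)))
    (ℝR.+-identityʳ (f zero))
    where
    zeros : ∀ {N} (g : Fin N → ℝ) → ∑ (λ u → g u *ʳ 0ʳ) ≋ 0ʳ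
    zeros {zero}  g = ≋-refl
    zeros {suc N} g = ≋-trans (+ʳ-cong (ℝR.zeroʳ (g zero)) (zeros (g ∘ suc))) (ℝR.+-identityˡ 0ʳ)
  ∑-basis {suc N} f (suc v) = ≋-trans (+ʳ-cong (ℝR.zeroʳ (f zero)) (∑-basis (f ∘ suc) v)) (ℝR.+-identityˡ _)

  ∑-dot : ∀ {N} (ε u : Vec ℤ N) → ∑ (λ v → fromℤ (lookup ε v) *ʳ fromℤ (lookup u v)) ≋ fromℚ (ι (dot ε u))
  ∑-dot []       []       = ≋-pointwise λ _ → sym ι-0
  ∑-dot (e ∷ ε) (x ∷ u) = ≋-trans
    (+ʳ-cong (*ʳ-cong (fromℤ≋ι e) (fromℤ≋ι x)) (∑-dot ε u))
    (≋-pointwise λ _ → sym (trans (ι-+ (e ℤ.* x) (dot ε u)) (cong (ℚ._+ ι (dot ε u)) (ι-* e x))))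

  module _ (G : SimpleGraph) (ε : Vec ℤ (SimpleGraph.order G)) (M : ℤ)
    (bounded : ∀ v w → SimpleGraph.Adj G v w → lookup ε v ℤ.- lookup ε w ℤ.≤ M) where
    open SimpleGraph G

    Λ : (Fin order → ℝ) → ℝ
    Λ x = ∑ λ v → fromℤ (lookup ε v) *ʳ x v

    M-Λ : (Fin order → ℝ) → ℝ
    M-Λ x = fromℚ (ι M) -ʳ Λ x

    Λ-cong : ∀ {x y} → (∀ v → x v ≋ y v) → Λ x ≋ Λ y
    Λ-cong h = ∑M.sum-cong-≋ λ v → *ʳ-cong ≋-refl (h v)

    -- Exhibiting the value as a rational puts its product with a real weight within reach of
    -- `nonNeg-scale`.
    edge-value : ∀ {x} → EdgeVector G x → ∃[ q ] 0ℚ ℚ.≤ q × M-Λ x ≋ fromℚ q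
    edge-value {x} (v , w , vw , h) = ι (M ℤ.- (lookup ε v ℤ.- lookup ε w))
      , subst (ℚ._≤ ι (M ℤ.- (lookup ε v ℤ.- lookup ε w))) ι-0 (ι-mono-≤ (ℤ.i≤j⇒0≤j-i (bounded v w vw)))
      , ≋-trans (+ʳ-cong ≋-refl (-ʳ-cong (≋-trans (Λ-cong λ u → mk≋ (h u)) (≋-trans split (+ʳ-cong (single v) (-ʳ-cong (single w)))))))
          (≋-pointwise λ _ → sym (trans (ι-- M (lookup ε v ℤ.- lookup ε w)) (cong (λ t → ι M ℚ.- t) (ι-- (lookup ε v) (lookup ε w)))))
      where
      ι-- : ∀ i j → ι (i ℤ.- j) ≡ ι i ℚ.- ι j
      ι-- i j = trans (ι-+ i (ℤ.- j)) (cong (ι i ℚ.+_) (ι-neg j))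
      e : Fin order → ℝ
      e u = fromℤ (lookup ε u)
      single : ∀ v → ∑ (λ u → e u *ʳ basis v u) ≋ fromℚ (ι (lookup ε v))
      single v = ≋-trans (∑-basis e v) (fromℤ≋ι (lookup ε v))
      split : ∑ (λ u → e u *ʳ (basis v u -ʳ basis w u)) ≋ ∑ (λ u → e u *ʳ basis v u) -ʳ ∑ (λ u → e u *ʳ basis w u)
      split = ≋-trans (≋-trans
          (∑M.sum-cong-≋ λ u → ≋-trans (ℝR.distribˡ (e u) (basis v u) (-ʳ basis w u))
            (+ʳ-cong ≋-refl (≋-pointwise λ n →
              solve 2 (λ a b → a :* (:- b) := con (ℚ.- 1ℚ) :* (a :* b)) refl (seq (e u) n) (seq (basis w u) n))))
          (∑M.∑-distrib-+ (λ u → e u *ʳ basis v u) (λ u → fromℚ (ℚ.- 1ℚ) *ʳ (e u *ʳ basis w u))))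
        (+ʳ-cong ≋-refl (≋-trans (≋-sym (∑S.*-distribˡ-sum (fromℚ (ℚ.- 1ℚ)) (λ u → e u *ʳ basis w u)))
          (≋-pointwise λ n → solve 1 (λ a → con (ℚ.- 1ℚ) :* a := :- a) refl (seq (∑ λ u → e u *ʳ basis w u) n))))
        where open ℚ-Solver.+-*-Solver

    -- The weights sum to 1, so the affine function `M - Λ` takes at `y` the weighted sum of its
    -- values at the edge vectors.
    hull-value : ∀ {y} → ConvexHull (EdgeVector G) y → NonNeg (M-Λ y)
    hull-value {y} (k , c , p , edges , c≥0 , ∑c , y≈) = nonNeg-resp value
      (nonNeg-∑ (λ i → c i *ʳ M-Λ (p i)) λ i →
        let q , q≥0 , e = edge-value (edges i)
        in nonNeg-resp (*ʳ-cong ≋-refl (≋-sym e)) (nonNeg-scale (mkNonNeg (c≥0 i)) q≥0))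
      where
      m : ℝ
      m = fromℚ (ι M)
      open ℚ-Solver.+-*-Solver
      Λy : Λ y ≋ ∑ (λ i → c i *ʳ Λ (p i))
      Λy = ≋-trans (Λ-cong λ v → mk≋ (y≈ v))
        (≋-trans (∑M.sum-cong-≋ λ v → ≋-trans
            (∑S.*-distribˡ-sum (fromℤ (lookup ε v)) (λ i → c i *ʳ p i v))
            (∑M.sum-cong-≋ λ i → ≋-pointwise λ n →
              solve 3 (λ e c p → e :* (c :* p) := c :* (e :* p)) refl (seq (fromℤ (lookup ε v)) n) (seq (c i) n) (seq (p i v) n)))
          (≋-trans (∑M.∑-comm (λ v i → c i *ʳ (fromℤ (lookup ε v) *ʳ p i v)))
            (∑M.sum-cong-≋ λ i → ≋-sym (∑S.*-distribˡ-sum (c i) (λ v → fromℤ (lookup ε v) *ʳ p i v)))))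
      value : ∑ (λ i → c i *ʳ M-Λ (p i)) ≋ M-Λ y
      value = ≋-trans (∑M.sum-cong-≋ λ i → ≋-pointwise λ n →
          solve 3 (λ c m l → c :* (m :- l) := m :* c :+ con (ℚ.- 1ℚ) :* (c :* l)) refl (seq (c i) n) (ι M) (seq (Λ (p i)) n))
        (≋-trans (∑M.∑-distrib-+ (λ i → m *ʳ c i) (λ i → fromℚ (ℚ.- 1ℚ) *ʳ (c i *ʳ Λ (p i))))
          (+ʳ-cong
            (≋-trans (≋-sym (∑S.*-distribˡ-sum m c)) (≋-trans (*ʳ-cong ≋-refl (mk≋ ∑c)) (ℝR.*-identityʳ m)))
            (≋-trans (≋-sym (∑S.*-distribˡ-sum (fromℚ (ℚ.- 1ℚ)) (λ i → c i *ʳ Λ (p i))))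
              (≋-trans (*ʳ-cong ≋-refl (≋-sym Λy))
                (≋-pointwise λ n → solve 1 (λ a → con (ℚ.- 1ℚ) :* a := :- a) refl (seq (Λ y) n))))))

    functional-bound : ∀ s u → LatticePoint (Dilate s (SymmetricEdgePolytope G)) u → dot ε u ℤ.≤ + s ℤ.* M
    functional-bound s u (y , hy , u≈) = ι-cancel-≤ (p≤q⇐0≤q-p (fromℚ-cancel-≤ (NonNeg.un
      (nonNeg-resp scaled (nonNeg-scale (hull-value hy) (ι-nonNeg s))))))
      where
      open ℚ-Solver.+-*-Solver
      Λu : Λ y *ʳ fromℚ (ι (+ s)) ≋ fromℚ (ι (dot ε u))
      Λu = ≋-trans (≋-trans (∑S.*-distribʳ-sum (fromℚ (ι (+ s))) (λ v → fromℤ (lookup ε v) *ʳ y v))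
          (∑M.sum-cong-≋ λ v → ≋-trans
            (≋-pointwise λ n → solve 3 (λ e y s → e :* y :* s := e :* (s :* y)) refl (seq (fromℤ (lookup ε v)) n) (seq (y v) n) (ι (+ s)))
            (*ʳ-cong ≋-refl (≋-trans (*ʳ-cong (≋-sym (fromℤ≋ι (+ s))) (≋-refl {y v})) (≋-sym (mk≋ (u≈ v)))))))
        (∑-dot ε u)
      scaled : M-Λ y *ʳ fromℚ (ι (+ s)) ≋ fromℚ (ι (+ s ℤ.* M) ℚ.- ι (dot ε u))
      scaled = ≋-trans {y = fromℚ (ι (+ s)) *ʳ fromℚ (ι M) -ʳ Λ y *ʳ fromℚ (ι (+ s))}
        (≋-pointwise λ n → solve 3 (λ m l s → (m :- l) :* s := s :* m :- l :* s) refl (ι M) (seq (Λ y) n) (ι (+ s)))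
        (≋-trans {y = fromℚ (ι (+ s ℤ.* M)) -ʳ fromℚ (ι (dot ε u))}
          (+ʳ-cong (≋-pointwise λ _ → sym (ι-* (+ s) M)) (-ʳ-cong Λu)) (≋-pointwise λ _ → refl))

-- Lattice points of the dilates for complete bipartite graphs

module EdgePolytope where
  open Reals
  open Expressions
  open Balls
  open LatticeCount
  open Functionals
  open import Data.Bool.Base using (true; false; if_then_else_)
  open import Data.Fin.Base as Fin using (Fin; zero; suc; splitAt; _↑ˡ_; _↑ʳ_)
  import Data.Fin.Properties as Fin
  open import Data.List.Base as List using (List; []; _∷_; length)
  open import Data.Vec.Base as Vec using (Vec; []; _∷_; _++_; lookup; replicate)
  import Data.Vec.Properties as Vec
  open import Data.Unit.Base using (tt)
  open import Relation.Nullary.Decidable.Core using (does)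
  import Algebra.Properties.Semiring.Sum as SemiringSum
  import Algebra.Properties.CommutativeMonoid.Sum as MonoidSum

  private
    module ℝR = CommutativeRing ℝ-ring
    module ∑M = MonoidSum ℝR.+-commutativeMonoid
    module ∑S = SemiringSum ℝR.semiring

  module _ (a b : ℕ) where
    open SimpleGraph (K a b) using (Adj)

    adj-sides : ∀ v w → Adj v w →
      (∃[ i ] ∃[ j ] splitAt a v ≡ inj₁ i × splitAt a w ≡ inj₂ j) ⊎
      (∃[ i ] ∃[ j ] splitAt a v ≡ inj₂ i × splitAt a w ≡ inj₁ j)
    adj-sides v w h with splitAt a v | splitAt a w
    ... | inj₁ i | inj₂ j = inj₁ (i , j , refl , refl)
    ... | inj₂ i | inj₁ j = inj₂ (i , j , refl , refl)

    adjˡʳ : ∀ i j → Adj (i ↑ˡ b) (a ↑ʳ j)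
    adjˡʳ i j rewrite Fin.splitAt-↑ˡ a i b | Fin.splitAt-↑ʳ a b j = tt

    adjʳˡ : ∀ i j → Adj (a ↑ʳ j) (i ↑ˡ b)
    adjʳˡ i j rewrite Fin.splitAt-↑ˡ a i b | Fin.splitAt-↑ʳ a b j = tt

    bounded-by-sides : ∀ (α : Vec ℤ a) (β : Vec ℤ b) M →
      (∀ i j → lookup α i ℤ.- lookup β j ℤ.≤ M) → (∀ i j → lookup β j ℤ.- lookup α i ℤ.≤ M) →
      ∀ v w → Adj v w → lookup (α ++ β) v ℤ.- lookup (α ++ β) w ℤ.≤ M
    bounded-by-sides α β M h k v w vw
      rewrite Vec.lookup-splitAt a α β v | Vec.lookup-splitAt a α β w with adj-sides v w vw
    ... | inj₁ (i , j , e , e′) rewrite e | e′ = h i j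
    ... | inj₂ (j , i , e , e′) rewrite e | e′ = k i j

  sign : ℤ → ℤ
  sign (+ zero)  = + 0
  sign (+ suc _) = + 1
  sign -[1+ _ ]  = ℤ.- + 1

  signs : ∀ {n} → Vec ℤ n → Vec ℤ n
  signs []       = []
  signs (x ∷ xs) = sign x ∷ signs xs

  private
    sign≤1 : ∀ x → sign x ℤ.- + 0 ℤ.≤ + 1
    sign≤1 (+ zero)  = ℤ.+≤+ ℕ.z≤n
    sign≤1 (+ suc _) = ℤ.≤-refl
    sign≤1 -[1+ _ ]  = ℤ.-≤+

    -sign≤1 : ∀ x → + 0 ℤ.- sign x ℤ.≤ + 1
    -sign≤1 (+ zero)  = ℤ.+≤+ ℕ.z≤n
    -sign≤1 (+ suc _) = ℤ.-≤+
    -sign≤1 -[1+ _ ]  = ℤ.≤-refl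

    lookup-signs : ∀ {n} (x : Vec ℤ n) i → lookup (signs x) i ≡ sign (lookup x i)
    lookup-signs (x ∷ xs) zero    = refl
    lookup-signs (x ∷ xs) (suc i) = lookup-signs xs i

    dot-signs : ∀ {n} (x : Vec ℤ n) → dot (signs x) x ≡ + (Pos# x ℕ.+ Neg# x)
    dot-signs []       = refl
    dot-signs (x ∷ xs) = trans (cong₂ ℤ._+_ (head x) (dot-signs xs))
      (cong +_ (solve 4 (λ a b c d → (a :+ b) :+ (c :+ d) := (a :+ c) :+ (b :+ d)) refl (pos x) (neg x) (Pos# xs) (Neg# xs)))
      where
      open ℕ-Solver.+-*-Solver
      head : ∀ x → sign x ℤ.* x ≡ + (pos x ℕ.+ neg x)
      head (+ zero)  = refl
      head (+ suc k) = trans (ℤ.*-identityˡ (+ suc k)) (cong +_ (sym (ℕ.+-identityʳ (suc k))))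
      head -[1+ k ]  = ℤ.-1*i≡-i -[1+ k ]

    dot-const : ∀ {n} c (x : Vec ℤ n) → dot (replicate n c) x ≡ c ℤ.* total x
    dot-const c []       = sym (ℤ.*-zeroʳ c)
    dot-const c (x ∷ xs) = trans (cong (λ t → c ℤ.* x ℤ.+ t) (dot-const c xs)) (sym (ℤ.*-distribˡ-+ c x (total xs)))

    dot-++ : ∀ {m n} (α x : Vec ℤ m) (β y : Vec ℤ n) → dot (α ++ β) (x ++ y) ≡ dot α x ℤ.+ dot β y
    dot-++ []      []      β y = sym (ℤ.+-identityˡ (dot β y))
    dot-++ (e ∷ α) (x ∷ xs) β y = trans (cong (λ t → e ℤ.* x ℤ.+ t) (dot-++ α xs β y))
      (sym (ℤ.+-assoc (e ℤ.* x) (dot α xs) (dot β y)))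

  module _ {a b : ℕ} (s : ℕ) (x : Vec ℤ a) (y : Vec ℤ b)
    (h : LatticePoint (Dilate s (SymmetricEdgePolytope (K a b))) (x ++ y)) where

    private
      side-bound : ∀ α β M → (∀ i j → lookup α i ℤ.- lookup β j ℤ.≤ M) → (∀ i j → lookup β j ℤ.- lookup α i ℤ.≤ M) →
                   dot α x ℤ.+ dot β y ℤ.≤ + s ℤ.* M
      side-bound α β M p q = subst (ℤ._≤ + s ℤ.* M) (dot-++ α x β y)
        (functional-bound (K a b) (α ++ β) M (bounded-by-sides a b α β M p q) s (x ++ y) h)

      -- A constant functional vanishes on every edge vector; `c = 1` and `c = -1` together force
      -- the total to be 0.
      constant-bound : ∀ c → c ℤ.* (total x ℤ.+ total y) ℤ.≤ + 0
      constant-bound c = subst₂ ℤ._≤_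
        (trans (cong₂ ℤ._+_ (dot-const c x) (dot-const c y)) (sym (ℤ.*-distribˡ-+ c (total x) (total y))))
        (ℤ.*-zeroʳ (+ s))
        (side-bound (replicate a c) (replicate b c) (+ 0)
          (λ i j → ℤ.≤-reflexive (trans (cong₂ ℤ._-_ (Vec.lookup-replicate i c) (Vec.lookup-replicate j c)) (ℤ.+-inverseʳ c)))
          (λ i j → ℤ.≤-reflexive (trans (cong₂ ℤ._-_ (Vec.lookup-replicate j c) (Vec.lookup-replicate i c)) (ℤ.+-inverseʳ c))))

      total≡0 : total x ℤ.+ total y ≡ + 0
      total≡0 = ℤ.≤-antisym
        (subst (ℤ._≤ + 0) (ℤ.*-identityˡ (total x ℤ.+ total y)) (constant-bound (+ 1)))
        (subst (+ 0 ℤ.≤_) (ℤ.neg-involutive (total x ℤ.+ total y))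
          (ℤ.neg-mono-≤ (subst (ℤ._≤ + 0) (ℤ.-1*i≡-i (total x ℤ.+ total y)) (constant-bound (ℤ.- + 1)))))

      balance : Pos# x ℕ.+ Pos# y ≡ Neg# x ℕ.+ Neg# y
      balance = ℤ.+-injective (ℤ.i-j≡0⇒i≡j (+ (Pos# x ℕ.+ Pos# y)) (+ (Neg# x ℕ.+ Neg# y))
        (trans (solve 4 (λ a b c d → (a :+ c) :- (b :+ d) := (a :- b) :+ (c :- d)) refl
            (+ Pos# x) (+ Neg# x) (+ Pos# y) (+ Neg# y))
          (trans (cong₂ ℤ._+_ (sym (total≡ x)) (sym (total≡ y))) total≡0)))
        where open ℤ-Solver.+-*-Solver

      0-replicate : ∀ {n} i → lookup (replicate n (+ 0)) i ≡ + 0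
      0-replicate i = Vec.lookup-replicate i (+ 0)

      -- Every edge joins the two sides, so the functional with the signs of `x` on one side and 0
      -- on the other is at most 1 on edge vectors; at the given point it equals the norm of `x`.
      x-norm : Pos# x ℕ.+ Neg# x ℕ.≤ s
      x-norm = ℤ.drop‿+≤+ (subst₂ ℤ._≤_
        (trans (cong₂ ℤ._+_ (dot-signs x) (dot-const (+ 0) y)) (ℤ.+-identityʳ _)) (ℤ.*-identityʳ (+ s))
        (side-bound (signs x) (replicate b (+ 0)) (+ 1)
          (λ i j → subst₂ (λ u v → u ℤ.- v ℤ.≤ + 1) (sym (lookup-signs x i)) (sym (0-replicate j)) (sign≤1 (lookup x i)))
          (λ i j → subst₂ (λ u v → v ℤ.- u ℤ.≤ + 1) (sym (lookup-signs x i)) (sym (0-replicate j)) (-sign≤1 (lookup x i)))))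

      y-norm : Pos# y ℕ.+ Neg# y ℕ.≤ s
      y-norm = ℤ.drop‿+≤+ (subst₂ ℤ._≤_
        (trans (cong₂ ℤ._+_ (dot-const (+ 0) x) (dot-signs y)) (ℤ.+-identityˡ _)) (ℤ.*-identityʳ (+ s))
        (side-bound (replicate a (+ 0)) (signs y) (+ 1)
          (λ i j → subst₂ (λ u v → v ℤ.- u ℤ.≤ + 1) (sym (lookup-signs y j)) (sym (0-replicate i)) (-sign≤1 (lookup y j)))
          (λ i j → subst₂ (λ u v → u ℤ.- v ℤ.≤ + 1) (sym (lookup-signs y j)) (sym (0-replicate i)) (sign≤1 (lookup y j)))))

    lattice⇒balanced : Balanced s x y
    lattice⇒balanced = balance , x-norm , y-norm

  δ : ∀ {N} → Fin N → Fin N → ℤ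
  δ v u = if does (v Fin.≟ u) then + 1 else + 0

  private
    δ-ˡˡ : ∀ {a} b (v i : Fin a) → δ (v ↑ˡ b) (i ↑ˡ b) ≡ δ v i
    δ-ˡˡ b zero    zero    = refl
    δ-ˡˡ b zero    (suc i) = refl
    δ-ˡˡ b (suc v) zero    = refl
    δ-ˡˡ b (suc v) (suc i) = δ-ˡˡ b v i

    δ-ˡʳ : ∀ {a b} (v : Fin a) (j : Fin b) → δ (v ↑ˡ b) (a ↑ʳ j) ≡ + 0
    δ-ˡʳ zero    j = refl
    δ-ˡʳ (suc v) j = δ-ˡʳ v j

    δ-ʳˡ : ∀ {a b} (w : Fin b) (i : Fin a) → δ (a ↑ʳ w) (i ↑ˡ b) ≡ + 0
    δ-ʳˡ w zero    = refl
    δ-ʳˡ w (suc i) = δ-ʳˡ w i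

    δ-ʳʳ : ∀ a {b} (w j : Fin b) → δ (a ↑ʳ w) (a ↑ʳ j) ≡ δ w j
    δ-ʳʳ zero    w j = refl
    δ-ʳʳ (suc a) w j = δ-ʳʳ a w j

    fin-sum : ∀ a {b} (P : Fin (a ℕ.+ b) → Set) → (∀ i → P (i ↑ˡ b)) → (∀ j → P (a ↑ʳ j)) → ∀ u → P u
    fin-sum zero    P l r u       = r u
    fin-sum (suc a) P l r zero    = l zero
    fin-sum (suc a) P l r (suc u) = fin-sum a (P ∘ suc) (l ∘ suc) r u

  Shift : ∀ {n} → ℤ → Vec ℤ n → Vec ℤ n → Set
  Shift c x x′ = ∃[ v ] ∀ u → lookup x u ≡ lookup x′ u ℤ.+ c ℤ.* δ v u

  private
    shift-head : ∀ {n} c {x x′} {xs : Vec ℤ n} → x ≡ x′ ℤ.+ c → Shift c (x ∷ xs) (x′ ∷ xs)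
    shift-head {n} c {x} {x′} {xs} e = zero , go
      where
      go : ∀ u → lookup (x ∷ xs) u ≡ lookup (x′ ∷ xs) u ℤ.+ c ℤ.* δ zero u
      go zero    = trans e (cong (λ t → x′ ℤ.+ t) (sym (ℤ.*-identityʳ c)))
      go (suc u) = sym (trans (cong (λ t → lookup xs u ℤ.+ t) (ℤ.*-zeroʳ c)) (ℤ.+-identityʳ (lookup xs u)))

    shift-tail : ∀ {n} c {x} {xs xs′ : Vec ℤ n} → Shift c xs xs′ → Shift c (x ∷ xs) (x ∷ xs′)
    shift-tail {n} c {x} {xs} {xs′} (v , h) = suc v , go
      where
      go : ∀ u → lookup (x ∷ xs) u ≡ lookup (x ∷ xs′) u ℤ.+ c ℤ.* δ (suc v) u
      go zero    = sym (trans (cong (λ t → x ℤ.+ t) (ℤ.*-zeroʳ c)) (ℤ.+-identityʳ x))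
      go (suc u) = h u

    lower : ∀ {n P} (x : Vec ℤ n) → Pos# x ≡ suc P → ∃[ x′ ] Shift (+ 1) x x′ × Pos# x′ ≡ P × Neg# x′ ≡ Neg# x
    lower (+ suc k ∷ xs) e = (+ k ∷ xs) , shift-head (+ 1) (ℤ.+-comm (+ 1) (+ k)) , ℕ.suc-injective e , refl
    lower (+ zero ∷ xs)  e = let xs′ , s , p , q = lower xs e in (+ 0 ∷ xs′) , shift-tail (+ 1) s , p , q
    lower (-[1+ k ] ∷ xs) e = let xs′ , s , p , q = lower xs e in
      (-[1+ k ] ∷ xs′) , shift-tail (+ 1) s , p , cong (λ t → suc k ℕ.+ t) q

    raise : ∀ {n M} (x : Vec ℤ n) → Neg# x ≡ suc M → ∃[ x′ ] Shift (ℤ.- + 1) x x′ × Pos# x′ ≡ Pos# x × Neg# x′ ≡ M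
    raise (-[1+ zero ] ∷ xs)  e = (+ 0 ∷ xs) , shift-head (ℤ.- + 1) refl , refl , ℕ.suc-injective e
    raise (-[1+ suc k ] ∷ xs) e = (-[1+ k ] ∷ xs) , shift-head (ℤ.- + 1) (cong (λ t → -[1+ suc t ]) (sym (ℕ.+-identityʳ k))) , refl , ℕ.suc-injective e
    raise (+ k ∷ xs) e = let xs′ , s , p , q = raise xs e in
      (+ k ∷ xs′) , shift-tail (ℤ.- + 1) s , cong (λ t → k ℕ.+ t) p , q

    -- Serves the case where one side is zero and the other has entries of both signs: a unit is
    -- parked on the zero side until a later step removes it.
    raise-zero : ∀ {n} (x : Vec ℤ (suc n)) → Pos# x ≡ 0 → Neg# x ≡ 0 → ∃[ x′ ] Shift (ℤ.- + 1) x x′ × Pos# x′ ≡ 1 × Neg# x′ ≡ 0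
    raise-zero (+ zero ∷ xs) p q = (+ 1 ∷ xs) , shift-head (ℤ.- + 1) refl , cong suc p , q

    lookup-zero : ∀ {n} (x : Vec ℤ n) → Pos# x ≡ 0 → Neg# x ≡ 0 → ∀ u → lookup x u ≡ + 0
    lookup-zero (+ zero ∷ xs) p q zero    = refl
    lookup-zero (+ zero ∷ xs) p q (suc u) = lookup-zero xs p q u

  module Flow (G : SimpleGraph) where
    open SimpleGraph G

    Edge : Set
    Edge = Σ[ v ∈ Fin order ] Σ[ w ∈ Fin order ] Adj v w

    edgeValue : Edge → Fin order → ℤ
    edgeValue (v , w , _) u = δ v u ℤ.- δ w u

    flows : List Edge → Fin order → ℤ
    flows []       u = + 0
    flows (e ∷ es) u = edgeValue e u ℤ.+ flows es u

  module _ (a′ b′ : ℕ) where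
    private
      a = suc a′
      b = suc b′
    open Flow (K a b)

    edgeˡʳ edgeʳˡ : Fin a → Fin b → Edge
    edgeˡʳ v w = v ↑ˡ b , a ↑ʳ w , adjˡʳ a b v w
    edgeʳˡ v w = a ↑ʳ w , v ↑ˡ b , adjʳˡ a b v w

    -- Doubling leaves room for idle steps, which add an edge and its reverse.
    Decomposed : ℕ → Vec ℤ a → Vec ℤ b → Set
    Decomposed s x y = ∃[ es ] length es ≡ s ℕ.+ s × ∀ u → + 2 ℤ.* lookup (x ++ y) u ≡ flows es u

    private
      add-twice : ∀ {s x y x′ y′} (e : Edge) → (∀ u → lookup (x ++ y) u ≡ lookup (x′ ++ y′) u ℤ.+ edgeValue e u) →
                  Decomposed s x′ y′ → Decomposed (suc s) x y
      add-twice {s} {x} {y} {x′} {y′} e h (es , l , f) = e ∷ e ∷ es , trans (cong (λ n → suc (suc n)) l) (cong suc (sym (ℕ.+-suc s s))) , λ u →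
        trans (cong (+ 2 ℤ.*_) (h u)) (trans
          (solve 2 (λ l e → con (+ 2) :* (l :+ e) := e :+ (e :+ con (+ 2) :* l)) refl (lookup (x′ ++ y′) u) (edgeValue e u))
          (cong (λ t → edgeValue e u ℤ.+ (edgeValue e u ℤ.+ t)) (f u)))
        where open ℤ-Solver.+-*-Solver

      stay : ∀ {s x y} → Decomposed s x y → Decomposed (suc s) x y
      stay {s} {x} {y} (es , l , f) = edgeˡʳ zero zero ∷ edgeʳˡ zero zero ∷ es ,
        trans (cong (λ n → suc (suc n)) l) (cong suc (sym (ℕ.+-suc s s))) , λ u →
        trans (f u) (solve 3 (λ p q f → f := (p :- q) :+ ((q :- p) :+ f)) refl (δ {a ℕ.+ b} (zero ↑ˡ b) u) (δ (a ↑ʳ zero) u) (flows es u))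
        where open ℤ-Solver.+-*-Solver

      toʳ : ∀ {s x y x′ y′} → Shift (+ 1) x x′ → Shift (ℤ.- + 1) y y′ → Decomposed s x′ y′ → Decomposed (suc s) x y
      toʳ {s} {x} {y} {x′} {y′} (v , h) (w , k) = add-twice {s} {x} {y} {x′} {y′} (edgeˡʳ v w)
        (fin-sum a _
          (λ i → trans (Vec.lookup-++ˡ x y i) (trans (h i) (cong₂ ℤ._+_ (sym (Vec.lookup-++ˡ x′ y′ i))
            (trans (ℤ.*-identityˡ (δ v i)) (trans (sym (ℤ.+-identityʳ (δ v i)))
              (cong₂ (λ p q → p ℤ.- q) (sym (δ-ˡˡ b v i)) (sym (δ-ʳˡ w i))))))))
          (λ j → trans (Vec.lookup-++ʳ x y j) (trans (k j) (cong₂ ℤ._+_ (sym (Vec.lookup-++ʳ x′ y′ j))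
            (trans (ℤ.-1*i≡-i (δ w j)) (trans (sym (ℤ.+-identityˡ (ℤ.- δ w j)))
              (cong₂ (λ p q → p ℤ.- q) (sym (δ-ˡʳ v j)) (sym (δ-ʳʳ a w j)))))))))

      toˡ : ∀ {s x y x′ y′} → Shift (ℤ.- + 1) x x′ → Shift (+ 1) y y′ → Decomposed s x′ y′ → Decomposed (suc s) x y
      toˡ {s} {x} {y} {x′} {y′} (v , h) (w , k) = add-twice {s} {x} {y} {x′} {y′} (edgeʳˡ v w)
        (fin-sum a _
          (λ i → trans (Vec.lookup-++ˡ x y i) (trans (h i) (cong₂ ℤ._+_ (sym (Vec.lookup-++ˡ x′ y′ i))
            (trans (ℤ.-1*i≡-i (δ v i)) (trans (sym (ℤ.+-identityˡ (ℤ.- δ v i)))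
              (cong₂ (λ p q → p ℤ.- q) (sym (δ-ʳˡ w i)) (sym (δ-ˡˡ b v i))))))))
          (λ j → trans (Vec.lookup-++ʳ x y j) (trans (k j) (cong₂ ℤ._+_ (sym (Vec.lookup-++ʳ x′ y′ j))
            (trans (ℤ.*-identityˡ (δ w j)) (trans (sym (ℤ.+-identityʳ (δ w j)))
              (cong₂ (λ p q → p ℤ.- q) (sym (δ-ʳʳ a w j)) (sym (δ-ˡʳ v j)))))))))

      m+suc≤ : ∀ {m n s} → m ℕ.+ suc n ℕ.≤ suc s → m ℕ.+ n ℕ.≤ s
      m+suc≤ {m} {n} {s} h = ℕ.s≤s⁻¹ (subst (ℕ._≤ suc s) (ℕ.+-suc m n) h)

    -- A positive entry on one side and a negative one on the other can be reduced by a single edge,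
    -- which lowers both norms. If there is no such pair, balance leaves two possibilities: one side
    -- is zero and the other has entries of both signs, or both sides are zero and the step is idle.
    balanced⇒decomposed : ∀ s (x : Vec ℤ a) (y : Vec ℤ b) → Balanced s x y → Decomposed s x y
    balanced⇒decomposed zero x y (_ , hx , hy) = [] , refl , fin-sum a _
      (λ i → cong (+ 2 ℤ.*_) (trans (Vec.lookup-++ˡ x y i)
        (lookup-zero x (ℕ.m+n≡0⇒m≡0 (Pos# x) (ℕ.n≤0⇒n≡0 hx)) (ℕ.m+n≡0⇒n≡0 (Pos# x) (ℕ.n≤0⇒n≡0 hx)) i)))
      (λ j → cong (+ 2 ℤ.*_) (trans (Vec.lookup-++ʳ x y j)
        (lookup-zero y (ℕ.m+n≡0⇒m≡0 (Pos# y) (ℕ.n≤0⇒n≡0 hy)) (ℕ.m+n≡0⇒n≡0 (Pos# y) (ℕ.n≤0⇒n≡0 hy)) j)))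
    balanced⇒decomposed (suc s) x y (e , hx , hy) = go (Pos# x) (Neg# x) (Pos# y) (Neg# y) refl refl refl refl e hx hy
      where
      recurse : ∀ x′ y′ {px nx py ny} → Pos# x′ ≡ px → Neg# x′ ≡ nx → Pos# y′ ≡ py → Neg# y′ ≡ ny →
        px ℕ.+ py ≡ nx ℕ.+ ny → px ℕ.+ nx ℕ.≤ s → py ℕ.+ ny ℕ.≤ s → Decomposed s x′ y′
      recurse x′ y′ refl refl refl refl e hx hy = balanced⇒decomposed s x′ y′ (e , hx , hy)
      go : ∀ px nx py ny → Pos# x ≡ px → Neg# x ≡ nx → Pos# y ≡ py → Neg# y ≡ ny →
        px ℕ.+ py ≡ nx ℕ.+ ny → px ℕ.+ nx ℕ.≤ suc s → py ℕ.+ ny ℕ.≤ suc s → Decomposed (suc s) x y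
      go (suc px) nx py (suc ny) epx enx epy eny e hx hy =
        let x′ , sx , p , q = lower x epx
            y′ , sy , r , t = raise y eny
        in toʳ {s} {x} {y} {x′} {y′} sx sy (recurse x′ y′ p (trans q enx) (trans r epy) t
             (ℕ.suc-injective (trans e (ℕ.+-suc nx ny))) (ℕ.s≤s⁻¹ hx) (m+suc≤ {py} hy))
      go px (suc nx) (suc py) ny epx enx epy eny e hx hy =
        let x′ , sx , p , q = raise x enx
            y′ , sy , r , t = lower y epy
        in toˡ {s} {x} {y} {x′} {y′} sx sy (recurse x′ y′ (trans p epx) q r (trans t eny)
             (ℕ.suc-injective (trans (sym (ℕ.+-suc px py)) e)) (m+suc≤ {px} hx) (ℕ.s≤s⁻¹ hy))
      -- The norm of `x` is at least 2 here, so `s ≥ 1`, and the unit placed into `y` respects the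
      -- bound that remains.
      go (suc px) (suc nx) zero zero epx enx epy eny e hx hy =
        let x′ , sx , p , q = lower x epx
            y′ , sy , r , t = raise-zero y epy eny
        in toʳ {s} {x} {y} {x′} {y′} sx sy (recurse x′ y′ p (trans q enx) r t
             (trans (ℕ.+-comm px 1) (trans (cong suc (ℕ.suc-injective (subst₂ _≡_ (ℕ.+-identityʳ (suc px)) (ℕ.+-identityʳ (suc nx)) e))) (sym (ℕ.+-identityʳ (suc nx)))))
             (ℕ.s≤s⁻¹ hx) (ℕ.≤-trans (ℕ.s≤s ℕ.z≤n) (subst (ℕ._≤ s) (ℕ.+-suc px nx) (ℕ.s≤s⁻¹ hx))))
      go zero zero (suc py) (suc ny) epx enx epy eny e hx hy =
        let x′ , sx , p , q = raise-zero x epx enx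
            y′ , sy , r , t = lower y epy
        in toˡ {s} {x} {y} {x′} {y′} sx sy (recurse x′ y′ p q r (trans t eny) e
             (ℕ.≤-trans (ℕ.s≤s ℕ.z≤n) (subst (ℕ._≤ s) (ℕ.+-suc py ny) (ℕ.s≤s⁻¹ hy))) (ℕ.s≤s⁻¹ hy))
      go zero zero zero zero epx enx epy eny e hx hy = stay {s} {x} {y} (recurse x y epx enx epy eny refl ℕ.z≤n ℕ.z≤n)
      go (suc px) zero zero zero _ _ _ _ ()
      go zero (suc nx) zero ny _ _ _ _ ()
      go zero zero (suc py) zero _ _ _ _ ()
      go zero zero zero (suc ny) _ _ _ _ ()

    private
      N = a ℕ.+ b

      edgeVector : Edge → Fin N → ℝ
      edgeVector (v , w , _) u = basis v u -ʳ basis w u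

      basis≋δ : ∀ v (u : Fin N) → basis v u ≋ fromℚ (ι (δ v u))
      basis≋δ v u with does (v Fin.≟ u)
      ... | true  = ≋-pointwise λ _ → sym ι-1
      ... | false = ≋-pointwise λ _ → sym ι-0

      edgeVector≋ : ∀ e u → edgeVector e u ≋ fromℚ (ι (edgeValue e u))
      edgeVector≋ (v , w , _) u = ≋-trans (+ʳ-cong (basis≋δ v u) (-ʳ-cong (basis≋δ w u)))
        (≋-pointwise λ _ → sym (trans (ι-+ (δ v u) (ℤ.- δ w u)) (cong (ι (δ v u) ℚ.+_) (ι-neg (δ w u)))))

      ∑-edges : ∀ es u → ∑ (λ i → edgeVector (List.lookup es i) u) ≋ fromℚ (ι (flows es u))
      ∑-edges []       u = ≋-pointwise λ _ → sym ι-0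
      ∑-edges (e ∷ es) u = ≋-trans (+ʳ-cong (edgeVector≋ e u) (∑-edges es u))
        (≋-pointwise λ _ → sym (ι-+ (edgeValue e u) (flows es u)))

      ∑-const : ∀ k h → ∑ {k} (λ _ → fromℚ h) ≋ fromℚ (ι (+ k) ℚ.* h)
      ∑-const zero    h = ≋-pointwise λ _ → sym (trans (cong (ℚ._* h) ι-0) (ℚ.*-zeroˡ h))
      ∑-const (suc k) h = ≋-trans (+ʳ-cong ≋-refl (∑-const k h)) (≋-pointwise λ _ →
        trans (solve 2 (λ h k → h :+ k :* h := (con 1ℚ :+ k) :* h) refl h (ι (+ k))) (cong (ℚ._* h) (sym (ι-suc k))))
        where open ℚ-Solver.+-*-Solver

    -- All `2 s + 2` edges get equal weight, and the 2 in its denominator cancels the doubling in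
    -- `Decomposed`. The dilation factor is a successor because an empty list of edges carries no
    -- convex combination.
    decomposed⇒lattice : ∀ s (x : Vec ℤ a) (y : Vec ℤ b) → Decomposed (suc s) x y → LatticePoint (Dilate (suc s) (SymmetricEdgePolytope (K a b))) (x ++ y)
    decomposed⇒lattice s x y (es , l , f) =
        (λ u → ∑ λ i → fromℚ h *ʳ edgeVector (List.lookup es i) u)
      , (length es , (λ _ → fromℚ h) , (λ i → edgeVector (List.lookup es i))
        , (λ i → let v , w , vw = List.lookup es i in v , w , vw , λ u → un≋ (≋-refl {edgeVector (List.lookup es i) u}))
        , (λ i → NonNeg.un {fromℚ h} (nonNeg-resp {1ʳ *ʳ fromℚ h} {fromℚ h} (≋-pointwise λ _ → ℚ.*-identityˡ h) (nonNeg-scale (⋖⇒NonNeg (pos-fromℚ 0<1ℚ)) (ℚ.<⇒≤ h>0))))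
        , un≋ {∑ {length es} (λ _ → fromℚ h)} {1ʳ} (≋-trans (∑-const (length es) h) (≋-pointwise λ _ → trans (cong (λ t → ι (+ t) ℚ.* h) l) 2sh≡1))
        , λ u → un≋ (≋-refl {∑ λ i → fromℚ h *ʳ edgeVector (List.lookup es i) u}))
      , λ u → un≋ (≋-trans (fromℤ≋ι (lookup (x ++ y) u)) (≋-sym (≋-trans
          (*ʳ-cong (fromℤ≋ι (+ suc s)) (≋-trans
            (≋-sym (∑S.*-distribˡ-sum (fromℚ h) (λ i → edgeVector (List.lookup es i) u)))
            (*ʳ-cong ≋-refl (∑-edges es u))))
          (≋-pointwise λ _ → value u))))
      where
      open ℚ-Solver.+-*-Solver
      ⋖⇒NonNeg : ∀ {x} → Pos x → NonNeg x
      ⋖⇒NonNeg {x} p = mkNonNeg (⋖⇒≤ʳ {0ʳ} {x} (pos-resp (≋-pointwise λ n → solve 1 (λ x → x := x :- con 0ℚ) refl (seq x n)) p))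
      2s = suc s ℕ.+ suc s
      inverse : ∃[ h ] 0ℚ ℚ.< h × ι (+ 2s) ℚ.* h ≡ 1ℚ
      inverse = divide (ι-pos (s ℕ.+ suc s)) 0<1ℚ
      h = proj₁ inverse
      h>0 : 0ℚ ℚ.< h
      h>0 = proj₁ (proj₂ inverse)
      2sh≡1 : ι (+ 2s) ℚ.* h ≡ 1ℚ
      2sh≡1 = proj₂ (proj₂ inverse)
      value : ∀ u → ι (+ suc s) ℚ.* (h ℚ.* ι (flows es u)) ≡ ι (lookup (x ++ y) u)
      value u = trans (cong (λ t → ι (+ suc s) ℚ.* (h ℚ.* t)) (trans (cong ι (sym (f u))) double))
        (trans (solve 3 (λ s h z → s :* (h :* (z :+ z)) := ((s :+ s) :* h) :* z) refl (ι (+ suc s)) h z)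
          (trans (cong (λ t → t ℚ.* h ℚ.* z) (sym (ι-+ (+ suc s) (+ suc s))))
            (trans (cong (ℚ._* z) 2sh≡1) (ℚ.*-identityˡ z))))
        where
        z = ι (lookup (x ++ y) u)
        double : ι (+ 2 ℤ.* lookup (x ++ y) u) ≡ z ℚ.+ z
        double = trans (cong ι (trans (ℤ.*-distribʳ-+ (lookup (x ++ y) u) (+ 1) (+ 1))
          (cong₂ ℤ._+_ (ℤ.*-identityˡ (lookup (x ++ y) u)) (ℤ.*-identityˡ (lookup (x ++ y) u)))))
          (ι-+ (lookup (x ++ y) u) (lookup (x ++ y) u))

    -- Dilation by 0 sends any point of the polytope to the origin; as both parts have a vertex, an
    -- edge vector can be that point.
    zero-lattice : ∀ (x : Vec ℤ a) (y : Vec ℤ b) → (∀ u → lookup (x ++ y) u ≡ + 0) → LatticePoint (Dilate 0 (SymmetricEdgePolytope (K a b))) (x ++ y)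
    zero-lattice x y h = (λ u → edgeVector e u)
      , (1 , (λ _ → 1ʳ) , (λ _ → edgeVector e) , (λ _ → proj₁ e , proj₁ (proj₂ e) , proj₂ (proj₂ e) , λ u → un≋ (≋-refl {edgeVector e u}))
        , (λ _ → ⋖⇒≤ʳ {0ʳ} {1ʳ} (pos-resp (≋-pointwise λ _ → refl) (pos-fromℚ 0<1ℚ)))
        , un≋ (≋-pointwise {1ʳ +ʳ 0ʳ} {1ʳ} λ _ → refl)
        , λ u → un≋ (≋-sym (≋-trans (ℝR.+-identityʳ (1ʳ *ʳ edgeVector e u)) (ℝR.*-identityˡ (edgeVector e u)))))
      , λ u → un≋ {fromℤ (lookup (x ++ y) u)} {fromℤ (+ 0) *ʳ edgeVector e u} (≋-trans (≋-pointwise λ _ → cong (ℚ._/ 1) (h u)) (≋-sym (ℝR.zeroˡ (edgeVector e u))))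
      where
      e : Edge
      e = edgeˡʳ zero zero

    balanced⇒lattice : ∀ s (x : Vec ℤ a) (y : Vec ℤ b) → Balanced s x y → LatticePoint (Dilate s (SymmetricEdgePolytope (K a b))) (x ++ y)
    balanced⇒lattice zero x y bal = zero-lattice x y λ u →
      let es , l , f = balanced⇒decomposed 0 x y bal in ℤ.*-cancelˡ-≡ (+ 2) _ (+ 0) (trans (f u) (empty es l u))
      where
      empty : ∀ es → length es ≡ 0 → ∀ u → flows es u ≡ + 0
      empty [] _ u = refl
    balanced⇒lattice (suc s) x y bal = decomposed⇒lattice s x y (balanced⇒decomposed (suc s) x y bal)

-- Complex numbers, and polynomials determined by their values at the naturals

module ComplexPolynomials where
  open Reals
  open Expressions
  open OrthogonalChain
  open import Data.Fin.Base using (toℕ)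
  open import Data.List.Base using ([]; _∷_; length)

  private module ℝR = CommutativeRing ℝ-ring

  infix 4 _≋ᶜ_

  record _≋ᶜ_ (z w : ℂ) : Set where
    constructor mk≋ᶜ
    field
      re≋ : re z ≋ re w
      im≋ : im z ≋ im w
  open _≋ᶜ_ public

  un≋ᶜ : ∀ {z w} → z ≋ᶜ w → z ≈ᶜ w
  un≋ᶜ (mk≋ᶜ (mk≋ h) (mk≋ k)) = h , k

  to≋ᶜ : ∀ {z w} → z ≈ᶜ w → z ≋ᶜ w
  to≋ᶜ (h , k) = mk≋ᶜ (mk≋ h) (mk≋ k)

  ≋ᶜ-pointwise : ∀ {z w} → (∀ n → seq (re z) n ≡ seq (re w) n) → (∀ n → seq (im z) n ≡ seq (im w) n) → z ≋ᶜ w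
  ≋ᶜ-pointwise h k = mk≋ᶜ (≋-pointwise h) (≋-pointwise k)

  ≋ᶜ-refl : ∀ {z} → z ≋ᶜ z
  ≋ᶜ-refl = mk≋ᶜ ≋-refl ≋-refl

  ≋ᶜ-sym : ∀ {z w} → z ≋ᶜ w → w ≋ᶜ z
  ≋ᶜ-sym (mk≋ᶜ h k) = mk≋ᶜ (≋-sym h) (≋-sym k)

  ≋ᶜ-trans : ∀ {x y z} → x ≋ᶜ y → y ≋ᶜ z → x ≋ᶜ z
  ≋ᶜ-trans (mk≋ᶜ h k) (mk≋ᶜ h′ k′) = mk≋ᶜ (≋-trans h h′) (≋-trans k k′)

  module _ where
    open ℚ-Solver.+-*-Solver

    ℂ-ring : CommutativeRing 0ℓ 0ℓ
    ℂ-ring = record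
      { Carrier = ℂ ; _≈_ = _≋ᶜ_ ; _+_ = _+ᶜ_ ; _*_ = _*ᶜ_ ; -_ = -ᶜ_ ; 0# = 0ᶜ ; 1# = 1ᶜ
      ; isCommutativeRing = record
        { isRing = record
          { +-isAbelianGroup = record
            { isGroup = record
              { isMonoid = record
                { isSemigroup = record
                  { isMagma = record
                    { isEquivalence = record { refl = ≋ᶜ-refl ; sym = ≋ᶜ-sym ; trans = ≋ᶜ-trans }
                    ; ∙-cong = λ { (mk≋ᶜ h k) (mk≋ᶜ h′ k′) → mk≋ᶜ (+ʳ-cong h h′) (+ʳ-cong k k′) } }
                  ; assoc = λ x y z → mk≋ᶜ (ℝR.+-assoc (re x) (re y) (re z)) (ℝR.+-assoc (im x) (im y) (im z)) }
                ; identity = (λ x → mk≋ᶜ (ℝR.+-identityˡ (re x)) (ℝR.+-identityˡ (im x)))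
                           , (λ x → mk≋ᶜ (ℝR.+-identityʳ (re x)) (ℝR.+-identityʳ (im x))) }
              ; inverse = (λ x → mk≋ᶜ (ℝR.-‿inverseˡ (re x)) (ℝR.-‿inverseˡ (im x)))
                        , (λ x → mk≋ᶜ (ℝR.-‿inverseʳ (re x)) (ℝR.-‿inverseʳ (im x)))
              ; ⁻¹-cong = λ { (mk≋ᶜ h k) → mk≋ᶜ (-ʳ-cong h) (-ʳ-cong k) } }
            ; comm = λ x y → mk≋ᶜ (ℝR.+-comm (re x) (re y)) (ℝR.+-comm (im x) (im y)) }
          ; *-cong = λ { (mk≋ᶜ h k) (mk≋ᶜ h′ k′) → mk≋ᶜ
              (+ʳ-cong (*ʳ-cong h h′) (-ʳ-cong (*ʳ-cong k k′))) (+ʳ-cong (*ʳ-cong h k′) (*ʳ-cong k h′)) }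
          ; *-assoc = λ x y z → ≋ᶜ-pointwise
              (λ n → solve 6 (λ a b c d e f → (a :* c :- b :* d) :* e :- (a :* d :+ b :* c) :* f
                  := a :* (c :* e :- d :* f) :- b :* (c :* f :+ d :* e)) refl
                (seq (re x) n) (seq (im x) n) (seq (re y) n) (seq (im y) n) (seq (re z) n) (seq (im z) n))
              (λ n → solve 6 (λ a b c d e f → (a :* c :- b :* d) :* f :+ (a :* d :+ b :* c) :* e
                  := a :* (c :* f :+ d :* e) :+ b :* (c :* e :- d :* f)) refl
                (seq (re x) n) (seq (im x) n) (seq (re y) n) (seq (im y) n) (seq (re z) n) (seq (im z) n))
          ; *-identity =
              (λ x → ≋ᶜ-pointwise
                (λ n → solve 2 (λ a b → con 1ℚ :* a :- con 0ℚ :* b := a) refl (seq (re x) n) (seq (im x) n))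
                (λ n → solve 2 (λ a b → con 1ℚ :* b :+ con 0ℚ :* a := b) refl (seq (re x) n) (seq (im x) n)))
            , (λ x → ≋ᶜ-pointwise
                (λ n → solve 2 (λ a b → a :* con 1ℚ :- b :* con 0ℚ := a) refl (seq (re x) n) (seq (im x) n))
                (λ n → solve 2 (λ a b → a :* con 0ℚ :+ b :* con 1ℚ := b) refl (seq (re x) n) (seq (im x) n)))
          ; distrib =
              (λ x y z → ≋ᶜ-pointwise
                (λ n → solve 6 (λ a b c d e f → a :* (c :+ e) :- b :* (d :+ f) := (a :* c :- b :* d) :+ (a :* e :- b :* f)) refl
                  (seq (re x) n) (seq (im x) n) (seq (re y) n) (seq (im y) n) (seq (re z) n) (seq (im z) n))
                (λ n → solve 6 (λ a b c d e f → a :* (d :+ f) :+ b :* (c :+ e) := (a :* d :+ b :* c) :+ (a :* f :+ b :* e)) refl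
                  (seq (re x) n) (seq (im x) n) (seq (re y) n) (seq (im y) n) (seq (re z) n) (seq (im z) n)))
            , (λ x y z → ≋ᶜ-pointwise
                (λ n → solve 6 (λ a b c d e f → (c :+ e) :* a :- (d :+ f) :* b := (c :* a :- d :* b) :+ (e :* a :- f :* b)) refl
                  (seq (re x) n) (seq (im x) n) (seq (re y) n) (seq (im y) n) (seq (re z) n) (seq (im z) n))
                (λ n → solve 6 (λ a b c d e f → (c :+ e) :* b :+ (d :+ f) :* a := (c :* b :+ d :* a) :+ (e :* b :+ f :* a)) refl
                  (seq (re x) n) (seq (im x) n) (seq (re y) n) (seq (im y) n) (seq (re z) n) (seq (im z) n))) }
        ; *-comm = λ x y → ≋ᶜ-pointwise
            (λ n → solve 4 (λ a b c d → a :* c :- b :* d := c :* a :- d :* b) refl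
              (seq (re x) n) (seq (im x) n) (seq (re y) n) (seq (im y) n))
            (λ n → solve 4 (λ a b c d → a :* d :+ b :* c := c :* b :+ d :* a) refl
              (seq (re x) n) (seq (im x) n) (seq (re y) n) (seq (im y) n)) } }

  module ℂR = CommutativeRing ℂ-ring
  private module ℂP = RingProperties ℂR.ring
  open PolynomialFunctions ℂ-ring public using (divide-step) renaming
    (prod to prodᶜ; prod-cong to prodᶜ-cong; prod-scale to prodᶜ-scale; IsPoly to IsPolyᶜ; factorization to factorizationᶜ; Cancellable to Cancellableᶜ)

  κ : ℚ → ℂ
  κ p = fromℝ (fromℚ p)

  open Eval ℂ-ring κ public renaming (⟦_⟧ to evalᶜ)
  module Degreeᶜ = Degree ℂ-ring κ

  module _ where
    open ℚ-Solver.+-*-Solver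

    evalᶜ-fromℝ : ∀ e t → evalᶜ e (fromℝ t) ≋ᶜ fromℝ (evalℝ e t)
    evalᶜ-fromℝ var     t = ≋ᶜ-refl
    evalᶜ-fromℝ (con q) t = ≋ᶜ-refl
    evalᶜ-fromℝ (e ⊕ f) t = ≋ᶜ-trans (ℂR.+-cong (evalᶜ-fromℝ e t) (evalᶜ-fromℝ f t))
      (mk≋ᶜ ≋-refl (≋-pointwise λ _ → refl))
    evalᶜ-fromℝ (e ⊗ f) t = ≋ᶜ-trans (ℂR.*-cong (evalᶜ-fromℝ e t) (evalᶜ-fromℝ f t))
      (≋ᶜ-pointwise
        (λ n → solve 2 (λ a b → a :* b :- con 0ℚ :* con 0ℚ := a :* b) refl (seq (evalℝ e t) n) (seq (evalℝ f t) n))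
        (λ n → solve 2 (λ a b → a :* con 0ℚ :+ con 0ℚ :* b := con 0ℚ) refl (seq (evalℝ e t) n) (seq (evalℝ f t) n)))

    ∣_∣² : ℂ → ℝ
    ∣ z ∣² = re z *ʳ re z +ʳ im z *ʳ im z

    ∣∣²≥0 : ∀ z n → 0ℚ ℚ.≤ seq ∣ z ∣² n
    ∣∣²≥0 z n = ℚ.+-mono-≤ (square≥0 (seq (re z) n)) (square≥0 (seq (im z) n))

    -- Multiplying `z w` by the conjugate of `z` gives `|z|² w`, whose real and imaginary parts can
    -- be cancelled in ℝ.
    cancellableᶜ : ∀ {z} → Pos ∣ z ∣² → Cancellableᶜ z
    cancellableᶜ {z} h w (mk≋ᶜ e f) = mk≋ᶜ
      (pos-cancel-0 h (≋-trans
        (≋-pointwise λ n → solve 4 (λ a b c d → (a :* a :+ b :* b) :* c := a :* (a :* c :- b :* d) :+ b :* (a :* d :+ b :* c)) refl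
          (seq (re z) n) (seq (im z) n) (seq (re w) n) (seq (im w) n))
        (vanish (re z) (im z) e f)))
      (pos-cancel-0 h (≋-trans
        (≋-pointwise λ n → solve 4 (λ a b c d → (a :* a :+ b :* b) :* d := a :* (a :* d :+ b :* c) :+ (:- b) :* (a :* c :- b :* d)) refl
          (seq (re z) n) (seq (im z) n) (seq (re w) n) (seq (im w) n))
        (vanish (re z) (-ʳ im z) f e)))
      where
      vanish : ∀ {u v} a b → u ≋ 0ʳ → v ≋ 0ʳ → a *ʳ u +ʳ b *ʳ v ≋ 0ʳ
      vanish a b h k = ≋-trans (+ʳ-cong (*ʳ-cong (≋-refl {a}) h) (*ʳ-cong (≋-refl {b}) k))
        (≋-trans (+ʳ-cong (ℝR.zeroʳ a) (ℝR.zeroʳ b)) (ℝR.+-identityʳ 0ʳ))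

    pos-square : ∀ {x} → Pos x → Pos (x *ʳ x)
    pos-square h = pos-* h h

    pos-square-neg : ∀ {x} → Pos (-ʳ x) → Pos (x *ʳ x)
    pos-square-neg {x} h = pos-resp (≋-pointwise λ n → solve 1 (λ x → :- x :* :- x := x :* x) refl (seq x n)) (pos-* h h)

    -- The squared modulus is multiplicative, so `|z|² |w|² = 1`, and `pos-cancelʳ` removes the
    -- nonnegative second factor.
    unit⇒≉0 : ∀ z w → z *ᶜ w ≋ᶜ 1ᶜ → Pos ∣ z ∣²
    unit⇒≉0 z w (mk≋ᶜ h k) = pos-cancelʳ {∣ z ∣²} {∣ w ∣²}
      (pos-resp (≋-sym (≋-trans
          (≋-pointwise λ n → solve 4 (λ a b c d → (a :* a :+ b :* b) :* (c :* c :+ d :* d)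
              := (a :* c :- b :* d) :* (a :* c :- b :* d) :+ (a :* d :+ b :* c) :* (a :* d :+ b :* c)) refl
            (seq (re z) n) (seq (im z) n) (seq (re w) n) (seq (im w) n))
          (+ʳ-cong (*ʳ-cong h h) (*ʳ-cong k k))))
        (pos-resp (≋-pointwise λ _ → refl) (pos-fromℚ 0<1ℚ)))
      (0 , λ n _ → ∣∣²≥0 w n)

    cancellable-fromℝ : ∀ {x y} → Pos (y -ʳ x) → Cancellableᶜ (ℂR._-_ (fromℝ y) (fromℝ x))
    cancellable-fromℝ {x} {y} h = cancellableᶜ (pos-+-nonNeg (pos-square h) λ _ → ℚ.≤-refl)

  module _ where
    open ℂR using (_-_; +-cong; *-cong; +-congˡ; +-congʳ; *-congˡ; *-congʳ)

    eval-scale : ∀ c p z → eval (scale c p) z ≋ᶜ c *ᶜ eval p z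
    eval-scale c []      z = ≋ᶜ-sym (ℂR.zeroʳ c)
    eval-scale c (a ∷ p) z = ≋ᶜ-trans (+-congˡ (*-congˡ (eval-scale c p z)))
      (solve 4 (λ c a z p → c :* a :+ z :* (c :* p) := c :* (a :+ z :* p)) ≋ᶜ-refl c a z (eval p z))
      where
      import Algebra.Solver.Ring.NaturalCoefficients.Default as NatSolver
      open NatSolver ℂR.commutativeSemiring

    eval-+ₚ : ∀ p q z → eval (p +ₚ q) z ≋ᶜ eval p z +ᶜ eval q z
    eval-+ₚ []      q       z = ≋ᶜ-sym (ℂR.+-identityˡ (eval q z))
    eval-+ₚ (a ∷ p) []      z = ≋ᶜ-sym (ℂR.+-identityʳ (eval (a ∷ p) z))
    eval-+ₚ (a ∷ p) (b ∷ q) z = ≋ᶜ-trans (+-congˡ (*-congˡ (eval-+ₚ p q z)))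
      (solve 5 (λ a b z p q → (a :+ b) :+ z :* (p :+ q) := (a :+ z :* p) :+ (b :+ z :* q)) ≋ᶜ-refl a b z (eval p z) (eval q z))
      where
      import Algebra.Solver.Ring.NaturalCoefficients.Default as NatSolver
      open NatSolver ℂR.commutativeSemiring

    eval-∏ : ∀ k (u : ℕ → ℂ) z → eval (∏[x-_] {k} (u ∘ toℕ)) z ≋ᶜ prodᶜ k (λ j → z - u j)
    eval-∏ zero    u z = ≋ᶜ-trans (+-congˡ (ℂR.zeroʳ z)) (ℂR.+-identityʳ 1ᶜ)
    eval-∏ (suc k) u z = ≋ᶜ-trans (eval-+ₚ (0ᶜ ∷ p) (scale (-ᶜ u 0) p) z)
      (≋ᶜ-trans (+-cong (ℂR.+-identityˡ (z *ᶜ eval p z)) (eval-scale (-ᶜ u 0) p z))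
        (≋ᶜ-trans (≋ᶜ-sym (ℂR.distribʳ (eval p z) z (-ᶜ u 0))) (*-congˡ (eval-∏ k (u ∘ suc) z))))
      where p = ∏[x-_] {k} (u ∘ suc ∘ toℕ)

    coeff-scale : ∀ c p k → coeff (scale c p) k ≋ᶜ c *ᶜ coeff p k
    coeff-scale c []      k       = ≋ᶜ-sym (ℂR.zeroʳ c)
    coeff-scale c (a ∷ p) zero    = ≋ᶜ-refl
    coeff-scale c (a ∷ p) (suc k) = coeff-scale c p k

    coeff-+ₚ : ∀ p q k → coeff (p +ₚ q) k ≋ᶜ coeff p k +ᶜ coeff q k
    coeff-+ₚ []      q       k       = ≋ᶜ-sym (ℂR.+-identityˡ (coeff q k))
    coeff-+ₚ (a ∷ p) []      k       = ≋ᶜ-sym (ℂR.+-identityʳ (coeff (a ∷ p) k))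
    coeff-+ₚ (a ∷ p) (b ∷ q) zero    = ≋ᶜ-refl
    coeff-+ₚ (a ∷ p) (b ∷ q) (suc k) = coeff-+ₚ p q k

    -- Synthetic division on coefficient lists. Its effect is recorded below in two ways: on values,
    -- to pass vanishing to the quotient, and on coefficients, to return from there.
    quotient : ℂ[x] → ℂ → ℂ[x]
    quotient []          r = []
    quotient (a ∷ [])    r = []
    quotient (a ∷ b ∷ p) r = eval (b ∷ p) r ∷ quotient (b ∷ p) r

    length-quotient : ∀ a p r → length (quotient (a ∷ p) r) ≡ length p
    length-quotient a []      r = refl
    length-quotient a (b ∷ p) r = cong suc (length-quotient b p r)

    eval-quotient : ∀ p r x → eval p x ≋ᶜ eval p r +ᶜ (x - r) *ᶜ eval (quotient p r) x
    eval-quotient []          r x = ≋ᶜ-sym (≋ᶜ-trans (+-congˡ (ℂR.zeroʳ (x - r))) (ℂR.+-identityʳ 0ᶜ))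
    eval-quotient (a ∷ [])    r x = ≋ᶜ-trans (+-congˡ (≋ᶜ-trans (ℂR.zeroʳ x) (≋ᶜ-sym (ℂR.zeroʳ r))))
      (≋ᶜ-sym (≋ᶜ-trans (+-congˡ (ℂR.zeroʳ (x - r))) (ℂR.+-identityʳ (a +ᶜ r *ᶜ 0ᶜ))))
    eval-quotient (a ∷ b ∷ p) r x = ≋ᶜ-trans (+-congˡ (*-congˡ (eval-quotient (b ∷ p) r x)))
      (divide-step a x r (eval (b ∷ p) r) (eval (quotient (b ∷ p) r) x))

    private
      absorb : ∀ a r v → a ≋ᶜ (a +ᶜ r *ᶜ v) +ᶜ (-ᶜ r) *ᶜ v
      absorb a r v = ≋ᶜ-sym (≋ᶜ-trans (ℂR.+-assoc a (r *ᶜ v) ((-ᶜ r) *ᶜ v))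
        (≋ᶜ-trans (+-congˡ (≋ᶜ-trans (≋ᶜ-sym (ℂR.distribʳ v r (-ᶜ r))) (≋ᶜ-trans (*-congʳ (ℂR.-‿inverseʳ r)) (ℂR.zeroˡ v))))
          (ℂR.+-identityʳ a)))

      zero-absorb : ∀ r → 0ᶜ ≋ᶜ 0ᶜ +ᶜ (-ᶜ r) *ᶜ 0ᶜ
      zero-absorb r = ≋ᶜ-sym (≋ᶜ-trans (+-congˡ (ℂR.zeroʳ (-ᶜ r))) (ℂR.+-identityʳ 0ᶜ))

    coeff-quotient-0 : ∀ p r → coeff p 0 ≋ᶜ eval p r +ᶜ (-ᶜ r) *ᶜ coeff (quotient p r) 0
    coeff-quotient-0 []          r = zero-absorb r
    coeff-quotient-0 (a ∷ [])    r = absorb a r 0ᶜ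
    coeff-quotient-0 (a ∷ b ∷ p) r = absorb a r (eval (b ∷ p) r)

    coeff-quotient-suc : ∀ p r k → coeff p (suc k) ≋ᶜ coeff (quotient p r) k +ᶜ (-ᶜ r) *ᶜ coeff (quotient p r) (suc k)
    coeff-quotient-suc []          r k       = zero-absorb r
    coeff-quotient-suc (a ∷ [])    r k       = zero-absorb r
    coeff-quotient-suc (a ∷ b ∷ p) r zero    = coeff-quotient-0 (b ∷ p) r
    coeff-quotient-suc (a ∷ b ∷ p) r (suc k) = coeff-quotient-suc (b ∷ p) r k

    fromℕ≋κ : ∀ s → fromℕ s ≋ᶜ κ (ι (+ s))
    fromℕ≋κ s = ≋ᶜ-pointwise (λ _ → /1≡ι (+ s)) (λ _ → refl)

    private
      suc-apart : ∀ N k → Cancellableᶜ (fromℕ (suc k ℕ.+ N) - fromℕ N)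
      suc-apart N k y h = cancellable-fromℝ {fromℚ (ι (+ N))} {fromℚ (ι (+ (suc k ℕ.+ N)))}
        (pos-resp (≋-pointwise λ _ → difference) (pos-fromℚ (ι-pos k))) y
        (≋ᶜ-trans (*-congʳ (+-cong (≋ᶜ-sym (fromℕ≋κ (suc k ℕ.+ N))) (ℂR.-‿cong (≋ᶜ-sym (fromℕ≋κ N))))) h)
        where
        open ℚ-Solver.+-*-Solver
        difference : ι (+ suc k) ≡ ι (+ (suc k ℕ.+ N)) ℚ.- ι (+ N)
        difference = trans (solve 2 (λ a b → a := (a :+ b) :- b) refl (ι (+ suc k)) (ι (+ N)))
          (cong (λ t → t ℚ.- ι (+ N)) (sym (ι-+ (+ suc k) (+ N))))

    -- The zero at `N` splits off a factor `x - N`; the quotient is shorter and still vanishes at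
    -- `N + 1`, `N + 2` and so on. The shift `N` makes this an induction on the length.
    vanishing : ∀ ℓ p N → length p ≡ ℓ → (∀ k → eval p (fromℕ (k ℕ.+ N)) ≋ᶜ 0ᶜ) → ∀ k → coeff p k ≋ᶜ 0ᶜ
    vanishing ℓ       []      N l h k = ≋ᶜ-refl
    vanishing (suc ℓ) p@(a ∷ p′) N l h = result
      where
      r = fromℕ N
      q₀ = quotient p r
      q₀-vanishes : ∀ k → coeff q₀ k ≋ᶜ 0ᶜ
      q₀-vanishes = vanishing ℓ q₀ (suc N) (trans (length-quotient a p′ r) (ℕ.suc-injective l)) λ k →
        subst (λ m → eval q₀ (fromℕ m) ≋ᶜ 0ᶜ) (sym (ℕ.+-suc k N))
          (suc-apart N k (eval q₀ (fromℕ (suc k ℕ.+ N)))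
            (≋ᶜ-trans (≋ᶜ-sym (≋ᶜ-trans (eval-quotient p r (fromℕ (suc k ℕ.+ N)))
                (≋ᶜ-trans (+-congʳ (h 0)) (ℂR.+-identityˡ _))))
              (h (suc k))))
      zeros : ∀ {u v} → u ≋ᶜ 0ᶜ → v ≋ᶜ 0ᶜ → u +ᶜ (-ᶜ r) *ᶜ v ≋ᶜ 0ᶜ
      zeros e f = ≋ᶜ-trans (+-cong e (≋ᶜ-trans (*-congˡ f) (ℂR.zeroʳ (-ᶜ r)))) (ℂR.+-identityʳ 0ᶜ)
      result : ∀ k → coeff p k ≋ᶜ 0ᶜ
      result zero    = ≋ᶜ-trans (coeff-quotient-0 p r) (zeros (h 0) (q₀-vanishes 0))
      result (suc k) = ≋ᶜ-trans (coeff-quotient-suc p r k) (zeros (q₀-vanishes k) (q₀-vanishes (suc k)))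

    agreement : ∀ p q → (∀ s → eval p (fromℕ s) ≋ᶜ eval q (fromℕ s)) → ∀ k → coeff p k ≋ᶜ coeff q k
    agreement p q h k = ≋ᶜ-trans (≋ᶜ-sym (ℂR.+-identityʳ (coeff p k)))
      (≋ᶜ-trans (+-congˡ (≋ᶜ-sym (ℂR.-‿inverseˡ (coeff q k))))
        (≋ᶜ-trans (≋ᶜ-sym (ℂR.+-assoc (coeff p k) (-ᶜ coeff q k) (coeff q k)))
          (≋ᶜ-trans (+-congʳ difference) (ℂR.+-identityˡ (coeff q k)))))
      where
      minus : ℂ[x]
      minus = scale (-ᶜ 1ᶜ) q
      difference : coeff p k +ᶜ (-ᶜ coeff q k) ≋ᶜ 0ᶜ
      difference = ≋ᶜ-trans (≋ᶜ-sym (≋ᶜ-trans (coeff-+ₚ p minus k) (+-congˡ (≋ᶜ-trans (coeff-scale (-ᶜ 1ᶜ) q k) (ℂP.-1*x≈-x (coeff q k))))))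
        (vanishing (length (p +ₚ minus)) (p +ₚ minus) 0 refl (λ s →
          ≋ᶜ-trans (eval-+ₚ p minus (fromℕ (s ℕ.+ 0)))
            (≋ᶜ-trans (+-cong (h (s ℕ.+ 0)) (≋ᶜ-trans (eval-scale (-ᶜ 1ᶜ) q (fromℕ (s ℕ.+ 0))) (ℂP.-1*x≈-x (eval q (fromℕ (s ℕ.+ 0))))))
              (ℂR.-‿inverseʳ (eval q (fromℕ (s ℕ.+ 0)))))) k)

    eval-cong : ∀ p q → (∀ k → coeff p k ≋ᶜ coeff q k) → ∀ z → eval p z ≋ᶜ eval q z
    eval-cong []      []      h z = ≋ᶜ-refl
    eval-cong []      (b ∷ q) h z = ≋ᶜ-sym (≋ᶜ-trans (+-cong (≋ᶜ-sym (h 0)) (≋ᶜ-trans (*-congˡ (≋ᶜ-sym (eval-cong [] q (h ∘ suc) z))) (ℂR.zeroʳ z))) (ℂR.+-identityʳ 0ᶜ))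
    eval-cong (a ∷ p) []      h z = ≋ᶜ-trans (+-cong (h 0) (≋ᶜ-trans (*-congˡ (eval-cong p [] (h ∘ suc) z)) (ℂR.zeroʳ z))) (ℂR.+-identityʳ 0ᶜ)
    eval-cong (a ∷ p) (b ∷ q) h z = +-cong (h 0) (*-congˡ (eval-cong p q (h ∘ suc) z))

-- Values of the chain at y = i (2 s + 1) as lattice point counts

module ChainValues where
  open Reals
  open Expressions
  open OrthogonalChain
  open PartialSums using (D; D₁; E; Z; three-term; 2E; 2Z)
  open LatticeCount
  open ComplexPolynomials
  open import Data.Integer.Base using (1ℤ)
  open import Data.List.Base using (length)

  -- (-i)ᵏ p
  turn : ℕ → ℚ → ℂ
  turn zero          p = κ p
  turn (suc zero)    p = 0ʳ +i fromℚ (ℚ.- p)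
  turn (suc (suc k)) p = turn k (ℚ.- p)

  -- iᵏ p
  unturn : ℕ → ℚ → ℂ
  unturn zero          p = κ p
  unturn (suc zero)    p = 0ʳ +i fromℚ p
  unturn (suc (suc k)) p = unturn k (ℚ.- p)

  Y : ℚ → ℂ
  Y w = 0ʳ +i fromℚ w

  module _ where
    open ℚ-Solver.+-*-Solver

    turn-cong : ∀ k {p r} → p ≡ r → turn k p ≋ᶜ turn k r
    turn-cong k refl = ≋ᶜ-refl

    turn-+ : ∀ k p r → turn k p +ᶜ turn k r ≋ᶜ turn k (p ℚ.+ r)
    turn-+ zero          p r = ≋ᶜ-pointwise (λ _ → refl) (λ _ → refl)
    turn-+ (suc zero)    p r = ≋ᶜ-pointwise (λ _ → refl) (λ _ → sym (ℚ.neg-distrib-+ p r))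
    turn-+ (suc (suc k)) p r = ≋ᶜ-trans (turn-+ k (ℚ.- p) (ℚ.- r)) (turn-cong k (sym (ℚ.neg-distrib-+ p r)))

    turn-scale : ∀ k c p → κ c *ᶜ turn k p ≋ᶜ turn k (c ℚ.* p)
    turn-scale zero c p = ≋ᶜ-pointwise
      (λ _ → solve 2 (λ c p → c :* p :- con 0ℚ :* con 0ℚ := c :* p) refl c p)
      (λ _ → solve 2 (λ c p → c :* con 0ℚ :+ con 0ℚ :* p := con 0ℚ) refl c p)
    turn-scale (suc zero) c p = ≋ᶜ-pointwise
      (λ _ → solve 2 (λ c p → c :* con 0ℚ :- con 0ℚ :* (:- p) := con 0ℚ) refl c p)
      (λ _ → solve 2 (λ c p → c :* (:- p) :+ con 0ℚ :* con 0ℚ := :- (c :* p)) refl c p)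
    turn-scale (suc (suc k)) c p = ≋ᶜ-trans (turn-scale k c (ℚ.- p)) (turn-cong k (sym (ℚ.neg-distribʳ-* c p)))

    turn-Y : ∀ k w p → Y w *ᶜ turn (suc k) p ≋ᶜ turn k (w ℚ.* p)
    turn-Y zero w p = ≋ᶜ-pointwise
      (λ _ → solve 2 (λ w p → con 0ℚ :* con 0ℚ :- w :* (:- p) := w :* p) refl w p)
      (λ _ → solve 2 (λ w p → con 0ℚ :* (:- p) :+ w :* con 0ℚ := con 0ℚ) refl w p)
    turn-Y (suc zero) w p = ≋ᶜ-pointwise
      (λ _ → solve 2 (λ w p → con 0ℚ :* (:- p) :- w :* con 0ℚ := con 0ℚ) refl w p)
      (λ _ → solve 2 (λ w p → con 0ℚ :* con 0ℚ :+ w :* (:- p) := :- (w :* p)) refl w p)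
    turn-Y (suc (suc k)) w p = ≋ᶜ-trans (turn-Y k w (ℚ.- p)) (turn-cong k (sym (ℚ.neg-distribʳ-* w p)))

    unturn-turn : ∀ k p r → unturn k p *ᶜ turn k r ≋ᶜ κ (p ℚ.* r)
    unturn-turn zero p r = turn-scale 0 p r
    unturn-turn (suc zero) p r = ≋ᶜ-pointwise
      (λ _ → solve 2 (λ p r → con 0ℚ :* con 0ℚ :- p :* (:- r) := p :* r) refl p r)
      (λ _ → solve 2 (λ p r → con 0ℚ :* (:- r) :+ p :* con 0ℚ := con 0ℚ) refl p r)
    unturn-turn (suc (suc k)) p r = ≋ᶜ-trans (unturn-turn k (ℚ.- p) (ℚ.- r))
      (≋ᶜ-pointwise (λ _ → solve 2 (λ p r → :- p :* :- r := p :* r) refl p r) (λ _ → refl))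

    turn-neg : ∀ k p → κ (ℚ.- 1ℚ) *ᶜ turn k p ≋ᶜ turn (suc (suc k)) p
    turn-neg k p = ≋ᶜ-trans (turn-scale k (ℚ.- 1ℚ) p) (turn-cong k (solve 1 (λ p → con (ℚ.- 1ℚ) :* p := :- p) refl p))

    -- At `y = i w`, multiplication by y turns the power `k + 1` of `-i` into `w` times the power
    -- `k`. Both summands then carry the same power, and the outer `-1` is the square of `-i`. A
    -- step of the chain thus becomes a recurrence with plus signs, like that of `D`.
    turn-step : ∀ k w c {z u p r} → z ≋ᶜ turn (suc k) p → u ≋ᶜ turn k r →
             κ (ℚ.- 1ℚ) *ᶜ (Y w *ᶜ z +ᶜ κ c *ᶜ u) ≋ᶜ turn (suc (suc k)) (w ℚ.* p ℚ.+ c ℚ.* r)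
    turn-step k w c {z} {u} {p} {r} hz hu = ≋ᶜ-trans
      (ℂR.*-congˡ {κ (ℚ.- 1ℚ)} (≋ᶜ-trans
        (ℂR.+-cong (≋ᶜ-trans (ℂR.*-congˡ {Y w} hz) (turn-Y k w p)) (≋ᶜ-trans (ℂR.*-congˡ {κ c} hu) (turn-scale k c r)))
        (turn-+ k (w ℚ.* p) (c ℚ.* r))))
      (turn-neg k (w ℚ.* p ℚ.+ c ℚ.* r))

  fac : ℕ → ℤ
  fac zero    = 1ℤ
  fac (suc k) = + suc k ℤ.* fac k

  fac-pos : ∀ k → 0ℚ ℚ.< ι (fac k)
  fac-pos zero    = subst (0ℚ ℚ.<_) (sym ι-1) 0<1ℚ
  fac-pos (suc k) = subst (0ℚ ℚ.<_) (sym (ι-* (+ suc k) (fac k))) (0<* (ι-pos k) (fac-pos k))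

  odd : ℕ → ℤ
  odd s = + 2 ℤ.* + s ℤ.+ 1ℤ

  node : ℕ → ℂ
  node s = Y (ι (odd s))

  private
    ι-linear : ∀ a b c d → ι a ℚ.* ι b ℚ.+ ι c ℚ.* ι d ≡ ι (a ℤ.* b ℤ.+ c ℤ.* d)
    ι-linear a b c d = sym (trans (ι-+ (a ℤ.* b) (c ℤ.* d)) (cong₂ ℚ._+_ (ι-* a b) (ι-* c d)))

  value-q : ∀ s k → evalᶜ (q k) (node s) ≋ᶜ turn k (ι (fac k ℤ.* D k s))
  value-q s zero = ≋ᶜ-pointwise (λ _ → sym ι-1) (λ _ → refl)
  value-q s (suc zero) = ≋ᶜ-pointwise
    (λ _ → solve 1 (λ w → con (ℚ.- 1ℚ) :* con 0ℚ :- con 0ℚ :* w := con 0ℚ) refl (ι (odd s)))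
    (λ _ → trans (solve 1 (λ w → con (ℚ.- 1ℚ) :* w :+ con 0ℚ :* con 0ℚ := :- w) refl (ι (odd s)))
      (cong (λ t → ℚ.- ι t) (trans (sym (D₁ s)) (sym (ℤ.*-identityˡ (D 1 s))))))
    where open ℚ-Solver.+-*-Solver
  value-q s (suc (suc k)) = ≋ᶜ-trans
    (turn-step k (ι (odd s)) (square k) (value-q s (suc k)) (value-q s k))
    (turn-cong (suc (suc k)) (trans (cong (λ t → ι (odd s) ℚ.* ι (fac (suc k) ℤ.* D (suc k) s) ℚ.+ t ℚ.* ι (fac k ℤ.* D k s)) (sym (ι-* (+ suc k) (+ suc k))))
      (trans (ι-linear (odd s) (fac (suc k) ℤ.* D (suc k) s) (+ suc k ℤ.* + suc k) (fac k ℤ.* D k s))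
        (cong ι (trans
          (solve 5 (λ w k f d e → w :* (k :* f :* d) :+ k :* k :* (f :* e) := k :* f :* (w :* d :+ k :* e)) refl
            (odd s) (+ suc k) (fac k) (D (suc k) s) (D k s))
          (trans (cong (λ t → + suc k ℤ.* fac k ℤ.* t) (sym (three-term k s)))
            (solve 4 (λ k f l d → k :* f :* (l :* d) := l :* (k :* f) :* d) refl (+ suc k) (fac k) (+ suc (suc k)) (D (suc (suc k)) s))))))))
    where open ℤ-Solver.+-*-Solver

  αᶻ Aᶻ Bᶻ scaleᶻ : ℤ → ℤ
  αᶻ n = + 4 ℤ.* (n ℤ.* n) ℤ.+ + 18 ℤ.* n ℤ.+ + 12
  Aᶻ n = n ℤ.* n ℤ.+ + 11 ℤ.* n ℤ.+ + 6
  Bᶻ n = (n ℤ.+ 1ℤ) ℤ.* (+ 9 ℤ.* n ℤ.+ + 14)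
  scaleᶻ n = + 16 ℤ.* ((n ℤ.+ 1ℤ) ℤ.* (n ℤ.+ + 2))

  private
    -- A certificate of linear elimination with `N = (n + 1) (n + 2)`. The multiples `4 N`,
    -- `2 N (6 s + 3)` and `-2 N` of the first three equations remove `e` and `z`. The multiples
    -- `-2 n (n + 1)` and `-2 n (2 s + 1)` of the last two remove `d₂` and `d₁`, which stand for
    -- `D (n + 2)` and `D (n + 1)`; what remains are `a = D n` and `b = D (n - 1)`.
    eliminate : ∀ n s c z e a b d₁ d₂ →
      (let w = + 2 ℤ.* s ℤ.+ 1ℤ) →
      + 4 ℤ.* c ℤ.+ z ≡ (+ 3 ℤ.* (s ℤ.* s) ℤ.+ 1ℤ) ℤ.* a ℤ.+ (+ 6 ℤ.* s ℤ.+ + 3) ℤ.* e →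
      + 2 ℤ.* e ≡ a ℤ.+ b →
      + 2 ℤ.* z ≡ n ℤ.* (d₂ ℤ.- a) →
      (1ℤ ℤ.+ (1ℤ ℤ.+ n)) ℤ.* d₂ ≡ w ℤ.* d₁ ℤ.+ (1ℤ ℤ.+ n) ℤ.* a →
      (1ℤ ℤ.+ n) ℤ.* d₁ ≡ w ℤ.* a ℤ.+ n ℤ.* b →
      scaleᶻ n ℤ.* c ≡ αᶻ n ℤ.* (w ℤ.* (w ℤ.* a ℤ.+ b)) ℤ.+ (Bᶻ n ℤ.- Aᶻ n ℤ.* (w ℤ.* w)) ℤ.* a
    eliminate n s c z e a b d₁ d₂ h₁ h₂ h₃ h₄ h₅ = ℤ.i-j≡0⇒i≡j _ _ (trans
      (solve 9 (λ n s c z e a b d₁ d₂ →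
          let w = con (+ 2) :* s :+ con 1ℤ
              N = (n :+ con 1ℤ) :* (n :+ con (+ 2))
              α = con (+ 4) :* (n :* n) :+ con (+ 18) :* n :+ con (+ 12)
              A = n :* n :+ con (+ 11) :* n :+ con (+ 6)
              B = (n :+ con 1ℤ) :* (con (+ 9) :* n :+ con (+ 14))
              six = con (+ 6) :* s :+ con (+ 3)
          in con (+ 16) :* N :* c :- (α :* (w :* (w :* a :+ b)) :+ (B :- A :* (w :* w)) :* a)
             := con (+ 4) :* N :* (con (+ 4) :* c :+ z :- ((con (+ 3) :* (s :* s) :+ con 1ℤ) :* a :+ six :* e))
                :+ con (+ 2) :* N :* six :* (con (+ 2) :* e :- (a :+ b))
                :- con (+ 2) :* N :* (con (+ 2) :* z :- n :* (d₂ :- a))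
                :- con (+ 2) :* n :* (n :+ con 1ℤ) :* ((con 1ℤ :+ (con 1ℤ :+ n)) :* d₂ :- (w :* d₁ :+ (con 1ℤ :+ n) :* a))
                :- con (+ 2) :* n :* w :* ((con 1ℤ :+ n) :* d₁ :- (w :* a :+ n :* b)))
        refl n s c z e a b d₁ d₂)
      (trans (cong₂ ℤ._-_ (cong₂ ℤ._-_ (cong₂ ℤ._-_ (cong₂ ℤ._+_
          (times (+ 4 ℤ.* N) h₁) (times (+ 2 ℤ.* N ℤ.* (+ 6 ℤ.* s ℤ.+ + 3)) h₂)) (times (+ 2 ℤ.* N) h₃))
          (times (+ 2 ℤ.* n ℤ.* (n ℤ.+ 1ℤ)) h₄)) (times (+ 2 ℤ.* n ℤ.* (+ 2 ℤ.* s ℤ.+ 1ℤ)) h₅)) refl))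
      where
      open ℤ-Solver.+-*-Solver
      N = (n ℤ.+ 1ℤ) ℤ.* (n ℤ.+ + 2)
      times : ∀ k {x y} → x ≡ y → k ℤ.* (x ℤ.- y) ≡ ℤ.0ℤ
      times k {x} refl = trans (cong (k ℤ.*_) (ℤ.+-inverseʳ x)) (ℤ.*-zeroʳ k)

  module _ (k s : ℕ) where
    private
      n = suc k
      ν = + n
      w = odd s
      c₂ = + length (points 1 {n} s)
      c₃ = + length (points 2 {n} s)

    twice-count₂ : + 2 ℤ.* c₂ ≡ w ℤ.* D n s ℤ.+ D k s
    twice-count₂ = trans (cong (+ 2 ℤ.*_) (count₂ n s))
      (trans (solve 3 (λ s d e → con (+ 2) :* (s :* d :+ e) := con (+ 2) :* s :* d :+ con (+ 2) :* e) refl (+ s) (D n s) (E n s))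
        (trans (cong (λ t → + 2 ℤ.* + s ℤ.* D n s ℤ.+ t) (2E k s))
          (solve 3 (λ s d e → con (+ 2) :* s :* d :+ (d :+ e) := (con (+ 2) :* s :+ con 1ℤ) :* d :+ e) refl (+ s) (D n s) (D k s))))
      where open ℤ-Solver.+-*-Solver

    scaled-count₃ : scaleᶻ ν ℤ.* c₃ ≡ αᶻ ν ℤ.* (w ℤ.* (w ℤ.* D n s ℤ.+ D k s)) ℤ.+ (Bᶻ ν ℤ.- Aᶻ ν ℤ.* (w ℤ.* w)) ℤ.* D n s
    scaled-count₃ = eliminate ν (+ s) c₃ (Z n s) (E n s) (D n s) (D k s) (D (suc n) s) (D (suc (suc n)) s)
      (count₃ n s) (2E k s) (2Z n s) (three-term n s) (three-term k s)

    private
      lit≡ι : ∀ m → lit m ≡ ι (+ m)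
      lit≡ι m = /1≡ι (+ m)

      ι-coeffα : coeffα (ι ν) ≡ ι (αᶻ ν)
      ι-coeffα = sym (trans (ι-+ (+ 4 ℤ.* (ν ℤ.* ν) ℤ.+ + 18 ℤ.* ν) (+ 12)) (cong₂ ℚ._+_
        (trans (ι-+ (+ 4 ℤ.* (ν ℤ.* ν)) (+ 18 ℤ.* ν)) (cong₂ ℚ._+_
          (trans (ι-* (+ 4) (ν ℤ.* ν)) (cong₂ ℚ._*_ (sym (lit≡ι 4)) (ι-* ν ν)))
          (trans (ι-* (+ 18) ν) (cong (ℚ._* ι ν) (sym (lit≡ι 18))))))
        (sym (lit≡ι 12))))

      ι-coeffA : coeffA (ι ν) ≡ ι (Aᶻ ν)
      ι-coeffA = sym (trans (ι-+ (ν ℤ.* ν ℤ.+ + 11 ℤ.* ν) (+ 6)) (cong₂ ℚ._+_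
        (trans (ι-+ (ν ℤ.* ν) (+ 11 ℤ.* ν)) (cong₂ ℚ._+_ (ι-* ν ν)
          (trans (ι-* (+ 11) ν) (cong (ℚ._* ι ν) (sym (lit≡ι 11))))))
        (sym (lit≡ι 6))))

      ι-coeffB : coeffB (ι ν) ≡ ι (Bᶻ ν)
      ι-coeffB = sym (trans (ι-* (ν ℤ.+ 1ℤ) (+ 9 ℤ.* ν ℤ.+ + 14)) (cong₂ ℚ._*_
        (trans (ι-+ ν 1ℤ) (cong (ι ν ℚ.+_) ι-1))
        (trans (ι-+ (+ 9 ℤ.* ν) (+ 14)) (cong₂ ℚ._+_
          (trans (ι-* (+ 9) ν) (cong (ℚ._* ι ν) (sym (lit≡ι 9)))) (sym (lit≡ι 14))))))

    value-F : evalᶜ (F n) (node s) ≋ᶜ turn (suc n) (ι (+ 2 ℤ.* fac n) ℚ.* ι c₂)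
    value-F = ≋ᶜ-trans (turn-step k (ι w) (ι ν) (value-q s n) (value-q s k))
      (turn-cong (suc n) (trans (ι-linear w (fac n ℤ.* D n s) ν (fac k ℤ.* D k s))
        (trans (cong ι (trans
            (solve 5 (λ w n f d e → w :* (n :* f :* d) :+ n :* (f :* e) := n :* f :* (w :* d :+ e)) refl w ν (fac k) (D n s) (D k s))
            (trans (cong (fac n ℤ.*_) (sym twice-count₂))
              (solve 2 (λ f c → f :* (con (+ 2) :* c) := con (+ 2) :* f :* c) refl (fac n) c₂))))
          (ι-* (+ 2 ℤ.* fac n) c₂))))
      where open ℤ-Solver.+-*-Solver

    -- At the node `y² = -w²`, so the coefficient `A y² + B` becomes `B - A w²`, as in
    -- `scaled-count₃`.
    value-G : evalᶜ (G n) (node s) ≋ᶜ turn (suc (suc n)) (ι (scaleᶻ ν ℤ.* fac n) ℚ.* ι c₃)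
    value-G = ≋ᶜ-trans (ℂR.*-congˡ {κ (ℚ.- 1ℚ)} (≋ᶜ-trans (ℂR.+-cong first second) (turn-+ n p₁ p₂)))
      (≋ᶜ-trans (turn-neg n (p₁ ℚ.+ p₂)) (turn-cong (suc (suc n)) total≡c₃))
      where
      f g p₁ p₂ : ℚ
      f = ι (+ 2 ℤ.* fac n) ℚ.* ι c₂
      g = ι (fac n ℤ.* D n s)
      p₁ = coeffα (ι ν) ℚ.* (ι w ℚ.* f)
      p₂ = (coeffB (ι ν) ℚ.- coeffA (ι ν) ℚ.* (ι w ℚ.* ι w)) ℚ.* g
      first : (κ (coeffα (ι ν)) *ᶜ Y (ι w)) *ᶜ evalᶜ (F n) (node s) ≋ᶜ turn n p₁
      first = ≋ᶜ-trans (ℂR.*-assoc (κ (coeffα (ι ν))) (Y (ι w)) (evalᶜ (F n) (node s)))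
        (≋ᶜ-trans (ℂR.*-congˡ {κ (coeffα (ι ν))} (≋ᶜ-trans (ℂR.*-congˡ {Y (ι w)} value-F) (turn-Y n (ι w) f)))
          (turn-scale n (coeffα (ι ν)) (ι w ℚ.* f)))
      P≋ : κ (coeffA (ι ν)) *ᶜ (Y (ι w) *ᶜ Y (ι w)) +ᶜ κ (coeffB (ι ν)) ≋ᶜ κ (coeffB (ι ν) ℚ.- coeffA (ι ν) ℚ.* (ι w ℚ.* ι w))
      P≋ = ≋ᶜ-pointwise
        (λ _ → solve 3 (λ a b w → a :* (con 0ℚ :* con 0ℚ :- w :* w) :- con 0ℚ :* (con 0ℚ :* w :+ w :* con 0ℚ) :+ b := b :- a :* (w :* w)) refl
          (coeffA (ι ν)) (coeffB (ι ν)) (ι w))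
        (λ _ → solve 2 (λ a w → a :* (con 0ℚ :* w :+ w :* con 0ℚ) :+ con 0ℚ :* (con 0ℚ :* con 0ℚ :- w :* w) :+ con 0ℚ := con 0ℚ) refl
          (coeffA (ι ν)) (ι w))
        where open ℚ-Solver.+-*-Solver
      second : (κ (coeffA (ι ν)) *ᶜ (Y (ι w) *ᶜ Y (ι w)) +ᶜ κ (coeffB (ι ν))) *ᶜ evalᶜ (q n) (node s) ≋ᶜ turn n p₂
      second = ≋ᶜ-trans (ℂR.*-cong P≋ (value-q s n)) (turn-scale n (coeffB (ι ν) ℚ.- coeffA (ι ν) ℚ.* (ι w ℚ.* ι w)) g)
      total≡c₃ : p₁ ℚ.+ p₂ ≡ ι (scaleᶻ ν ℤ.* fac n) ℚ.* ι c₃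
      total≡c₃ = trans (cong₂ ℚ._+_
          (cong₂ (λ u v → u ℚ.* (ι w ℚ.* v)) ι-coeffα (sym (ι-* (+ 2 ℤ.* fac n) c₂)))
          (cong₂ (λ u v → (u ℚ.- v ℚ.* (ι w ℚ.* ι w)) ℚ.* g) ι-coeffB ι-coeffA))
        (trans (cong₂ ℚ._+_
            (trans (cong (ι (αᶻ ν) ℚ.*_) (sym (ι-* w (+ 2 ℤ.* fac n ℤ.* c₂)))) (sym (ι-* (αᶻ ν) (w ℤ.* (+ 2 ℤ.* fac n ℤ.* c₂)))))
            (trans (cong (ℚ._* g) (trans (cong (λ t → ι (Bᶻ ν) ℚ.- t) (trans (cong (ι (Aᶻ ν) ℚ.*_) (sym (ι-* w w))) (sym (ι-* (Aᶻ ν) (w ℤ.* w)))))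
                (trans (cong (ι (Bᶻ ν) ℚ.+_) (sym (ι-neg (Aᶻ ν ℤ.* (w ℤ.* w))))) (sym (ι-+ (Bᶻ ν) (ℤ.- (Aᶻ ν ℤ.* (w ℤ.* w))))))))
              (sym (ι-* (Bᶻ ν ℤ.- Aᶻ ν ℤ.* (w ℤ.* w)) (fac n ℤ.* D n s)))))
        (trans (sym (ι-+ (αᶻ ν ℤ.* (w ℤ.* (+ 2 ℤ.* fac n ℤ.* c₂))) ((Bᶻ ν ℤ.- Aᶻ ν ℤ.* (w ℤ.* w)) ℤ.* (fac n ℤ.* D n s))))
        (trans (cong ι integers) (ι-* (scaleᶻ ν ℤ.* fac n) c₃))))
        where
        open ℤ-Solver.+-*-Solver
        integers : αᶻ ν ℤ.* (w ℤ.* (+ 2 ℤ.* fac n ℤ.* c₂)) ℤ.+ (Bᶻ ν ℤ.- Aᶻ ν ℤ.* (w ℤ.* w)) ℤ.* (fac n ℤ.* D n s) ≡ scaleᶻ ν ℤ.* fac n ℤ.* c₃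
        integers = trans
          (solve 6 (λ α w f c b d → α :* (w :* (con (+ 2) :* f :* c)) :+ b :* (f :* d) := f :* (α :* (w :* (con (+ 2) :* c)) :+ b :* d)) refl
            (αᶻ ν) w (fac n) c₂ (Bᶻ ν ℤ.- Aᶻ ν ℤ.* (w ℤ.* w)) (D n s))
          (trans (cong (λ t → fac n ℤ.* (αᶻ ν ℤ.* (w ℤ.* t) ℤ.+ (Bᶻ ν ℤ.- Aᶻ ν ℤ.* (w ℤ.* w)) ℤ.* D n s)) twice-count₂)
            (trans (cong (fac n ℤ.*_) (sym scaled-count₃))
              (solve 3 (λ f s c → f :* (s :* c) := s :* f :* c) refl (fac n) (scaleᶻ ν) c₃)))

-- Transfer to the Ehrhart polynomials and the critical line

open Reals
open Expressions
open Interlacing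
open OrthogonalChain
open PartialSums using (D; E; Z; D-0)
open LatticeCount
open EdgePolytope
open ComplexPolynomials
open ChainValues
open import Data.Integer.Base using (1ℤ)
open import Data.Fin.Base as Fin using (Fin; toℕ)
import Data.Fin.Properties as Fin
open import Data.List.Base using (length)
open import Data.List.Membership.Propositional using (_∈_)
open import Data.List.Membership.Propositional.Properties.WithK using (unique∧set⇒bag)
open import Data.List.Relation.Binary.BagAndSetEquality using (∼bag⇒↭)
open import Data.List.Relation.Binary.Permutation.Propositional.Properties using (↭-length)
open import Data.Vec.Base as Vec using (Vec)
open import Function.Bundles using (_⇔_; mk⇔; Equivalence)

module _ (a n : ℕ) (s : ℕ) where
  private
    Lattice : Vec ℤ (suc a ℕ.+ suc n) → Set
    Lattice = LatticePoint (Dilate s (SymmetricEdgePolytope (K (suc a) (suc n))))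

  lattice⇔points : ∀ u → Lattice u ⇔ u ∈ points a {suc n} s
  lattice⇔points u with Vec.splitAt (suc a) u
  ... | x , y , refl = mk⇔
    (λ h → ∈-points⁺ a s x y (lattice⇒balanced s x y h))
    (λ h → balanced⇒lattice a n s x y (∈-points⁻ a s x y h))

  -- Duplicate-free lists with the same members are permutations of each other, so any enumeration
  -- of the lattice points is as long as the explicit one.
  lattice-count : ∀ {k} → HasCardinality Lattice k → k ≡ length (points a {suc n} s)
  lattice-count (xs , uxs , h , refl) = ↭-length (∼bag⇒↭ (unique∧set⇒bag uxs (unique-points a s) λ {u} → mk⇔
    (λ u∈ → Equivalence.to (lattice⇔points u) (Equivalence.from (h u) u∈))
    (λ u∈ → Equivalence.to (h u) (Equivalence.from (lattice⇔points u) u∈))))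

ehrhart-value : ∀ a n H → IsEhrhartPolynomial (K (suc a) (suc n)) H →
  ∀ s → eval H (fromℕ s) ≋ᶜ κ (ι (+ length (points a {suc n} s)))
ehrhart-value a n H h s = let k , card , e = h s in
  ≋ᶜ-trans (to≋ᶜ e) (subst (λ m → fromℕ k ≋ᶜ κ (ι (+ m))) (lattice-count a n s card) (fromℕ≋κ k))

private
  E-0 : ∀ n → E n 0 ≡ 1ℤ
  E-0 zero    = refl
  E-0 (suc n) = trans (ℤ.+-identityˡ (E n 0)) (E-0 n)

  Z-0 : ∀ n → Z n 0 ≡ ℤ.0ℤ
  Z-0 zero    = refl
  Z-0 (suc n) = trans (ℤ.+-identityʳ (ℤ.0ℤ ℤ.+ Z n 0)) (trans (ℤ.+-identityˡ (Z n 0)) (Z-0 n))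

-- The Ehrhart polynomial has value 1 at 0, which later excludes a vanishing leading coefficient.
origin₂ : ∀ n → + length (points 1 {n} 0) ≡ 1ℤ
origin₂ n = trans (count₂ n 0) (trans (ℤ.+-identityˡ (E n 0)) (E-0 n))

origin₃ : ∀ n → + length (points 2 {n} 0) ≡ 1ℤ
origin₃ n = ℤ.*-cancelˡ-≡ (+ 4) _ 1ℤ (trans (sym (ℤ.+-identityʳ _))
  (trans (cong (λ t → + 4 ℤ.* + length (points 2 {n} 0) ℤ.+ t) (sym (Z-0 n)))
    (trans (count₃ n 0) (cong₂ (λ d e → 1ℤ ℤ.* d ℤ.+ + 3 ℤ.* e) (D-0 n) (E-0 n)))))

-- The direction `-i / 2`, instead of `i / 2`, makes the real parameter of a point on the line equal
-- to y itself.
α₀ β₀ : ℂ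
α₀ = κ (ℚ.- ½)
β₀ = 0ʳ +i fromℚ (ℚ.- ½)

module _ where
  open ℚ-Solver.+-*-Solver

  re-pointOn : ∀ t n → seq (re (pointOn α₀ β₀ t)) n ≡ ℚ.- ½
  re-pointOn t n = solve 1 (λ t → con (ℚ.- ½) :+ (t :* con 0ℚ :- con 0ℚ :* con (ℚ.- ½)) := con (ℚ.- ½)) refl (seq t n)

  im-pointOn : ∀ t n → seq (im (pointOn α₀ β₀ t)) n ≡ (ℚ.- ½) ℚ.* seq t n
  im-pointOn t n = solve 1 (λ t → con 0ℚ :+ (t :* con (ℚ.- ½) :+ con 0ℚ :* con 0ℚ) := con (ℚ.- ½) :* t) refl (seq t n)

  on-line : ∀ z → R z ⇔ (∃[ t ] z ≈ᶜ pointOn α₀ β₀ t)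
  on-line z = mk⇔
    (λ h → fromℚ (ℚ.- lit 2) *ʳ im z , un≋ᶜ {z} {pointOn α₀ β₀ (fromℚ (ℚ.- lit 2) *ʳ im z)} (mk≋ᶜ
      (≋-trans {re z} {fromℚ (ℚ.- ½)} (mk≋ h) (≋-pointwise λ n → sym (re-pointOn (fromℚ (ℚ.- lit 2) *ʳ im z) n)))
      (≋-pointwise λ n → sym (trans (im-pointOn (fromℚ (ℚ.- lit 2) *ʳ im z) n)
        (solve 1 (λ y → con (ℚ.- ½) :* (con (ℚ.- lit 2) :* y) := y) refl (seq (im z) n))))))
    (λ { (t , h , _) → un≋ {re z} {fromℚ (ℚ.- ½)} (≋-trans {re z} {re (pointOn α₀ β₀ t)} (mk≋ h) (≋-pointwise (re-pointOn t))) })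

  β₀≉0 : β₀ ≉0
  β₀≉0 = Pos⇒0<ʳ {∣ β₀ ∣²} (pos-resp {fromℚ (½ ℚ.* ½)} (≋-pointwise λ _ → refl) (pos-fromℚ (ℚ.positive⁻¹ (½ ℚ.* ½))))

  -- t - i (2 s + 1) = -2 i (s - (-1/2 - i t/2))
  node-difference : ∀ s t → ℂR._-_ (fromℝ t) (node s) ≋ᶜ Y (ℚ.- lit 2) *ᶜ (ℂR._-_ (fromℕ s) (pointOn α₀ β₀ t))
  node-difference s t = ≋ᶜ-trans
    (≋ᶜ-pointwise {fromℝ t +ᶜ (-ᶜ node s)} {Y (ℚ.- lit 2) *ᶜ (fromℕ′ +ᶜ (-ᶜ point′))}
      (λ n → solve 2 (λ s t → t :- con 0ℚ := con 0ℚ :* (s :- con (ℚ.- ½)) :- con (ℚ.- lit 2) :* (con 0ℚ :- con (ℚ.- ½) :* t)) refl (ι (+ s)) (seq t n))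
      (λ n → trans (cong (λ w → 0ℚ ℚ.- w) w≡)
        (solve 2 (λ s t → con 0ℚ :- (con (lit 2) :* s :+ con 1ℚ)
          := con 0ℚ :* (con 0ℚ :- con (ℚ.- ½) :* t) :+ con (ℚ.- lit 2) :* (s :- con (ℚ.- ½))) refl (ι (+ s)) (seq t n))))
    (ℂR.*-congˡ {Y (ℚ.- lit 2)} {fromℕ′ +ᶜ (-ᶜ point′)} (ℂR.+-cong (≋ᶜ-sym (fromℕ≋κ s))
      (ℂR.-‿cong (≋ᶜ-pointwise (λ n → sym (re-pointOn t n)) (λ n → sym (im-pointOn t n))))))
    where
    fromℕ′ point′ : ℂ
    fromℕ′ = κ (ι (+ s))
    point′ = fromℚ (ℚ.- ½) +i (fromℚ (ℚ.- ½) *ʳ t)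
    w≡ : ι (odd s) ≡ lit 2 ℚ.* ι (+ s) ℚ.+ 1ℚ
    w≡ = trans (ι-+ (+ 2 ℤ.* + s) 1ℤ) (cong₂ ℚ._+_ (trans (ι-* (+ 2) (+ s)) (cong (ℚ._* ι (+ s)) (sym (/1≡ι (+ 2))))) ι-1)

-- Stated once for both pairs, `F` with H₂ₙ and `G` with H₃ₙ: real zeros of `e` in y become zeros of
-- `H` on the line, although `H` is tied to `e` only through the counts at the naturals.
module OnLine (m : ℕ) (e : Expr) (u : ℕ → ℝ) (count : ℕ → ℕ) (N : ℚ) (H : ℂ[x])
  (degree : IsPolyᶜ m (evalᶜ e))
  (zeros : ∀ i → i ℕ.< m → evalℝ e (u i) ≋ 0ʳ)
  (apart : ∀ i j → i ℕ.< j → j ℕ.< m → u i ⋖ u j)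
  (N>0 : 0ℚ ℚ.< N)
  (value : ∀ s → evalᶜ e (node s) ≋ᶜ turn m (N ℚ.* ι (+ count s)))
  (origin : + count 0 ≡ 1ℤ)
  (H-value : ∀ s → eval H (fromℕ s) ≋ᶜ κ (ι (+ count s)))
  where

  ρ : ℕ → ℂ
  ρ j = pointOn α₀ β₀ (u j)

  factors : ∃[ c ] ∀ s → evalᶜ e (node s) ≋ᶜ c *ᶜ prodᶜ m (λ j → ℂR._-_ (fromℕ s) (ρ j))
  factors =
    let c , h = factorizationᶜ m (fromℝ ∘ u) degree
          (λ i i<m → ≋ᶜ-trans (evalᶜ-fromℝ e (u i)) (mk≋ᶜ (zeros i i<m) ≋-refl))
          (λ i j i<j j<m → cancellable-fromℝ (apart i j i<j j<m))
    -- Each of the `m` factors contributes `-2 i` in the change of variable from y to `s`.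
    in c *ᶜ prodᶜ m (λ _ → Y (ℚ.- lit 2)) , λ s →
      let c′ , p , e = prodᶜ-scale m (Y (ℚ.- lit 2)) (λ j → ℂR._-_ (fromℕ s) (ρ j))
      in ≋ᶜ-trans (h (node s)) (≋ᶜ-trans
           (ℂR.*-congˡ {c} (≋ᶜ-trans (prodᶜ-cong m λ j _ → node-difference s (u j)) (≋ᶜ-trans p (ℂR.*-congʳ e))))
           (≋ᶜ-sym (ℂR.*-assoc c (prodᶜ m λ _ → Y (ℚ.- lit 2)) (prodᶜ m λ j → ℂR._-_ (fromℕ s) (ρ j)))))

  inverse : ∃[ M ] 0ℚ ℚ.< M × N ℚ.* M ≡ 1ℚ
  inverse = divide N>0 0<1ℚ

  C : ℂ
  C = unturn m (proj₁ inverse) *ᶜ proj₁ factors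

  H-factors : ∀ s → eval H (fromℕ s) ≋ᶜ C *ᶜ prodᶜ m (λ j → ℂR._-_ (fromℕ s) (ρ j))
  H-factors s = ≋ᶜ-trans (H-value s) (≋ᶜ-trans
    (≋ᶜ-pointwise
      (λ _ → trans (sym (ℚ.*-identityˡ x)) (trans (cong (ℚ._* x) (sym (trans (ℚ.*-comm M N) (proj₂ (proj₂ inverse))))) (ℚ.*-assoc M N x)))
      (λ _ → refl))
    (≋ᶜ-trans (≋ᶜ-sym (unturn-turn m M (N ℚ.* x)))
      (≋ᶜ-trans (ℂR.*-congˡ {unturn m M} (≋ᶜ-trans (≋ᶜ-sym (value s)) (proj₂ factors s)))
        (≋ᶜ-sym (ℂR.*-assoc (unturn m M) (proj₁ factors) (prodᶜ m λ j → ℂR._-_ (fromℕ s) (ρ j)))))))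
    where
    M x : ℚ
    M = proj₁ inverse
    x = ι (+ count s)

  -- The value of `H` at 0 is 1, and the factorization there exhibits `C` as a unit.
  C≉0 : Pos ∣ C ∣²
  C≉0 = unit⇒≉0 C (prodᶜ m λ j → ℂR._-_ (fromℕ 0) (ρ j))
    (≋ᶜ-trans (≋ᶜ-sym (H-factors 0)) (≋ᶜ-trans (H-value 0)
      (≋ᶜ-pointwise (λ _ → trans (cong ι origin) ι-1) (λ _ → refl))))

  monic : ℂ[x]
  monic = ∏[x-_] {m} (ρ ∘ toℕ)

  coefficients : ∀ k → coeff H k ≋ᶜ coeff (scale C monic) k
  coefficients = agreement H (scale C monic) λ s → ≋ᶜ-trans (H-factors s)
    (≋ᶜ-sym (≋ᶜ-trans (eval-scale C monic (fromℕ s)) (ℂR.*-congˡ {C} (eval-∏ m ρ (fromℕ s)))))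

  zerosOf : ZerosOf_Are_ {m} H (pointOn α₀ β₀ ∘ u ∘ toℕ)
  zerosOf = C , Pos⇒0<ʳ C≉0 , λ k → un≋ᶜ (coefficients k)

  prod-cancel : ∀ m (v : ℕ → ℂ) → (∀ j → Cancellableᶜ (v j)) → prodᶜ m v ≋ᶜ 0ᶜ → 1ᶜ ≋ᶜ 0ᶜ
  prod-cancel zero    v h e = e
  prod-cancel (suc m) v h e = prod-cancel m (v ∘ suc) (h ∘ suc) (h 0 (prodᶜ m (v ∘ suc)) e)

  -- A vanishing product does not reveal which factor vanishes. But if `re z` were apart from -1/2,
  -- every factor `z - ρ j` would be apart from 0 and could be cancelled, leaving `1 = 0`. Tightness
  -- of apartness then gives the equality.
  allZeros : AllZerosOn R H
  allZeros z Hz = un≋ {re z} {fromℚ (ℚ.- ½)} (≋-trans {y = fromℚ (ℚ.- ½) +ʳ a}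
      (≋-pointwise λ n → solve 1 (λ x → x := con (ℚ.- ½) :+ (x :- con (ℚ.- ½))) refl (seq (re z) n))
      (≋-trans (+ʳ-cong ≋-refl (¬apart⇒≋0 a (absurd ∘ pos-square) (absurd ∘ pos-square-neg))) (≋-pointwise λ _ → refl)))
    where
    open ℚ-Solver.+-*-Solver
    a : ℝ
    a = re z -ʳ fromℚ (ℚ.- ½)
    product : prodᶜ m (λ j → ℂR._-_ z (ρ j)) ≋ᶜ 0ᶜ
    product = cancellableᶜ C≉0 _ (≋ᶜ-trans (≋ᶜ-sym (≋ᶜ-trans (eval-cong H (scale C monic) coefficients z)
      (≋ᶜ-trans (eval-scale C monic z) (ℂR.*-congˡ {C} (eval-∏ m ρ z))))) (to≋ᶜ Hz))
    absurd : Pos (a *ʳ a) → ⊥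
    absurd h = 1≢0 (fromℚ-injective (re≋ (prod-cancel m (λ j → ℂR._-_ z (ρ j)) factor-apart product)))
      where
      1≢0 : 1ℚ ≡ 0ℚ → ⊥
      1≢0 ()
      factor-apart : ∀ j → Cancellableᶜ (ℂR._-_ z (ρ j))
      factor-apart j = cancellableᶜ (pos-+-nonNeg
        (pos-resp (*ʳ-cong a≋ a≋) h) (λ n → square≥0 (seq (im (ℂR._-_ z (ρ j))) n)))
        where
        a≋ : a ≋ re (ℂR._-_ z (ρ j))
        a≋ = ≋-pointwise λ n → cong (λ t → seq (re z) n ℚ.- t) (sym (re-pointOn (u j) n))

module _ (k : ℕ) (H₃ H₂ : ℂ[x])
  (h₃ : IsEhrhartPolynomial (K 3 (suc k)) H₃) (h₂ : IsEhrhartPolynomial (K 2 (suc k)) H₂)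
  {L : ℚ} (t s : ℕ → ℝ)
  (t-zeros : AlternatesOnZeros L (suc (suc (suc k))) (G (suc k)) (F (suc k)) t)
  (s-zeros : AlternatesOnZeros L (suc (suc k)) (F (suc k)) (q (suc k)) s)
  (interlace : ∀ i → i ℕ.< suc (suc k) → t i ⋖ s i × s i ⋖ t (suc i))
  where
  private
    n = suc k
    module T = AlternatesOnZeros t-zeros
    module S = AlternatesOnZeros s-zeros

    scale₂>0 : 0ℚ ℚ.< ι (+ 2 ℤ.* fac n)
    scale₂>0 = subst (0ℚ ℚ.<_) (sym (ι-* (+ 2) (fac n))) (0<* (ι-pos 1) (fac-pos n))

    scale₃>0 : 0ℚ ℚ.< ι (scaleᶻ (+ n) ℤ.* fac n)
    scale₃>0 = subst (0ℚ ℚ.<_) (sym (ι-* (scaleᶻ (+ n)) (fac n))) (0<* (ι-pos _) (fac-pos n))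

    module S-line = OnLine (suc n) (F n) s (λ s → length (points 1 {n} s)) (ι (+ 2 ℤ.* fac n)) H₂
      (Degreeᶜ.isPoly-F k) S.zeros (λ i j i<j j<m → S.mono-< i<j (ℕ.<⇒≤ j<m))
      scale₂>0 (value-F k) (origin₂ n) (ehrhart-value 1 k H₂ h₂)

    module T-line = OnLine (suc (suc n)) (G n) t (λ s → length (points 2 {n} s)) (ι (scaleᶻ (+ n) ℤ.* fac n)) H₃
      (Degreeᶜ.isPoly-G k) T.zeros (λ i j i<j j<m → T.mono-< i<j (ℕ.<⇒≤ j<m))
      scale₃>0 (value-G k) (origin₃ n) (ehrhart-value 2 k H₃ h₃)

  zeros-interlace : AllZerosOn R H₃ × H₃ IsInterlaced[ R ]By H₂
  zeros-interlace = T-line.allZeros , record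
    { α = α₀ ; β = β₀ ; β≉0 = β₀≉0 ; line = on-line
    ; d = suc n ; t = t ∘ toℕ ; s = s ∘ toℕ
    ; zeros-f = T-line.zerosOf ; zeros-g = S-line.zerosOf
    ; t≤s = λ i → subst (λ j → t j ≤ʳ s (toℕ i)) (sym (Fin.toℕ-inject₁ i))
        (⋖⇒≤ʳ {t (toℕ i)} {s (toℕ i)} (proj₁ (interlace (toℕ i) (Fin.toℕ<n i))))
    ; s≤t = λ i → ⋖⇒≤ʳ {s (toℕ i)} {t (suc (toℕ i))} (proj₂ (interlace (toℕ i) (Fin.toℕ<n i))) }

theorem4p9 : (n : ℕ) → 1 ≤ n → (H₃ₙ H₂ₙ : ℂ[x]) →
    IsEhrhartPolynomial (K 3 n) H₃ₙ → IsEhrhartPolynomial (K 2 n) H₂ₙ →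
    AllZerosOn R H₃ₙ × H₃ₙ IsInterlaced[ R ]By H₂ₙ
theorem4p9 (suc k) _ H₃ H₂ h₃ h₂ =
  let t , s , t-zeros , s-zeros , interlace = real-interlacing k
  in zeros-interlace k H₃ H₂ h₃ h₂ t s t-zeros s-zeros interlace
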